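{- Let $p$ be an odd prime. If $p\equiv1\pmod4$, write $p=x^2+4y^2$ with integers $x,y$ and $4\mid x-1$; then $$\sum_{k=0}^{p-1}\frac{\binom{2k}k^2}{(-16)^k(2k-1)^2}\equiv(-1)^{\frac{p-1}4}\frac px\pmod{p^2}.$$ If $p\equiv3\pmod4$, then $$\sum_{k=0}^{p-1}\frac{\binom{2k}k^2}{(-16)^k(2k-1)^2}\equiv(-1)^{\frac{p+1}4}(2p+3-2^{p-1})\binom{\frac{p-1}2}{\frac{p-3}4}\pmod{p^2}$$ and $$\sum_{k=0}^{p-1}\frac{\binom{2k}k^2}{(-16)^k(2k-1)}\equiv\frac12(-1)^{\frac{p-3}4}(2p+3-2^{p-1})\binom{\frac{p-1}2}{\frac{p-3}4}-(-1)^{\frac{p-3}4}\frac{p}{\binom{(p-1)/2}{(p-3)/4}}\pmod{p^2}.$$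
   Context: Congruences are taken in the ring of rational numbers whose denominators are not divisible by $p$. -}

module Defs where

open import Data.Nat as ℕ using (ℕ; zero; suc)
open import Data.Nat.Combinatorics using (_C_)
open import Data.Nat.Primality using (Prime)
open import Data.Integer as ℤ using (ℤ; +_; -[1+_])
open import Data.Rational as ℚ using (ℚ; mkℚ; 0ℚ; 1ℚ; _+_; _*_; _-_; -_; 1/_)
open import Data.Nat.Divisibility using (_∣_)
open import Data.Product using (Σ; _×_)
open import Relation.Nullary using (¬_)
open import Relation.Binary.PropositionalEquality using (_≡_)

ℕ→ℚ : ℕ → ℚ
ℕ→ℚ n = (+ n) ℚ./ 1

ℤ→ℚ : ℤ → ℚ
ℤ→ℚ z = z ℚ./ 1

-- Reciprocal, total: recip 0 = 0 (only ever applied to nonzero values here)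
recip : ℚ → ℚ
recip (mkℚ (+ zero) _ _) = 0ℚ
recip q@(mkℚ (+ suc n) _ _) = 1/ q
recip q@(mkℚ -[1+ n ] _ _) = 1/ q

-- division (total; only used with nonzero divisors)
_÷_ : ℚ → ℚ → ℚ
a ÷ b = a * recip b

_^_ : ℚ → ℕ → ℚ
a ^ zero = 1ℚ
a ^ suc n = a * (a ^ n)

-- Z_(p): rationals whose (reduced) denominator is not divisible by p
pIntegral : ℕ → ℚ → Set
pIntegral p q = ¬ (p ∣ ℚ.denominatorℕ q)

Cong : (p : ℕ) → ℚ → ℚ → ℚ → Set
Cong p a b m = Σ ℚ (λ c → pIntegral p c × (a - b ≡ m * c))


Σ< : ℕ → (ℕ → ℚ) → ℚ
Σ< zero f = 0ℚ
Σ< (suc n) f = Σ< n f + f n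

twoKm1 : ℕ → ℚ
twoKm1 k = ℕ→ℚ (2 ℕ.* k) - 1ℚ

term1 : ℕ → ℚ
term1 k = (ℕ→ℚ ((2 ℕ.* k) C k) ^ 2) ÷ (((- ℕ→ℚ 16) ^ k) * (twoKm1 k ^ 2))

term2 : ℕ → ℚ
term2 k = (ℕ→ℚ ((2 ℕ.* k) C k) ^ 2) ÷ (((- ℕ→ℚ 16) ^ k) * twoKm1 k)

sgn : ℕ → ℚ
sgn n = (- 1ℚ) ^ n

module Submission where

-- With β(a,k) the generalised binomial coefficient, the summands are (-1)^k β(1/2,k)² and -(-1)^k β(1/2,k) β(-1/2,k).
-- The sum F(a) = Σ_{k<p} (-1)^k β(a,k)² satisfies a recurrence a F(a) ≡ -4 (a-1) F(a-2) (mod p²) at every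
-- a = j - p/2 with 2 ≤ j < p, since the boundary term of Zeilberger's telescoping contains β(a-1,p-1)². It descends from
-- 1/2 = (p+1)/2 - p/2 to F(-p/2) ≡ 1 or F(1-p/2) ≡ p, according to the parity of (p+1)/2, and expanding the product to
-- first order in p produces the alternating harmonic sum, that is, the Fermat quotient of 2. The second sum is
-- -F(-1/2) - F(1/2)/2.
--
-- For p = 4r + 1 the product is p times ± 2 / C(2r,r) modulo p², and Gauss's congruence C(2r,r) ≡ 2x (mod p) finishes.
-- Gauss's congruence comes from Jacobsthal sums: with χ the quadratic character and
-- S(k) = Σ_{1≤a≤2r} χ(a) χ(a²+k), expanding by Euler's criterion gives 2 S(k) ≡ - C(2r,r) k^r (mod p), while summing
-- S(k)² over k gives p = S(-1)² + S(g)² for a nonresidue g. The sign of S(-1) is read off modulo 8 from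
-- Σ (1 + χ(k)) (1 + χ(k+1)) (1 + χ(k+2)), and the representation p = x² + 4y² is unique.

open import Data.Nat as ℕ using (ℕ; zero; suc; s≤s; z≤n; _∸_; _/_; _%_)
import Data.Nat.Properties as ℕ
import Data.Nat.Divisibility as ℕ
import Data.Nat.Tactic.RingSolver as ℕSolver
open import Data.Nat.Combinatorics using (_C_; nCk+nC[k+1]≡[n+1]C[k+1]; nCk≡nC[n∸k]; nCn≡1; nC1≡n; k>n⇒nCk≡0)
open import Data.Nat.Coprimality using (coprime-divisor) renaming (sym to coprime-sym; recompute to recomputeCoprime)
open import Data.Nat.DivMod using (m≡m%n+[m/n]*n; m*n/n≡m)
open import Data.Nat.Induction using (<-rec)
open import Data.Nat.Primality using (Prime; euclidsLemma; prime[2]; prime⇒nonTrivial; prime⇒nonZero)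
open import Data.Integer as ℤ using (ℤ; +_; -[1+_]; +≤+)
import Data.Integer.Properties as ℤ
open import Data.Integer.Divisibility using () renaming (_∣_ to _∣ℤ_)
import Data.Integer.Divisibility.Signed as ℤ∣
import Data.Integer.Tactic.RingSolver as ℤSolver
open import Data.Product using (Σ; _×_; _,_; proj₁; proj₂)
open import Data.Sum as Sum using (_⊎_; inj₁; inj₂; [_,_]′)
open import Function using (_∘_)
open import Level using (0ℓ)
open import Relation.Binary using (Setoid)
open import Relation.Binary.PropositionalEquality
open import Relation.Nullary using (¬_; yes; no; contradiction; Dec)
open import Relation.Nullary.Decidable using (map′; dec⇒maybe)

-- Working at j - p/2 is what makes the modulus p² reachable. For j < k < p the product β(j - p/2,
-- k) contains the factor -p/2, so its square is a multiple of p² and the sums at the two ends of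
-- the descent shrink to one or two terms. The exact recurrence carries a further factor a - 1 =
-- (j-1) - p/2, a unit that has to be cancelled modulo p². Apart from the shift by p/2, a step
-- multiplies by -4 (odd)/(even) on the even indices, which builds central binomial coefficients,
-- and by -4 (even)/(odd) on the odd ones, which builds their reciprocals up to simple factors. The
-- chain that ends at p needs its product modulo p only; the chain that ends at 1 needs the
-- first-order term.
--
-- For Gauss's congruence, character sums are computed modulo p as power sums and become exact
-- integers through size bounds. Trivial bounds suffice for most of them; the correlation Σ χ(k)
-- χ(k+c) = -1 needs a sharper one. The product (1 + χ(k)) (1 + χ(k+1)) (1 + χ(k+2)) is chosen
-- because k (k+2) = (k+1)² - 1 turns its top term into a Jacobsthal sum.

module IntegerSums where
  open import Data.Integer using (0ℤ; 1ℤ; _+_; _*_; _-_; _^_; ∣_∣)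
  open import Algebra.Properties.AbelianGroup ℤ.+-0-abelianGroup using (∙-cancelˡ)
  open ℤSolver using (solve-∀)
  open ≡-Reasoning

  -- Finite sums of integers and the binomial theorem.

  ∑ : ℕ → (ℕ → ℤ) → ℤ
  ∑ zero    f = 0ℤ
  ∑ (suc n) f = ∑ n f + f n

  ∑-cong : ∀ n {f g : ℕ → ℤ} → (∀ k → k ℕ.< n → f k ≡ g k) → ∑ n f ≡ ∑ n g
  ∑-cong zero    eq = refl
  ∑-cong (suc n) eq = cong₂ _+_ (∑-cong n (λ k k<n → eq k (ℕ.m<n⇒m<1+n k<n))) (eq n ℕ.≤-refl)

  ∑-ext : ∀ n {f g : ℕ → ℤ} → (∀ k → f k ≡ g k) → ∑ n f ≡ ∑ n g
  ∑-ext n eq = ∑-cong n (λ k _ → eq k)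

  ∑-+ : ∀ n (f g : ℕ → ℤ) → ∑ n (λ k → f k + g k) ≡ ∑ n f + ∑ n g
  ∑-+ zero    f g = refl
  ∑-+ (suc n) f g = trans (cong (_+ (f n + g n)) (∑-+ n f g)) (interchange (∑ n f) (∑ n g) (f n) (g n))
    where
    interchange : ∀ a b c d → (a + b) + (c + d) ≡ (a + c) + (b + d)
    interchange = solve-∀

  ∑-*ˡ : ∀ n c (f : ℕ → ℤ) → ∑ n (λ k → c * f k) ≡ c * ∑ n f
  ∑-*ˡ zero    c f = sym (ℤ.*-zeroʳ c)
  ∑-*ˡ (suc n) c f = trans (cong (_+ c * f n) (∑-*ˡ n c f)) (sym (ℤ.*-distribˡ-+ c (∑ n f) (f n)))

  ∑-*ʳ : ∀ n c (f : ℕ → ℤ) → ∑ n (λ k → f k * c) ≡ ∑ n f * c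
  ∑-*ʳ n c f = trans (∑-ext n (λ k → ℤ.*-comm (f k) c)) (trans (∑-*ˡ n c f) (ℤ.*-comm c (∑ n f)))

  ∑-const : ∀ n c → ∑ n (λ _ → c) ≡ + n * c
  ∑-const zero    c = refl
  ∑-const (suc n) c = trans (cong (_+ c) (∑-const n c)) (trans (step (+ n) c) (cong (_* c) (ℤ.+-comm (+ n) 1ℤ)))
    where
    step : ∀ m c → m * c + c ≡ (m + 1ℤ) * c
    step = solve-∀

  ∑-peel : ∀ n (f : ℕ → ℤ) → ∑ (suc n) f ≡ f 0 + ∑ n (λ k → f (suc k))
  ∑-peel zero    f = ℤ.+-comm 0ℤ (f 0)
  ∑-peel (suc n) f = trans (cong (_+ f (suc n)) (∑-peel n f)) (ℤ.+-assoc (f 0) _ _)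

  ∑-split : ∀ m n (f : ℕ → ℤ) → ∑ (m ℕ.+ n) f ≡ ∑ m f + ∑ n (λ k → f (m ℕ.+ k))
  ∑-split m zero    f = trans (cong (λ t → ∑ t f) (ℕ.+-identityʳ m)) (sym (ℤ.+-identityʳ _))
  ∑-split m (suc n) f = begin
    ∑ (m ℕ.+ suc n) f                                       ≡⟨ cong (λ t → ∑ t f) (ℕ.+-suc m n) ⟩
    ∑ (m ℕ.+ n) f + f (m ℕ.+ n)                             ≡⟨ cong (_+ f (m ℕ.+ n)) (∑-split m n f) ⟩
    ∑ m f + ∑ n (λ k → f (m ℕ.+ k)) + f (m ℕ.+ n)           ≡⟨ ℤ.+-assoc (∑ m f) _ _ ⟩
    ∑ m f + (∑ n (λ k → f (m ℕ.+ k)) + f (m ℕ.+ n))         ∎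

  ∑-reverse : ∀ n (f : ℕ → ℤ) → ∑ n f ≡ ∑ n (λ k → f (n ℕ.∸ suc k))
  ∑-reverse zero    f = refl
  ∑-reverse (suc n) f = begin
    ∑ n f + f n                              ≡⟨ cong (_+ f n) (∑-reverse n f) ⟩
    ∑ n (λ k → f (n ℕ.∸ suc k)) + f n        ≡⟨ ℤ.+-comm _ (f n) ⟩
    f n + ∑ n (λ k → f (n ℕ.∸ suc k))        ≡⟨ ∑-peel n (λ k → f (n ℕ.∸ k)) ⟨
    ∑ (suc n) (λ k → f (n ℕ.∸ k))            ∎

  ∑-swap : ∀ m n (f : ℕ → ℕ → ℤ) → ∑ m (λ i → ∑ n (f i)) ≡ ∑ n (λ j → ∑ m (λ i → f i j))
  ∑-swap zero    n f = sym (trans (∑-const n 0ℤ) (ℤ.*-zeroʳ (+ n)))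
  ∑-swap (suc m) n f = trans (cong (_+ ∑ n (f m)) (∑-swap m n f)) (sym (∑-+ n (λ j → ∑ m (λ i → f i j)) (f m)))

  ∑-∑-* : ∀ m n (f g : ℕ → ℤ) → ∑ m (λ i → ∑ n (λ j → f i * g j)) ≡ ∑ m f * ∑ n g
  ∑-∑-* m n f g = trans (∑-ext m (λ i → ∑-*ˡ n (f i) g)) (∑-*ʳ m (∑ n g) f)

  ∑-telescope : ∀ n (f : ℕ → ℤ) → ∑ n (λ k → f (suc k) - f k) ≡ f n - f 0
  ∑-telescope zero    f = sym (ℤ.+-inverseʳ (f 0))
  ∑-telescope (suc n) f = trans (cong (_+ (f (suc n) - f n)) (∑-telescope n f)) (cancel (f 0) (f n) (f (suc n)))
    where
    cancel : ∀ a b c → (b - a) + (c - b) ≡ c - a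
    cancel = solve-∀

  -- Moving the window by one drops `f w` and gains `f (w + n)`, which are equal.
  ∑-periodic : ∀ n w {f : ℕ → ℤ} → (∀ k → f (k ℕ.+ n) ≡ f k) → ∑ n (λ k → f (k ℕ.+ w)) ≡ ∑ n f
  ∑-periodic n zero    {f} period = ∑-ext n (λ k → cong f (ℕ.+-identityʳ k))
  ∑-periodic n (suc w) {f} period = begin
    ∑ n (λ k → f (k ℕ.+ suc w))                   ≡⟨ ∑-ext n (λ k → cong f (ℕ.+-suc k w)) ⟩
    ∑ n (λ k → f (suc k ℕ.+ w))                   ≡⟨ ∙-cancelˡ (f w) _ (∑ n (λ k → f (k ℕ.+ w))) (begin
      f w + ∑ n (λ k → f (suc k ℕ.+ w))             ≡⟨ ∑-peel n (λ k → f (k ℕ.+ w)) ⟨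
      ∑ n (λ k → f (k ℕ.+ w)) + f (n ℕ.+ w)         ≡⟨ cong (λ t → ∑ n (λ k → f (k ℕ.+ w)) + f t) (ℕ.+-comm n w) ⟩
      ∑ n (λ k → f (k ℕ.+ w)) + f (w ℕ.+ n)         ≡⟨ cong (λ t → ∑ n (λ k → f (k ℕ.+ w)) + t) (period w) ⟩
      ∑ n (λ k → f (k ℕ.+ w)) + f w                 ≡⟨ ℤ.+-comm _ (f w) ⟩
      f w + ∑ n (λ k → f (k ℕ.+ w))                 ∎) ⟩
    ∑ n (λ k → f (k ℕ.+ w))                       ≡⟨ ∑-periodic n w period ⟩
    ∑ n f                                         ∎

  ∣∑∣≤ : ∀ n (f : ℕ → ℤ) → (∀ k → ∣ f k ∣ ℕ.≤ 1) → ∣ ∑ n f ∣ ℕ.≤ n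
  ∣∑∣≤ zero    f bound = z≤n
  ∣∑∣≤ (suc n) f bound = ℕ.≤-trans (ℤ.∣i+j∣≤∣i∣+∣j∣ (∑ n f) (f n))
    (ℕ.≤-trans (ℕ.+-mono-≤ (∣∑∣≤ n f bound) (bound n)) (ℕ.≤-reflexive (ℕ.+-comm n 1)))

  [1+k]*[1+n]C[1+k]≡[1+n]*nCk : ∀ n k → suc k ℕ.* (suc n C suc k) ≡ suc n ℕ.* (n C k)
  [1+k]*[1+n]C[1+k]≡[1+n]*nCk zero zero = refl
  [1+k]*[1+n]C[1+k]≡[1+n]*nCk zero (suc k) = trans (cong (suc (suc k) ℕ.*_) (k>n⇒nCk≡0 {1} {suc (suc k)} (s≤s (s≤s z≤n))))
    (trans (ℕ.*-zeroʳ (suc (suc k))) (sym (cong (1 ℕ.*_) (k>n⇒nCk≡0 {0} {suc k} (s≤s z≤n)))))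
  [1+k]*[1+n]C[1+k]≡[1+n]*nCk (suc n) zero = trans (ℕ.*-identityˡ _) (trans (sym (nCk+nC[k+1]≡[n+1]C[k+1] (suc n) 0))
    (cong suc (trans (sym (ℕ.*-identityˡ _)) ([1+k]*[1+n]C[1+k]≡[1+n]*nCk n zero))))
  [1+k]*[1+n]C[1+k]≡[1+n]*nCk (suc n) (suc k) = begin
    suc (suc k) ℕ.* (suc (suc n) C suc (suc k))                    ≡⟨ cong (suc (suc k) ℕ.*_) (nCk+nC[k+1]≡[n+1]C[k+1] (suc n) (suc k)) ⟨
    suc (suc k) ℕ.* (a ℕ.+ (suc n C suc (suc k)))                  ≡⟨ ℕ.*-distribˡ-+ (suc (suc k)) a _ ⟩
    (a ℕ.+ suc k ℕ.* a) ℕ.+ suc (suc k) ℕ.* (suc n C suc (suc k))  ≡⟨ cong₂ (λ u v → (a ℕ.+ u) ℕ.+ v) ([1+k]*[1+n]C[1+k]≡[1+n]*nCk n k) ([1+k]*[1+n]C[1+k]≡[1+n]*nCk n (suc k)) ⟩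
    (a ℕ.+ suc n ℕ.* (n C k)) ℕ.+ suc n ℕ.* (n C suc k)            ≡⟨ ℕ.+-assoc a _ _ ⟩
    a ℕ.+ (suc n ℕ.* (n C k) ℕ.+ suc n ℕ.* (n C suc k))            ≡⟨ cong (a ℕ.+_) (ℕ.*-distribˡ-+ (suc n) (n C k) (n C suc k)) ⟨
    a ℕ.+ suc n ℕ.* ((n C k) ℕ.+ (n C suc k))                      ≡⟨ cong (λ t → a ℕ.+ suc n ℕ.* t) (nCk+nC[k+1]≡[n+1]C[k+1] n k) ⟩
    suc (suc n) ℕ.* a                                              ∎
    where a = suc n C suc k

  coeff : ℤ → ℕ → ℕ → ℤ
  coeff y n j = + (n C j) * y ^ (n ℕ.∸ j)

  coeff-suc : ∀ y n j → coeff y (suc n) (suc j) ≡ coeff y n j + y * coeff y n (suc j)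
  coeff-suc y n j = begin
    + (suc n C suc j) * y ^ (n ℕ.∸ j)                              ≡⟨ cong (λ t → + t * y ^ (n ℕ.∸ j)) (nCk+nC[k+1]≡[n+1]C[k+1] n j) ⟨
    + ((n C j) ℕ.+ (n C suc j)) * y ^ (n ℕ.∸ j)                    ≡⟨ ℤ.*-distribʳ-+ (y ^ (n ℕ.∸ j)) (+ (n C j)) (+ (n C suc j)) ⟩
    coeff y n j + + (n C suc j) * y ^ (n ℕ.∸ j)                    ≡⟨ cong (λ t → coeff y n j + t) tail ⟩
    coeff y n j + y * coeff y n (suc j)                            ∎
    where
    tail : + (n C suc j) * y ^ (n ℕ.∸ j) ≡ y * coeff y n (suc j)
    tail with ℕ.<-≤-connex j n
    ... | inj₁ j<n = trans (cong (λ t → + (n C suc j) * y ^ t) (ℕ.+-∸-assoc 1 j<n)) (rearrange (+ (n C suc j)) y (y ^ (n ℕ.∸ suc j)))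
      where
      rearrange : ∀ c y t → c * (y * t) ≡ y * (c * t)
      rearrange = solve-∀
    -- Here truncated subtraction no longer lowers the exponent, but the binomial coefficient is 0.
    ... | inj₂ n≤j rewrite k>n⇒nCk≡0 (s≤s n≤j) = sym (ℤ.*-zeroʳ y)

  binomial : ∀ x y n → (x + y) ^ n ≡ ∑ (suc n) (λ j → coeff y n j * x ^ j)
  binomial x y zero = refl
  binomial x y (suc n) = begin
    (x + y) * (x + y) ^ n                                          ≡⟨ cong ((x + y) *_) (binomial x y n) ⟩
    (x + y) * ∑ (suc n) f                                          ≡⟨ ℤ.*-distribʳ-+ (∑ (suc n) f) x y ⟩
    x * ∑ (suc n) f + y * ∑ (suc n) f                              ≡⟨ cong (λ t → x * ∑ (suc n) f + y * t) extend ⟩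
    x * ∑ (suc n) f + y * ∑ (suc (suc n)) f                        ≡⟨ cong₂ (λ u v → u + y * v) (∑-*ˡ (suc n) x f) (sym (∑-peel (suc n) f)) ⟨
    ∑ (suc n) (λ j → x * f j) + y * (f 0 + ∑ (suc n) (λ j → f (suc j)))
      ≡⟨ regroup (∑ (suc n) (λ j → x * f j)) y (f 0) (∑ (suc n) (λ j → f (suc j))) ⟩
    y * f 0 + (∑ (suc n) (λ j → x * f j) + y * ∑ (suc n) (λ j → f (suc j)))
      ≡⟨ cong (λ t → y * f 0 + (∑ (suc n) (λ j → x * f j) + t)) (∑-*ˡ (suc n) y (λ j → f (suc j))) ⟨
    y * f 0 + (∑ (suc n) (λ j → x * f j) + ∑ (suc n) (λ j → y * f (suc j)))
      ≡⟨ cong (λ t → y * f 0 + t) (∑-+ (suc n) (λ j → x * f j) (λ j → y * f (suc j))) ⟨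
    y * f 0 + ∑ (suc n) (λ j → x * f j + y * f (suc j))            ≡⟨ cong₂ _+_ (first y (y ^ n)) (∑-ext (suc n) step) ⟩
    g 0 + ∑ (suc n) (λ j → g (suc j))                              ≡⟨ ∑-peel (suc n) g ⟨
    ∑ (suc (suc n)) g                                              ∎
    where
    f g : ℕ → ℤ
    f j = coeff y n j * x ^ j
    g j = coeff y (suc n) j * x ^ j
    extend : ∑ (suc n) f ≡ ∑ (suc (suc n)) f
    extend rewrite k>n⇒nCk≡0 (ℕ.n<1+n n) = sym (ℤ.+-identityʳ _)
    regroup : ∀ a y b c → a + y * (b + c) ≡ y * b + (a + y * c)
    regroup = solve-∀
    first : ∀ y t → y * (1ℤ * t * 1ℤ) ≡ 1ℤ * (y * t) * 1ℤ
    first = solve-∀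
    step : ∀ j → x * f j + y * f (suc j) ≡ g (suc j)
    step j = trans (expand x y (coeff y n j) (coeff y n (suc j)) (x ^ j)) (cong (_* (x * x ^ j)) (sym (coeff-suc y n j)))
      where
      expand : ∀ x y a b t → x * (a * t) + y * (b * (x * t)) ≡ (a + y * b) * (x * t)
      expand = solve-∀

module GaussBinomial where
  open import Data.Integer using (0ℤ; 1ℤ; -1ℤ; _+_; _*_; _-_; -_; _^_; ∣_∣; _≤_)
  open ℤSolver using (solve-∀)
  open IntegerSums

  -- Congruences of integers, then power sums modulo a prime.

  module Congruence (m : ℕ) where
    infix 4 _≈_
    -- The quotient is kept as data: matching the equation with `refl` reduces every law to a
    -- polynomial identity, and later proofs read the quotient off to obtain equations.
    record _≈_ (a b : ℤ) : Set where
      constructor _byQuotient_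
      field
        quotient : ℤ
        equality : a ≡ b + quotient * + m

    reflexive : ∀ {a b} → a ≡ b → a ≈ b
    reflexive {a} refl = 0ℤ byQuotient sym (ℤ.+-identityʳ a)

    ≈-refl : ∀ {a} → a ≈ a
    ≈-refl = reflexive refl

    ≈-sym : ∀ {a b} → a ≈ b → b ≈ a
    ≈-sym {a} {b} (q byQuotient refl) = (- q) byQuotient eq b q (+ m)
      where
      eq : ∀ b q m → b ≡ b + q * m + - q * m
      eq = solve-∀

    ≈-trans : ∀ {a b c} → a ≈ b → b ≈ c → a ≈ c
    ≈-trans {c = c} (q byQuotient refl) (q' byQuotient refl) = (q + q') byQuotient eq c q q' (+ m)
      where
      eq : ∀ c q q' m → c + q' * m + q * m ≡ c + (q + q') * m
      eq = solve-∀

    +-cong : ∀ {a b c d} → a ≈ b → c ≈ d → a + c ≈ b + d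
    +-cong {b = b} {d = d} (q byQuotient refl) (q' byQuotient refl) = (q + q') byQuotient eq b d q q' (+ m)
      where
      eq : ∀ b d q q' m → b + q * m + (d + q' * m) ≡ b + d + (q + q') * m
      eq = solve-∀

    *-cong : ∀ {a b c d} → a ≈ b → c ≈ d → a * c ≈ b * d
    *-cong {b = b} {d = d} (q byQuotient refl) (q' byQuotient refl) =
      (b * q' + q * d + q * q' * + m) byQuotient eq b d q q' (+ m)
      where
      eq : ∀ b d q q' m → (b + q * m) * (d + q' * m) ≡ b * d + (b * q' + q * d + q * q' * m) * m
      eq = solve-∀

    *-congˡ : ∀ c {a b} → a ≈ b → c * a ≈ c * b
    *-congˡ c = *-cong (≈-refl {c})

    *-congʳ : ∀ c {a b} → a ≈ b → a * c ≈ b * c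
    *-congʳ c a≈b = *-cong a≈b (≈-refl {c})

    -‿cong : ∀ {a b} → a ≈ b → - a ≈ - b
    -‿cong {b = b} (q byQuotient refl) = (- q) byQuotient eq b q (+ m)
      where
      eq : ∀ b q m → - (b + q * m) ≡ - b + - q * m
      eq = solve-∀

    ^-cong : ∀ {a b} n → a ≈ b → a ^ n ≈ b ^ n
    ^-cong zero    a≈b = ≈-refl
    ^-cong (suc n) a≈b = *-cong a≈b (^-cong n a≈b)

    ≈-setoid : Setoid 0ℓ 0ℓ
    ≈-setoid = record
      { Carrier = ℤ
      ; _≈_ = _≈_
      ; isEquivalence = record { refl = ≈-refl ; sym = ≈-sym ; trans = ≈-trans }
      }

    m≈0 : + m ≈ 0ℤ
    m≈0 = 1ℤ byQuotient eq (+ m)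
      where
      eq : ∀ m → m ≡ 0ℤ + 1ℤ * m
      eq = solve-∀

    difference≈0⇒≈ : ∀ {a b} → a - b ≈ 0ℤ → a ≈ b
    difference≈0⇒≈ {a} {b} d = ≈-trans (reflexive (eq a b)) (≈-trans (+-cong d ≈-refl) (reflexive (ℤ.+-identityˡ b)))
      where
      eq : ∀ a b → a ≡ a - b + b
      eq = solve-∀

    ≈⇒difference≈0 : ∀ {a b} → a ≈ b → a - b ≈ 0ℤ
    ≈⇒difference≈0 {a} {b} a≈b = ≈-trans (+-cong a≈b (≈-refl { - b})) (reflexive (ℤ.+-inverseʳ b))

    ∣⇒≈0 : ∀ {a} → m ℕ.∣ ∣ a ∣ → a ≈ 0ℤ
    ∣⇒≈0 m∣a with ℤ∣.∣ᵤ⇒∣ m∣a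
    ... | ℤ∣.divides q eq = q byQuotient trans eq (sym (ℤ.+-identityˡ _))

    ≈0⇒∣ : ∀ {a} → a ≈ 0ℤ → m ℕ.∣ ∣ a ∣
    ≈0⇒∣ (q byQuotient eq) = ℤ∣.∣⇒∣ᵤ (ℤ∣.divides q (trans eq (ℤ.+-identityˡ _)))

    -- A nonzero multiple of m has absolute value at least m. Through this, congruences for bounded
    -- character sums become equalities.
    ≈0∧∣∣<m⇒≡0 : ∀ {a} → ∣ a ∣ ℕ.< m → a ≈ 0ℤ → a ≡ 0ℤ
    ≈0∧∣∣<m⇒≡0 {a} small a≈0 with ∣ a ∣ in eq | ≈0⇒∣ a≈0
    ... | zero  | _   = ℤ.∣i∣≡0⇒i≡0 eq
    ... | suc k | m∣k = contradiction m∣k (ℕ.>⇒∤ small)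

    ≈∧∣-∣<m⇒≡ : ∀ {a b} → ∣ a - b ∣ ℕ.< m → a ≈ b → a ≡ b
    ≈∧∣-∣<m⇒≡ {a} {b} small a≈b = ℤ.i-j≡0⇒i≡j a b (≈0∧∣∣<m⇒≡0 small (≈⇒difference≈0 a≈b))

    ∑-cong≈ : ∀ n {f g : ℕ → ℤ} → (∀ k → k ℕ.< n → f k ≈ g k) → ∑ n f ≈ ∑ n g
    ∑-cong≈ zero    f≈g = ≈-refl
    ∑-cong≈ (suc n) f≈g = +-cong (∑-cong≈ n (λ k k<n → f≈g k (ℕ.m<n⇒m<1+n k<n))) (f≈g n ℕ.≤-refl)

    ∑≈0 : ∀ n {f : ℕ → ℤ} → (∀ k → k ℕ.< n → f k ≈ 0ℤ) → ∑ n f ≈ 0ℤ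
    ∑≈0 n f≈0 = ≈-trans (∑-cong≈ n f≈0) (reflexive (trans (∑-const n 0ℤ) (ℤ.*-zeroʳ (+ n))))

  module PrimeModulus (p : ℕ) (prime : Prime p) where
    open Congruence p public
    open import Relation.Binary.Reasoning.Setoid ≈-setoid

    1<p : 1 ℕ.< p
    1<p = ℕ.nonTrivial⇒n>1 p {{prime⇒nonTrivial prime}}

    instance
      p≢0 : ℕ.NonZero p
      p≢0 = prime⇒nonZero prime

    ≈0-split : ∀ a b → a * b ≈ 0ℤ → a ≈ 0ℤ ⊎ b ≈ 0ℤ
    ≈0-split a b ab≈0 with euclidsLemma ∣ a ∣ ∣ b ∣ prime (subst (p ℕ.∣_) (ℤ.abs-* a b) (≈0⇒∣ ab≈0))
    ... | inj₁ p∣a = inj₁ (∣⇒≈0 p∣a)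
    ... | inj₂ p∣b = inj₂ (∣⇒≈0 p∣b)

    *-cancelˡ : ∀ c {a b} → ¬ c ≈ 0ℤ → c * a ≈ c * b → a ≈ b
    *-cancelˡ c {a} {b} c≉0 ca≈cb with ≈0-split c (a - b) (≈-trans (reflexive (eq c a b)) (≈⇒difference≈0 ca≈cb))
      where
      eq : ∀ c a b → c * (a - b) ≡ c * a - c * b
      eq = solve-∀
    ... | inj₁ c≈0   = contradiction c≈0 c≉0
    ... | inj₂ a-b≈0 = difference≈0⇒≈ a-b≈0

    small-unit : ∀ {k} → 0 ℕ.< k → k ℕ.< p → ¬ + k ≈ 0ℤ
    small-unit 0<k k<p k≈0 with ≈0∧∣∣<m⇒≡0 k<p k≈0
    small-unit () k<p k≈0 | refl

    -- From (k+1) C(p,k+1) = p C(p-1,k), where k+1 is a unit.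
    binomial-≈0 : ∀ k → suc k ℕ.< p → + (p C suc k) ≈ 0ℤ
    binomial-≈0 k k<p = *-cancelˡ (+ suc k) (small-unit (s≤s z≤n) k<p) (begin
      + suc k * + (p C suc k)                      ≡⟨ ℤ.pos-* (suc k) (p C suc k) ⟨
      + (suc k ℕ.* (p C suc k))                    ≡⟨ cong (λ t → + (suc k ℕ.* (t C suc k))) (ℕ.suc-pred p) ⟨
      + (suc k ℕ.* (suc (ℕ.pred p) C suc k))       ≡⟨ cong +_ ([1+k]*[1+n]C[1+k]≡[1+n]*nCk (ℕ.pred p) k) ⟩
      + (suc (ℕ.pred p) ℕ.* (ℕ.pred p C k))        ≡⟨ cong (λ t → + (t ℕ.* (ℕ.pred p C k))) (ℕ.suc-pred p) ⟩
      + (p ℕ.* (ℕ.pred p C k))                     ≡⟨ ℤ.pos-* p _ ⟩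
      + p * + (ℕ.pred p C k)                       ≈⟨ *-congʳ (+ (ℕ.pred p C k)) m≈0 ⟩
      0ℤ * + (ℕ.pred p C k)                        ≡⟨ ℤ.*-zeroˡ (+ (ℕ.pred p C k)) ⟩
      0ℤ                                           ≡⟨ ℤ.*-zeroʳ (+ suc k) ⟨
      + suc k * 0ℤ                                 ∎)

    0^p : ∀ {n} → 0 ℕ.< n → 0ℤ ^ n ≡ 0ℤ
    0^p (s≤s _) = refl

    frobenius : ∀ x → (x + 1ℤ) ^ p ≈ x ^ p + 1ℤ
    frobenius x = begin
      (x + 1ℤ) ^ p                                                 ≡⟨ binomial x 1ℤ p ⟩
      ∑ p t + t p                                                  ≡⟨ cong (λ k → ∑ k t + t p) (ℕ.suc-pred p) ⟨
      ∑ (suc (ℕ.pred p)) t + t p                                   ≡⟨ cong (_+ t p) (∑-peel (ℕ.pred p) t) ⟩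
      t 0 + ∑ (ℕ.pred p) (λ j → t (suc j)) + t p                   ≈⟨ +-cong (+-cong (≈-refl {t 0}) (∑≈0 (ℕ.pred p) middle)) (≈-refl {t p}) ⟩
      t 0 + 0ℤ + t p                                               ≡⟨ cong₂ (λ u v → u + 0ℤ + v) first last ⟩
      1ℤ + 0ℤ + x ^ p                                              ≡⟨ ℤ.+-comm 1ℤ (x ^ p) ⟩
      x ^ p + 1ℤ                                                   ∎
      where
      t : ℕ → ℤ
      t j = coeff 1ℤ p j * x ^ j
      first : t 0 ≡ 1ℤ
      first = trans (ℤ.*-identityʳ _) (trans (ℤ.*-identityˡ _) (ℤ.^-zeroˡ p))
      last : t p ≡ x ^ p
      last = trans (cong₂ (λ c e → + c * 1ℤ ^ e * x ^ p) (nCn≡1 p) (ℕ.n∸n≡0 p)) (ℤ.*-identityˡ _)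
      middle : ∀ j → j ℕ.< ℕ.pred p → t (suc j) ≈ 0ℤ
      middle j j<p-1 = begin
        coeff 1ℤ p (suc j) * x ^ suc j                             ≈⟨ *-congʳ (x ^ suc j) (*-congʳ (1ℤ ^ (p ℕ.∸ suc j))
                                                                        (binomial-≈0 j (subst (suc j ℕ.<_) (ℕ.suc-pred p) (s≤s j<p-1)))) ⟩
        0ℤ * 1ℤ ^ (p ℕ.∸ suc j) * x ^ suc j                        ≡⟨ cong (_* x ^ suc j) (ℤ.*-zeroˡ (1ℤ ^ (p ℕ.∸ suc j))) ⟩
        0ℤ                                                         ∎

    fermat : ∀ k → (+ k) ^ p ≈ + k
    fermat zero = reflexive (0^p (ℕ.<-trans (s≤s z≤n) 1<p))
    fermat (suc k) = begin
      (+ suc k) ^ p        ≡⟨ cong (_^ p) (ℤ.+-comm 1ℤ (+ k)) ⟩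
      (+ k + 1ℤ) ^ p       ≈⟨ frobenius (+ k) ⟩
      (+ k) ^ p + 1ℤ       ≈⟨ +-cong (fermat k) ≈-refl ⟩
      + k + 1ℤ             ≡⟨ ℤ.+-comm (+ k) 1ℤ ⟩
      + suc k              ∎

    fermat-unit : ∀ {k} → ¬ + k ≈ 0ℤ → (+ k) ^ ℕ.pred p ≈ 1ℤ
    fermat-unit {k} k≉0 = *-cancelˡ (+ k) k≉0 (begin
      (+ k) ^ suc (ℕ.pred p)   ≡⟨ cong ((+ k) ^_) (ℕ.suc-pred p) ⟩
      (+ k) ^ p                ≈⟨ fermat k ⟩
      + k                      ≡⟨ ℤ.*-identityʳ (+ k) ⟨
      + k * 1ℤ                 ∎)

    powerSum : ℕ → ℤ
    powerSum j = ∑ p (λ k → (+ k) ^ j)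

    -- Telescoping (k+1)^(j+1) - k^(j+1) expresses (j+1) powerSum j through the lower power sums.
    powerSum≈0 : ∀ j → suc j ℕ.< p → powerSum j ≈ 0ℤ
    powerSum≈0 = <-rec _ λ j rec j<p → *-cancelˡ (+ suc j) (small-unit (s≤s z≤n) j<p) (begin
      + suc j * powerSum j                                        ≡⟨ cong (_* powerSum j) (top j) ⟨
      coeff 1ℤ (suc j) j * powerSum j                             ≡⟨ ℤ.+-identityˡ _ ⟨
      0ℤ + coeff 1ℤ (suc j) j * powerSum j                        ≈⟨ +-cong (∑≈0 j (λ i i<j → ≈-trans (*-congˡ (coeff 1ℤ (suc j) i) (rec i<j (ℕ.<-trans (s≤s i<j) j<p)))
                                                                       (reflexive (ℤ.*-zeroʳ (coeff 1ℤ (suc j) i))))) ≈-refl ⟨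
      ∑ (suc j) (λ i → coeff 1ℤ (suc j) i * powerSum i)           ≡⟨ ∑-ext (suc j) (λ i → sym (∑-*ˡ p (coeff 1ℤ (suc j) i) (λ k → (+ k) ^ i))) ⟩
      ∑ (suc j) (λ i → ∑ p (λ k → coeff 1ℤ (suc j) i * (+ k) ^ i)) ≡⟨ ∑-swap (suc j) p (λ i k → coeff 1ℤ (suc j) i * (+ k) ^ i) ⟩
      ∑ p (λ k → ∑ (suc j) (λ i → coeff 1ℤ (suc j) i * (+ k) ^ i)) ≡⟨ ∑-ext p (difference j) ⟨
      ∑ p (λ k → (+ suc k) ^ suc j - (+ k) ^ suc j)               ≡⟨ ∑-telescope p (λ k → (+ k) ^ suc j) ⟩
      (+ p) ^ suc j - 0ℤ                                          ≈⟨ +-cong (^-cong (suc j) m≈0) ≈-refl ⟩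
      0ℤ                                                          ≡⟨ ℤ.*-zeroʳ (+ suc j) ⟨
      + suc j * 0ℤ                                                ∎)
      where
      top : ∀ j → coeff 1ℤ (suc j) j ≡ + suc j
      top j = trans (cong₂ (λ c e → + c * e) ([1+n]Cn≡1+n j) (ℤ.^-zeroˡ (suc j ℕ.∸ j))) (ℤ.*-identityʳ _)
        where
        [1+n]Cn≡1+n : ∀ n → suc n C n ≡ suc n
        [1+n]Cn≡1+n n = trans (nCk≡nC[n∸k] (ℕ.n≤1+n n)) (trans (cong (suc n C_) (ℕ.m+n∸n≡m 1 n)) (nC1≡n (suc n)))
      difference : ∀ j k → (+ suc k) ^ suc j - (+ k) ^ suc j ≡ ∑ (suc j) (λ i → coeff 1ℤ (suc j) i * (+ k) ^ i)
      difference j k = trans (cong (λ t → t ^ suc j - (+ k) ^ suc j) (ℤ.+-comm 1ℤ (+ k)))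
        (trans (cong (_- (+ k) ^ suc j) (trans (binomial (+ k) 1ℤ (suc j)) (cong (λ t → ∑ (suc j) (λ i → coeff 1ℤ (suc j) i * (+ k) ^ i) + t) last)))
          (cancel (∑ (suc j) (λ i → coeff 1ℤ (suc j) i * (+ k) ^ i)) ((+ k) ^ suc j)))
        where
        last : coeff 1ℤ (suc j) (suc j) * (+ k) ^ suc j ≡ (+ k) ^ suc j
        last = trans (cong₂ (λ c e → + c * 1ℤ ^ e * (+ k) ^ suc j) (nCn≡1 (suc j)) (ℕ.n∸n≡0 j)) (ℤ.*-identityˡ _)
        cancel : ∀ a b → a + b - b ≡ a
        cancel = solve-∀

    powerSum-[p-1] : powerSum (ℕ.pred p) ≈ -1ℤ
    powerSum-[p-1] = begin
      ∑ p f                                                       ≡⟨ cong (λ t → ∑ t f) (ℕ.suc-pred p) ⟨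
      ∑ (suc (ℕ.pred p)) f                                        ≡⟨ ∑-peel (ℕ.pred p) f ⟩
      0ℤ ^ ℕ.pred p + ∑ (ℕ.pred p) (λ k → f (suc k))              ≡⟨ cong (_+ ∑ (ℕ.pred p) (λ k → f (suc k))) (0^p (ℕ.≤-pred (subst (1 ℕ.<_) (sym (ℕ.suc-pred p)) 1<p))) ⟩
      0ℤ + ∑ (ℕ.pred p) (λ k → f (suc k))                         ≈⟨ +-cong (≈-refl {0ℤ}) (∑-cong≈ (ℕ.pred p) (λ k k<p-1 →
                                                                       fermat-unit (small-unit (s≤s z≤n) (subst (suc k ℕ.<_) (ℕ.suc-pred p) (s≤s k<p-1))))) ⟩
      0ℤ + ∑ (ℕ.pred p) (λ _ → 1ℤ)                                ≡⟨ trans (ℤ.+-identityˡ _) (trans (∑-const (ℕ.pred p) 1ℤ) (ℤ.*-identityʳ _)) ⟩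
      + ℕ.pred p                                                  ≡⟨ shift (+ ℕ.pred p) ⟩
      + suc (ℕ.pred p) - 1ℤ                                       ≡⟨ cong (λ t → + t - 1ℤ) (ℕ.suc-pred p) ⟩
      + p - 1ℤ                                                    ≈⟨ +-cong m≈0 (≈-refl { -1ℤ}) ⟩
      -1ℤ                                                         ∎
      where
      f : ℕ → ℤ
      f k = (+ k) ^ ℕ.pred p
      shift : ∀ a → a ≡ 1ℤ + a - 1ℤ
      shift = solve-∀

    -- Fermat in the form k^p ≡ k. The exponent is positive because at exponent 0 the term 0^0 = 1
    -- would break the period.
    powerSum-periodic : ∀ j → powerSum (ℕ.pred p ℕ.+ suc j) ≈ powerSum (suc j)
    powerSum-periodic j = ∑-cong≈ p (λ k _ → begin
      (+ k) ^ (ℕ.pred p ℕ.+ suc j)      ≡⟨ cong ((+ k) ^_) (trans (ℕ.+-suc (ℕ.pred p) j) (cong (ℕ._+ j) (ℕ.suc-pred p))) ⟩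
      (+ k) ^ (p ℕ.+ j)                 ≡⟨ ℤ.^-distribˡ-+-* (+ k) p j ⟩
      (+ k) ^ p * (+ k) ^ j             ≈⟨ *-congʳ ((+ k) ^ j) (fermat k) ⟩
      + k * (+ k) ^ j                   ∎)

  square-nonneg : ∀ z → 0ℤ ≤ z * z
  square-nonneg (+ n)    = subst (0ℤ ≤_) (ℤ.pos-* n n) (+≤+ z≤n)
  square-nonneg -[1+ n ] = +≤+ z≤n

  ∑-nonneg : ∀ n {f : ℕ → ℤ} → (∀ k → 0ℤ ≤ f k) → 0ℤ ≤ ∑ n f
  ∑-nonneg zero    f≥0 = ℤ.≤-refl
  ∑-nonneg (suc n) f≥0 = ℤ.+-mono-≤ (∑-nonneg n f≥0) (f≥0 n)

  -- Serves to separate the diagonal term of a row of correlations from the constant off-diagonal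
  -- ones.
  ∑-differ-at : ∀ n {f g : ℕ → ℤ} {i c} → i ℕ.< n → (∀ k → k ℕ.< n → k ≢ i → f k ≡ g k) → f i ≡ g i + c →
                ∑ n f ≡ ∑ n g + c
  ∑-differ-at (suc n) {f} {g} {i} {c} i<1+n away at with i ℕ.≟ n
  ... | yes refl = trans (cong₂ _+_ (∑-cong n (λ k k<n → away k (ℕ.m<n⇒m<1+n k<n) (ℕ.<⇒≢ k<n))) at)
                         (sym (ℤ.+-assoc (∑ n g) (g n) c))
  ... | no i≢n = trans (cong₂ _+_ (∑-differ-at n (ℕ.≤∧≢⇒< (ℕ.≤-pred i<1+n) i≢n) (λ k k<n → away k (ℕ.m<n⇒m<1+n k<n)) at)
                                  (away n ℕ.≤-refl (i≢n ∘ sym)))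
                       (swap (∑ n g) c (g n))
    where
    swap : ∀ a b c → a + b + c ≡ a + c + b
    swap = solve-∀

  ∣∣≤1-cases : ∀ {z} → ∣ z ∣ ℕ.≤ 1 → z ≡ 0ℤ ⊎ z ≡ 1ℤ ⊎ z ≡ -1ℤ
  ∣∣≤1-cases {+ zero}          _ = inj₁ refl
  ∣∣≤1-cases {+ suc zero}      _ = inj₂ (inj₁ refl)
  ∣∣≤1-cases {+ suc (suc _)}   (s≤s ())
  ∣∣≤1-cases { -[1+ zero ]}    _ = inj₂ (inj₂ refl)
  ∣∣≤1-cases { -[1+ suc _ ]}   (s≤s ())

  ∣*∣≤1 : ∀ a b → ∣ a ∣ ℕ.≤ 1 → ∣ b ∣ ℕ.≤ 1 → ∣ a * b ∣ ℕ.≤ 1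
  ∣*∣≤1 a b a≤1 b≤1 = subst (ℕ._≤ 1) (sym (ℤ.abs-* a b)) (ℕ.*-mono-≤ a≤1 b≤1)

  ^-distribʳ-* : ∀ a b n → (a * b) ^ n ≡ a ^ n * b ^ n
  ^-distribʳ-* a b zero    = refl
  ^-distribʳ-* a b (suc n) = trans (cong (a * b *_) (^-distribʳ-* a b n)) (eq a b (a ^ n) (b ^ n))
    where
    eq : ∀ a b s t → a * b * (s * t) ≡ a * s * (b * t)
    eq = solve-∀

  -- The quadratic character of 𝔽ₚ as Euler's criterion gives it: χ a is the representative of a^((p-1)/2) in {-1, 0, 1}.
  module QuadraticCharacter (p : ℕ) (prime : Prime p) (n : ℕ) (p≡1+2n : p ≡ suc (n ℕ.+ n)) where
    open PrimeModulus p prime public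
    open import Relation.Binary.Reasoning.Setoid ≈-setoid

    p-1≡2n : ℕ.pred p ≡ n ℕ.+ n
    p-1≡2n = cong ℕ.pred p≡1+2n

    0<n : 0 ℕ.< n
    0<n = ℕ.n≢0⇒n>0 λ n≡0 → ℕ.<-irrefl (sym (trans p≡1+2n (cong (λ t → suc (t ℕ.+ t)) n≡0))) 1<p

    2n<p : n ℕ.+ n ℕ.< p
    2n<p = ℕ.≤-reflexive (sym p≡1+2n)

    1+n<p : suc n ℕ.< p
    1+n<p = ℕ.≤-<-trans (ℕ.+-monoˡ-≤ n 0<n) 2n<p

    2<p : 2 ℕ.< p
    2<p = ℕ.≤-<-trans (s≤s 0<n) 1+n<p

    powerSum-2n : powerSum (n ℕ.+ n) ≈ -1ℤ
    powerSum-2n = subst (λ t → powerSum t ≈ -1ℤ) p-1≡2n powerSum-[p-1]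

    ≈0? : ∀ a → Dec (+ a ≈ 0ℤ)
    ≈0? a = map′ ∣⇒≈0 ≈0⇒∣ (p ℕ.∣? a)

    ^2n≈1 : ∀ {a} → ¬ + a ≈ 0ℤ → (+ a) ^ n * (+ a) ^ n ≈ 1ℤ
    ^2n≈1 {a} a≉0 = begin
      (+ a) ^ n * (+ a) ^ n    ≡⟨ ℤ.^-distribˡ-+-* (+ a) n n ⟨
      (+ a) ^ (n ℕ.+ n)        ≡⟨ cong ((+ a) ^_) p-1≡2n ⟨
      (+ a) ^ ℕ.pred p         ≈⟨ fermat-unit a≉0 ⟩
      1ℤ                       ∎

    ^n≈±1 : ∀ {a} → ¬ + a ≈ 0ℤ → (+ a) ^ n ≈ 1ℤ ⊎ (+ a) ^ n ≈ -1ℤ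
    ^n≈±1 {a} a≉0 = Sum.map (difference≈0⇒≈ {(+ a) ^ n} {1ℤ}) (difference≈0⇒≈ {(+ a) ^ n} { -1ℤ})
      (≈0-split ((+ a) ^ n - 1ℤ) ((+ a) ^ n - -1ℤ) (begin
        ((+ a) ^ n - 1ℤ) * ((+ a) ^ n - -1ℤ)  ≡⟨ factor ((+ a) ^ n) ⟩
        (+ a) ^ n * (+ a) ^ n - 1ℤ            ≈⟨ ≈⇒difference≈0 (^2n≈1 a≉0) ⟩
        0ℤ                                    ∎))
      where
      factor : ∀ t → (t - 1ℤ) * (t - -1ℤ) ≡ t * t - 1ℤ
      factor = solve-∀

    euler : ∀ a → Dec (+ a ≈ 0ℤ) → Σ ℤ λ z → ∣ z ∣ ℕ.≤ 1 × z ≈ (+ a) ^ n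
    euler a (yes a≈0) = 0ℤ , z≤n , ≈-sym (≈-trans (^-cong n a≈0) (reflexive (0^p 0<n)))
    euler a (no a≉0) = [ (λ eq → 1ℤ , s≤s z≤n , ≈-sym eq) , (λ eq → -1ℤ , s≤s z≤n , ≈-sym eq) ]′ (^n≈±1 a≉0)

    abstract
      -- Opaque, so that type checking does not unfold the divisibility test. The bound and the
      -- congruence below determine the value, as p > 2.
      χ : ℕ → ℤ
      χ a = proj₁ (euler a (≈0? a))

      ∣χ∣≤1 : ∀ a → ∣ χ a ∣ ℕ.≤ 1
      ∣χ∣≤1 a = proj₁ (proj₂ (euler a (≈0? a)))

      χ≈ : ∀ a → χ a ≈ (+ a) ^ n
      χ≈ a = proj₂ (proj₂ (euler a (≈0? a)))

    ∣∣≤1-unique : ∀ {z w} → ∣ z ∣ ℕ.≤ 1 → ∣ w ∣ ℕ.≤ 1 → z ≈ w → z ≡ w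
    ∣∣≤1-unique {z} {w} z≤1 w≤1 =
      ≈∧∣-∣<m⇒≡ (ℕ.≤-<-trans (ℤ.∣i-j∣≤∣i∣+∣j∣ z w) (ℕ.≤-<-trans (ℕ.+-mono-≤ z≤1 w≤1) 2<p))

    χ-unique : ∀ {a z} → ∣ z ∣ ℕ.≤ 1 → (+ a) ^ n ≈ z → χ a ≡ z
    χ-unique {a} z≤1 eq = ∣∣≤1-unique (∣χ∣≤1 a) z≤1 (≈-trans (χ≈ a) eq)

    χ-cong : ∀ {a b} → + a ≈ + b → χ a ≡ χ b
    χ-cong {a} {b} a≈b = χ-unique (∣χ∣≤1 b) (≈-trans (^-cong n a≈b) (≈-sym (χ≈ b)))

    χ-zero : ∀ {a} → + a ≈ 0ℤ → χ a ≡ 0ℤ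
    χ-zero a≈0 = χ-unique z≤n (≈-trans (^-cong n a≈0) (reflexive (0^p 0<n)))

    χ-* : ∀ a b → χ (a ℕ.* b) ≡ χ a * χ b
    χ-* a b = χ-unique (∣*∣≤1 (χ a) (χ b) (∣χ∣≤1 a) (∣χ∣≤1 b)) (begin
      (+ (a ℕ.* b)) ^ n          ≡⟨ cong (_^ n) (ℤ.pos-* a b) ⟩
      (+ a * + b) ^ n            ≡⟨ ^-distribʳ-* (+ a) (+ b) n ⟩
      (+ a) ^ n * (+ b) ^ n      ≈⟨ *-cong (χ≈ a) (χ≈ b) ⟨
      χ a * χ b                  ∎)

    χ-square : ∀ {a} → ¬ + a ≈ 0ℤ → χ a * χ a ≡ 1ℤ
    χ-square {a} a≉0 = ∣∣≤1-unique (∣*∣≤1 (χ a) (χ a) (∣χ∣≤1 a) (∣χ∣≤1 a)) (s≤s z≤n)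
      (≈-trans (*-cong (χ≈ a) (χ≈ a)) (^2n≈1 a≉0))

    χ-unit-cases : ∀ {a} → ¬ + a ≈ 0ℤ → χ a ≡ 1ℤ ⊎ χ a ≡ -1ℤ
    χ-unit-cases {a} a≉0 with ∣∣≤1-cases (∣χ∣≤1 a)
    ... | inj₂ cases = cases
    ... | inj₁ χa≡0  = contradiction (trans (sym (χ-square a≉0)) (cong₂ _*_ χa≡0 χa≡0)) λ ()

    [k+p]≈k : ∀ k → + (k ℕ.+ p) ≈ + k
    [k+p]≈k k = begin
      + (k ℕ.+ p)     ≡⟨ ℤ.pos-+ k p ⟩
      + k + + p       ≈⟨ +-cong (≈-refl {+ k}) m≈0 ⟩
      + k + 0ℤ        ≡⟨ ℤ.+-identityʳ (+ k) ⟩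
      + k             ∎

    [k+p+u]≈k+u : ∀ k u → + (k ℕ.+ p ℕ.+ u) ≈ + (k ℕ.+ u)
    [k+p+u]≈k+u k u = ≈-trans (reflexive (ℤ.pos-+ (k ℕ.+ p) u)) (≈-trans (+-cong ([k+p]≈k k) (≈-refl {+ u})) (reflexive (sym (ℤ.pos-+ k u))))

    χ-periodic : ∀ u k → χ (k ℕ.+ p ℕ.+ u) ≡ χ (k ℕ.+ u)
    χ-periodic u k = χ-cong ([k+p+u]≈k+u k u)

    ∑ₚ-peel : ∀ f → ∑ p f ≡ f 0 + ∑ (n ℕ.+ n) (λ k → f (suc k))
    ∑ₚ-peel f = trans (cong (λ t → ∑ t f) p≡1+2n) (∑-peel (n ℕ.+ n) f)

    ∑χ² : ∑ p (λ k → χ k * χ k) ≡ + (n ℕ.+ n)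
    ∑χ² = trans (∑ₚ-peel _) (trans (cong₂ _+_ (cong₂ _*_ χ0≡0 χ0≡0)
        (trans (∑-cong (n ℕ.+ n) (λ k k<2n → χ-square (small-unit (s≤s z≤n) (subst (suc k ℕ.<_) (sym p≡1+2n) (s≤s k<2n)))))
          (trans (∑-const (n ℕ.+ n) 1ℤ) (ℤ.*-identityʳ (+ (n ℕ.+ n))))))
      (ℤ.+-identityˡ (+ (n ℕ.+ n))))
      where
      χ0≡0 : χ 0 ≡ 0ℤ
      χ0≡0 = χ-zero ≈-refl

    -- Expanding (k+c)^n leaves power sums of exponents n + j with j ≤ n. Those below 2n = p - 1
    -- vanish, and the one at j = n is -1 with coefficient 1.
    χ-autocorrelation≈ : ∀ c → ∑ p (λ k → χ k * χ (k ℕ.+ c)) ≈ -1ℤ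
    χ-autocorrelation≈ c = begin
      ∑ p (λ k → χ k * χ (k ℕ.+ c))
        ≈⟨ ∑-cong≈ p (λ k _ → expand k) ⟩
      ∑ p (λ k → ∑ (suc n) (λ j → coeff (+ c) n j * (+ k) ^ (n ℕ.+ j)))
        ≡⟨ ∑-swap p (suc n) (λ k j → coeff (+ c) n j * (+ k) ^ (n ℕ.+ j)) ⟩
      ∑ (suc n) (λ j → ∑ p (λ k → coeff (+ c) n j * (+ k) ^ (n ℕ.+ j)))
        ≡⟨ ∑-ext (suc n) (λ j → ∑-*ˡ p (coeff (+ c) n j) (λ k → (+ k) ^ (n ℕ.+ j))) ⟩
      ∑ n (λ j → coeff (+ c) n j * powerSum (n ℕ.+ j)) + coeff (+ c) n n * powerSum (n ℕ.+ n)
        ≈⟨ +-cong (∑≈0 n lower) (*-cong (reflexive top) powerSum-2n) ⟩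
      -1ℤ ∎
      where
      expand : ∀ k → χ k * χ (k ℕ.+ c) ≈ ∑ (suc n) (λ j → coeff (+ c) n j * (+ k) ^ (n ℕ.+ j))
      expand k = begin
        χ k * χ (k ℕ.+ c)                                             ≈⟨ *-cong (χ≈ k) (χ≈ (k ℕ.+ c)) ⟩
        (+ k) ^ n * (+ (k ℕ.+ c)) ^ n                                 ≡⟨ cong (λ t → (+ k) ^ n * t ^ n) (ℤ.pos-+ k c) ⟩
        (+ k) ^ n * (+ k + + c) ^ n                                   ≡⟨ cong ((+ k) ^ n *_) (binomial (+ k) (+ c) n) ⟩
        (+ k) ^ n * ∑ (suc n) (λ j → coeff (+ c) n j * (+ k) ^ j)     ≡⟨ ∑-*ˡ (suc n) ((+ k) ^ n) _ ⟨
        ∑ (suc n) (λ j → (+ k) ^ n * (coeff (+ c) n j * (+ k) ^ j))   ≡⟨ ∑-ext (suc n) (λ j →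
            trans (rearrange ((+ k) ^ n) (coeff (+ c) n j) ((+ k) ^ j)) (cong (coeff (+ c) n j *_) (sym (ℤ.^-distribˡ-+-* (+ k) n j)))) ⟩
        ∑ (suc n) (λ j → coeff (+ c) n j * (+ k) ^ (n ℕ.+ j))         ∎
        where
        rearrange : ∀ a b c → a * (b * c) ≡ b * (a * c)
        rearrange = solve-∀
      lower : ∀ j → j ℕ.< n → coeff (+ c) n j * powerSum (n ℕ.+ j) ≈ 0ℤ
      lower j j<n = ≈-trans (*-congˡ (coeff (+ c) n j) (powerSum≈0 (n ℕ.+ j) (ℕ.≤-<-trans (ℕ.+-monoʳ-< n j<n) 2n<p)))
                            (reflexive (ℤ.*-zeroʳ (coeff (+ c) n j)))
      top : coeff (+ c) n n ≡ 1ℤ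
      top = cong₂ (λ b e → + b * (+ c) ^ e) (nCn≡1 n) (ℕ.n∸n≡0 n)

    -- ∑ (χ k ± χ (k+c))² > 0 because its term at k = 0 is 1; this bounds the correlation strictly.
    χ-autocorrelation : ∀ {c} → ¬ + c ≈ 0ℤ → ∑ p (λ k → χ k * χ (k ℕ.+ c)) ≡ -1ℤ
    χ-autocorrelation {c} c≉0 = ≈∧∣-∣<m⇒≡ bound (χ-autocorrelation≈ c)
      where
      U : ℤ
      U = ∑ p (λ k → χ k * χ (k ℕ.+ c))
      square : ℤ → ℕ → ℤ
      square e k = (χ k - e * χ (k ℕ.+ c)) * (χ k - e * χ (k ℕ.+ c))
      ∑square : ∀ e → e * e ≡ 1ℤ → ∑ p (square e) ≡ + 2 * + (n ℕ.+ n) - + 2 * (e * U)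
      ∑square e e²≡1 = trans (∑-ext p (λ k → expand e (χ k) (χ (k ℕ.+ c))))
        (trans (∑-+ p (λ k → χ k * χ k + e * e * (χ (k ℕ.+ c) * χ (k ℕ.+ c))) (λ k → (- + 2 * e) * (χ k * χ (k ℕ.+ c))))
        (trans (cong₂ _+_
          (trans (∑-+ p (λ k → χ k * χ k) (λ k → e * e * (χ (k ℕ.+ c) * χ (k ℕ.+ c))))
            (cong₂ _+_ ∑χ² (trans (∑-*ˡ p (e * e) (λ k → χ (k ℕ.+ c) * χ (k ℕ.+ c)))
              (cong₂ _*_ e²≡1 (trans (∑-periodic p c (λ k → cong₂ _*_ (χ-cong ([k+p]≈k k)) (χ-cong ([k+p]≈k k)))) ∑χ²)))))
          (∑-*ˡ p (- + 2 * e) (λ k → χ k * χ (k ℕ.+ c))))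
        (collect (+ (n ℕ.+ n)) e U)))
        where
        expand : ∀ e a b → (a - e * b) * (a - e * b) ≡ a * a + e * e * (b * b) + (- + 2 * e) * (a * b)
        expand = solve-∀
        collect : ∀ m e u → m + 1ℤ * m + (- + 2 * e) * u ≡ + 2 * m - + 2 * (e * u)
        collect = solve-∀
      square≥1 : ∀ e → e * e ≡ 1ℤ → Σ ℕ λ m → ∑ p (square e) ≡ + suc m
      square≥1 e e²≡1 with ∑ (n ℕ.+ n) (λ k → square e (suc k)) in eq | ∑-nonneg (n ℕ.+ n) {λ k → square e (suc k)} (λ k → square-nonneg (χ (suc k) - e * χ (suc k ℕ.+ c)))
      ... | + m      | _ = m , trans (∑ₚ-peel (square e)) (trans (cong₂ _+_ first eq) refl)
        where
        first : square e 0 ≡ 1ℤ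
        first = trans (cong (λ t → (t - e * χ c) * (t - e * χ c)) (χ-zero ≈-refl)) (trans (expand e (χ c)) (trans (cong₂ _*_ e²≡1 (χ-square c≉0)) refl))
          where
          expand : ∀ e t → (0ℤ - e * t) * (0ℤ - e * t) ≡ e * e * (t * t)
          expand = solve-∀
      ... | -[1+ _ ] | ()
      small : ∀ e → e * e ≡ 1ℤ → + ∣ U ∣ ≡ e * U → ∣ U ∣ ℕ.< n ℕ.+ n
      small e e²≡1 ∣U∣≡ with square≥1 e e²≡1
      ... | m , eq with ℕ.<-≤-connex ∣ U ∣ (n ℕ.+ n)
      ...   | inj₁ lt = lt
      -- With e the sign of U and d the excess of its absolute value over 2n, the sum of squares
      -- equals -2d, although it is at least 1.
      ...   | inj₂ ge = contradiction total λ ()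
        where
        d : ℕ
        d = ∣ U ∣ ℕ.∸ (n ℕ.+ n)
        total : + suc (m ℕ.+ (d ℕ.+ d)) ≡ 0ℤ
        total = trans (cong₂ _+_ {+ suc m} (trans (sym eq) (trans (∑square e e²≡1) (cong (λ t → + 2 * + (n ℕ.+ n) - + 2 * t)
            (trans (sym ∣U∣≡) (trans (cong +_ (sym (ℕ.m+[n∸m]≡n ge))) (ℤ.pos-+ (n ℕ.+ n) d)))))) (ℤ.pos-+ d d))
          (cancel (+ (n ℕ.+ n)) (+ d))
          where
          cancel : ∀ a d → + 2 * a - + 2 * (a + d) + (d + d) ≡ 0ℤ
          cancel = solve-∀
      ∣U∣<2n : ∣ U ∣ ℕ.< n ℕ.+ n
      ∣U∣<2n with ℤ.+∣i∣≡i⊎+∣i∣≡-i U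
      ... | inj₁ eq = small 1ℤ refl (trans eq (sym (ℤ.*-identityˡ U)))
      ... | inj₂ eq = small -1ℤ refl (trans eq (sym (ℤ.-1*i≡-i U)))
      bound : ∣ U - -1ℤ ∣ ℕ.< p
      bound = ℕ.≤-<-trans (ℤ.∣i-j∣≤∣i∣+∣j∣ U -1ℤ) (ℕ.≤-<-trans (ℕ.≤-trans (ℕ.≤-reflexive (ℕ.+-comm ∣ U ∣ 1)) ∣U∣<2n) 2n<p)

    -- The character takes naturals, so the translation by -u is carried out as one by (p-1) u.
    χ-correlation-shift : ∀ u v → ∑ p (λ k → χ (k ℕ.+ u) * χ (k ℕ.+ v)) ≡ ∑ p (λ k → χ k * χ (k ℕ.+ (ℕ.pred p ℕ.* u ℕ.+ v)))
    χ-correlation-shift u v = trans (sym (∑-periodic p (ℕ.pred p ℕ.* u) (λ k → cong₂ _*_ (χ-periodic u k) (χ-periodic v k))))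
      (∑-ext p (λ k → cong₂ _*_
        (χ-cong (begin
          + (k ℕ.+ ℕ.pred p ℕ.* u ℕ.+ u)       ≡⟨ cong +_ (trans (ℕ.+-assoc k _ u) (cong (k ℕ.+_) (trans (ℕ.+-comm _ u) (cong (ℕ._* u) (ℕ.suc-pred p))))) ⟩
          + (k ℕ.+ p ℕ.* u)                    ≡⟨ trans (ℤ.pos-+ k (p ℕ.* u)) (cong (λ t → + k + t) (ℤ.pos-* p u)) ⟩
          + k + + p * + u                      ≈⟨ +-cong (≈-refl {+ k}) (*-congʳ (+ u) m≈0) ⟩
          + k + 0ℤ * + u                       ≡⟨ ℤ.+-identityʳ (+ k) ⟩
          + k                                  ∎))
        (cong χ (ℕ.+-assoc k _ v))))

    [p-1]u+v≈v-u : ∀ u v → + (ℕ.pred p ℕ.* u ℕ.+ v) ≈ + v - + u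
    [p-1]u+v≈v-u u v = begin
      + (ℕ.pred p ℕ.* u ℕ.+ v)                 ≡⟨ trans (ℤ.pos-+ (ℕ.pred p ℕ.* u) v) (cong (_+ + v) (ℤ.pos-* (ℕ.pred p) u)) ⟩
      + ℕ.pred p * + u + + v                   ≡⟨ eq (+ ℕ.pred p) (+ u) (+ v) ⟩
      + suc (ℕ.pred p) * + u + (+ v - + u)     ≈⟨ +-cong (*-congʳ (+ u) (≈-trans (reflexive (cong +_ (ℕ.suc-pred p))) m≈0)) (≈-refl {+ v - + u}) ⟩
      0ℤ * + u + (+ v - + u)                   ≡⟨ ℤ.+-identityˡ (+ v - + u) ⟩
      + v - + u                                ∎
      where
      eq : ∀ a u v → a * u + v ≡ (1ℤ + a) * u + (v - u)
      eq = solve-∀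

    χ-correlation-≉ : ∀ {u v} → ¬ + u ≈ + v → ∑ p (λ k → χ (k ℕ.+ u) * χ (k ℕ.+ v)) ≡ -1ℤ
    χ-correlation-≉ {u} {v} u≉v = trans (χ-correlation-shift u v) (χ-autocorrelation (λ c≈0 →
      u≉v (≈-sym (difference≈0⇒≈ (≈-trans (≈-sym ([p-1]u+v≈v-u u v)) c≈0)))))

    χ-correlation-≡ : ∀ u → ∑ p (λ k → χ (k ℕ.+ u) * χ (k ℕ.+ u)) ≡ + p - 1ℤ
    χ-correlation-≡ u = trans (∑-periodic p u (λ k → cong₂ _*_ (χ-cong ([k+p]≈k k)) (χ-cong ([k+p]≈k k))))
      (trans ∑χ² (trans (eq (+ (n ℕ.+ n))) (cong (λ t → + t - 1ℤ) (sym p≡1+2n))))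
      where
      eq : ∀ a → a ≡ 1ℤ + a - 1ℤ
      eq = solve-∀

  ^-evenˡ : ∀ x r → (- x) ^ (r ℕ.+ r) ≡ x ^ (r ℕ.+ r)
  ^-evenˡ x r = begin
    (- x) ^ (r ℕ.+ r)       ≡⟨ ℤ.^-distribˡ-+-* (- x) r r ⟩
    (- x) ^ r * (- x) ^ r   ≡⟨ ^-distribʳ-* (- x) (- x) r ⟨
    (- x * - x) ^ r         ≡⟨ cong (_^ r) (eq x) ⟩
    (x * x) ^ r             ≡⟨ ^-distribʳ-* x x r ⟩
    x ^ r * x ^ r           ≡⟨ ℤ.^-distribˡ-+-* x r r ⟨
    x ^ (r ℕ.+ r)           ∎
    where
    open ≡-Reasoning
    eq : ∀ x → - x * - x ≡ x * x
    eq = solve-∀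

  -- Jacobsthal sums for p = 4r + 1.

  module Jacobsthal (p : ℕ) (prime : Prime p) (r : ℕ) (p≡1+4r : p ≡ suc (r ℕ.+ r ℕ.+ (r ℕ.+ r))) where
    n : ℕ
    n = r ℕ.+ r

    open QuadraticCharacter p prime n p≡1+4r public
    open import Relation.Binary.Reasoning.Setoid ≈-setoid

    0<r : 0 ℕ.< r
    0<r = ℕ.n≢0⇒n>0 λ r≡0 → ℕ.<-irrefl (cong (λ t → t ℕ.+ t) (sym r≡0)) 0<n

    2≉0 : ¬ + 2 ≈ 0ℤ
    2≉0 = small-unit (s≤s z≤n) 2<p

    sum≡p⇒≈- : ∀ {a b} → a ℕ.+ b ≡ p → + b ≈ - + a
    sum≡p⇒≈- {a} {b} a+b≡p = begin
      + b                  ≡⟨ eq (+ a) (+ b) ⟩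
      + a + + b - + a      ≡⟨ cong (_- + a) (trans (sym (ℤ.pos-+ a b)) (cong +_ a+b≡p)) ⟩
      + p - + a            ≈⟨ +-cong m≈0 (≈-refl { - + a}) ⟩
      0ℤ - + a             ≡⟨ ℤ.+-identityˡ (- + a) ⟩
      - + a                ∎
      where
      eq : ∀ a b → b ≡ a + b - a
      eq = solve-∀

    -- The exponent n = 2r is even, so χ is an even function; b = p - a represents -a.
    χ-reflect : ∀ {a b} → a ℕ.+ b ≡ p → χ a ≡ χ b
    χ-reflect {a} {b} a+b≡p = χ-unique (∣χ∣≤1 b) (begin
      (+ a) ^ n      ≡⟨ ^-evenˡ (+ a) r ⟨
      (- + a) ^ n    ≈⟨ ^-cong n (sum≡p⇒≈- a+b≡p) ⟨
      (+ b) ^ n      ≈⟨ χ≈ b ⟨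
      χ b            ∎)

    -- Pairs a with p - a, which carries the upper half of the nonzero residues to the lower half.
    ∑-halve : ∀ f → f 0 ≡ 0ℤ → (∀ {a b} → a ℕ.+ b ≡ p → f a ≡ f b) →
              ∑ p f ≡ ∑ n (λ k → f (suc k)) + ∑ n (λ k → f (suc k))
    ∑-halve f f0≡0 reflect = trans (∑ₚ-peel f) (trans (cong₂ _+_ f0≡0 (trans (∑-split n n (λ k → f (suc k)))
        (cong (λ t → ∑ n (λ k → f (suc k)) + t) (trans (∑-reverse n (λ k → f (suc (n ℕ.+ k))))
          (∑-cong n (λ k k<n → reflect (complement k k<n)))))))
      (ℤ.+-identityˡ (∑ n (λ k → f (suc k)) + ∑ n (λ k → f (suc k)))))
      where
      complement : ∀ k → k ℕ.< n → suc (n ℕ.+ (n ℕ.∸ suc k)) ℕ.+ suc k ≡ p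
      complement k k<n = trans (cong suc (trans (ℕ.+-assoc n _ (suc k)) (cong (n ℕ.+_) (ℕ.m∸n+n≡m k<n)))) (sym p≡1+4r)

    double-cancel : ∀ {a b} → a + a ≈ b + b → a ≈ b
    double-cancel {a} {b} eq = *-cancelˡ (+ 2) 2≉0 (≈-trans (reflexive (two a)) (≈-trans eq (reflexive (sym (two b)))))
      where
      two : ∀ a → + 2 * a ≡ a + a
      two = solve-∀

    suc-unit : ∀ {k} → k ℕ.< n → ¬ + suc k ≈ 0ℤ
    suc-unit k<n = small-unit (s≤s z≤n) (ℕ.<-trans (s≤s k<n) 1+n<p)

    -- Twice this half-sum is `powerSum n` modulo p, hence 0, and its size is at most n < p.
    ∑χ≡0 : ∑ n (λ k → χ (suc k)) ≡ 0ℤ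
    ∑χ≡0 = ≈0∧∣∣<m⇒≡0 (ℕ.≤-<-trans (∣∑∣≤ n _ (λ k → ∣χ∣≤1 (suc k))) (ℕ.<-trans (ℕ.n<1+n n) 1+n<p)) (double-cancel (begin
      ∑ n (λ k → χ (suc k)) + ∑ n (λ k → χ (suc k))   ≡⟨ ∑-halve χ (χ-zero ≈-refl) χ-reflect ⟨
      ∑ p χ                                           ≈⟨ ∑-cong≈ p (λ k _ → χ≈ k) ⟩
      powerSum n                                      ≈⟨ powerSum≈0 n 1+n<p ⟩
      0ℤ                                              ∎))

    ∑ₚχ≡0 : ∑ p χ ≡ 0ℤ
    ∑ₚχ≡0 = trans (∑-halve χ (χ-zero ≈-refl) χ-reflect) (cong₂ _+_ ∑χ≡0 ∑χ≡0)

    -- Half of the Jacobsthal sum of χ(a) χ(a² + k) over all residues a.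
    S : ℕ → ℤ
    S k = ∑ n (λ a → χ (suc a) * χ (k ℕ.+ suc a ℕ.* suc a))

    S+S : ∀ k → ∑ p (λ a → χ a * χ (k ℕ.+ a ℕ.* a)) ≡ S k + S k
    S+S k = ∑-halve (λ a → χ a * χ (k ℕ.+ a ℕ.* a)) (cong (_* χ (k ℕ.+ 0)) (χ-zero ≈-refl))
      λ {a} {b} a+b≡p → cong₂ _*_ (χ-reflect a+b≡p) (χ-cong (begin
        + (k ℕ.+ a ℕ.* a)          ≡⟨ trans (ℤ.pos-+ k (a ℕ.* a)) (cong (λ t → + k + t) (ℤ.pos-* a a)) ⟩
        + k + + a * + a            ≡⟨ cong (λ t → + k + t) (eq (+ a)) ⟩
        + k + - + a * - + a        ≈⟨ +-cong (≈-refl {+ k}) (*-cong (sum≡p⇒≈- {a} {b} a+b≡p) (sum≡p⇒≈- {a} {b} a+b≡p)) ⟨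
        + k + + b * + b            ≡⟨ trans (ℤ.pos-+ k (b ℕ.* b)) (cong (λ t → + k + t) (ℤ.pos-* b b)) ⟨
        + (k ℕ.+ b ℕ.* b)          ∎))
      where
      eq : ∀ a → a * a ≡ - a * - a
      eq = solve-∀

    ∣S∣≤n : ∀ k → ∣ S k ∣ ℕ.≤ n
    ∣S∣≤n k = ∣∑∣≤ n _ (λ a → ∣*∣≤1 (χ (suc a)) (χ (k ℕ.+ suc a ℕ.* suc a)) (∣χ∣≤1 (suc a)) (∣χ∣≤1 (k ℕ.+ suc a ℕ.* suc a)))

    -- Of the exponents n + 2j, 0 ≤ j ≤ n, only j = r gives a multiple of p - 1, hence a nonzero power sum.
    S+S≈ : ∀ k → S k + S k ≈ - (+ (n C r) * (+ k) ^ r)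
    S+S≈ k = begin
      S k + S k
        ≡⟨ S+S k ⟨
      ∑ p (λ a → χ a * χ (k ℕ.+ a ℕ.* a))
        ≈⟨ ∑-cong≈ p (λ a _ → expand a) ⟩
      ∑ p (λ a → ∑ (suc n) (λ j → coeff (+ k) n j * (+ a) ^ (n ℕ.+ (j ℕ.+ j))))
        ≡⟨ ∑-swap p (suc n) (λ a j → coeff (+ k) n j * (+ a) ^ (n ℕ.+ (j ℕ.+ j))) ⟩
      ∑ (suc n) (λ j → ∑ p (λ a → coeff (+ k) n j * (+ a) ^ (n ℕ.+ (j ℕ.+ j))))
        ≡⟨ ∑-ext (suc n) (λ j → ∑-*ˡ p (coeff (+ k) n j) (λ a → (+ a) ^ (n ℕ.+ (j ℕ.+ j)))) ⟩
      ∑ (suc n) t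
        ≡⟨ trans (cong (λ m → ∑ m t) (sym (ℕ.+-suc r r))) (trans (∑-split r (suc r) t) (cong (λ x → ∑ r t + x) (∑-peel r (λ j → t (r ℕ.+ j))))) ⟩
      ∑ r t + (t (r ℕ.+ 0) + ∑ r (λ j → t (r ℕ.+ suc j)))
        ≈⟨ +-cong (∑≈0 r low) (+-cong middle (∑≈0 r high)) ⟩
      0ℤ + (- (+ (n C r) * (+ k) ^ r) + 0ℤ)
        ≡⟨ trans (ℤ.+-identityˡ _) (ℤ.+-identityʳ _) ⟩
      - (+ (n C r) * (+ k) ^ r) ∎
      where
      t : ℕ → ℤ
      t j = coeff (+ k) n j * powerSum (n ℕ.+ (j ℕ.+ j))
      expand : ∀ a → χ a * χ (k ℕ.+ a ℕ.* a) ≈ ∑ (suc n) (λ j → coeff (+ k) n j * (+ a) ^ (n ℕ.+ (j ℕ.+ j)))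
      expand a = begin
        χ a * χ (k ℕ.+ a ℕ.* a)
          ≈⟨ *-cong (χ≈ a) (χ≈ (k ℕ.+ a ℕ.* a)) ⟩
        (+ a) ^ n * (+ (k ℕ.+ a ℕ.* a)) ^ n
          ≡⟨ cong (λ u → (+ a) ^ n * u ^ n) (trans (cong +_ (ℕ.+-comm k (a ℕ.* a))) (trans (ℤ.pos-+ (a ℕ.* a) k) (cong (_+ + k) (ℤ.pos-* a a)))) ⟩
        (+ a) ^ n * (+ a * + a + + k) ^ n
          ≡⟨ cong ((+ a) ^ n *_) (binomial (+ a * + a) (+ k) n) ⟩
        (+ a) ^ n * ∑ (suc n) (λ j → coeff (+ k) n j * (+ a * + a) ^ j)
          ≡⟨ ∑-*ˡ (suc n) ((+ a) ^ n) _ ⟨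
        ∑ (suc n) (λ j → (+ a) ^ n * (coeff (+ k) n j * (+ a * + a) ^ j))
          ≡⟨ ∑-ext (suc n) (λ j → trans (rearrange ((+ a) ^ n) (coeff (+ k) n j) ((+ a * + a) ^ j)) (cong (coeff (+ k) n j *_) (merge j))) ⟩
        ∑ (suc n) (λ j → coeff (+ k) n j * (+ a) ^ (n ℕ.+ (j ℕ.+ j))) ∎
        where
        rearrange : ∀ a b c → a * (b * c) ≡ b * (a * c)
        rearrange = solve-∀
        merge : ∀ j → (+ a) ^ n * (+ a * + a) ^ j ≡ (+ a) ^ (n ℕ.+ (j ℕ.+ j))
        merge j = trans (cong ((+ a) ^ n *_) (trans (^-distribʳ-* (+ a) (+ a) j) (sym (ℤ.^-distribˡ-+-* (+ a) j j))))
                        (sym (ℤ.^-distribˡ-+-* (+ a) n (j ℕ.+ j)))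
      zero-power : ∀ j → powerSum (n ℕ.+ (j ℕ.+ j)) ≈ 0ℤ → t j ≈ 0ℤ
      zero-power j eq = ≈-trans (*-congˡ (coeff (+ k) n j) eq) (reflexive (ℤ.*-zeroʳ (coeff (+ k) n j)))
      low : ∀ j → j ℕ.< r → t j ≈ 0ℤ
      low j j<r = zero-power j (powerSum≈0 _ (ℕ.≤-<-trans (ℕ.+-monoʳ-< n (ℕ.+-mono-< j<r j<r)) 2n<p))
      high : ∀ j → j ℕ.< r → t (r ℕ.+ suc j) ≈ 0ℤ
      high j j<r = zero-power (r ℕ.+ suc j) (begin
        powerSum (n ℕ.+ (r ℕ.+ suc j ℕ.+ (r ℕ.+ suc j)))   ≡⟨ cong powerSum (trans (exponent r j) (cong (ℕ._+ suc (j ℕ.+ suc j)) (sym p-1≡2n))) ⟩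
        powerSum (ℕ.pred p ℕ.+ suc (j ℕ.+ suc j))          ≈⟨ powerSum-periodic (j ℕ.+ suc j) ⟩
        powerSum (suc (j ℕ.+ suc j))                       ≈⟨ powerSum≈0 _ (ℕ.≤-<-trans (s≤s (ℕ.+-mono-≤ j<r j<r)) 1+n<p) ⟩
        0ℤ                                                 ∎)
        where
        exponent : ∀ r j → r ℕ.+ r ℕ.+ (r ℕ.+ suc j ℕ.+ (r ℕ.+ suc j)) ≡ r ℕ.+ r ℕ.+ (r ℕ.+ r) ℕ.+ suc (j ℕ.+ suc j)
        exponent = ℕSolver.solve-∀
      middle : t (r ℕ.+ 0) ≈ - (+ (n C r) * (+ k) ^ r)
      middle = begin
        t (r ℕ.+ 0)                                          ≡⟨ cong t (ℕ.+-identityʳ r) ⟩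
        + (n C r) * (+ k) ^ (n ℕ.∸ r) * powerSum (n ℕ.+ n)   ≈⟨ *-cong (reflexive (cong (λ e → + (n C r) * (+ k) ^ e) (ℕ.m+n∸n≡m r r))) powerSum-2n ⟩
        + (n C r) * (+ k) ^ r * -1ℤ                          ≡⟨ trans (ℤ.*-comm _ -1ℤ) (ℤ.-1*i≡-i _) ⟩
        - (+ (n C r) * (+ k) ^ r)                            ∎

    -- The squares of k^r and l^r are k^n and l^n, so equal characters give k^r ≡ ± l^r. By `S+S≈`
    -- then S(k) ≡ ± S(l), and both being at most n in size makes this an equality.
    S²-cong : ∀ {k l} → ¬ + k ≈ 0ℤ → χ k ≡ χ l → S k * S k ≡ S l * S l
    S²-cong {k} {l} k≉0 χk≡χl = [ (λ eq → cong (λ t → t * t) (plus eq)) , (λ eq → trans (cong (λ t → t * t) (minus eq)) (neg² (S l))) ]′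
      (≈0-split ((+ k) ^ r - (+ l) ^ r) ((+ k) ^ r - - (+ l) ^ r) (begin
        ((+ k) ^ r - (+ l) ^ r) * ((+ k) ^ r - - (+ l) ^ r)   ≡⟨ factor ((+ k) ^ r) ((+ l) ^ r) ⟩
        (+ k) ^ r * (+ k) ^ r - (+ l) ^ r * (+ l) ^ r         ≡⟨ cong₂ _-_ (ℤ.^-distribˡ-+-* (+ k) r r) (ℤ.^-distribˡ-+-* (+ l) r r) ⟨
        (+ k) ^ n - (+ l) ^ n                                 ≈⟨ +-cong (χ≈ k) (-‿cong (χ≈ l)) ⟨
        χ k - χ l                                             ≡⟨ ℤ.i≡j⇒i-j≡0 χk≡χl ⟩
        0ℤ                                                    ∎))
      where
      factor : ∀ a b → (a - b) * (a - - b) ≡ a * a - b * b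
      factor = solve-∀
      neg² : ∀ a → - a * - a ≡ a * a
      neg² = solve-∀
      2n-bound : ∀ a b → ∣ a ∣ ℕ.≤ n → ∣ b ∣ ℕ.≤ n → ∣ a - b ∣ ℕ.< p
      2n-bound a b a≤n b≤n = ℕ.≤-<-trans (ℤ.∣i-j∣≤∣i∣+∣j∣ a b) (ℕ.≤-<-trans (ℕ.+-mono-≤ a≤n b≤n) 2n<p)
      plus : (+ k) ^ r - (+ l) ^ r ≈ 0ℤ → S k ≡ S l
      plus eq = ≈∧∣-∣<m⇒≡ (2n-bound (S k) (S l) (∣S∣≤n k) (∣S∣≤n l)) (double-cancel (begin
        S k + S k                      ≈⟨ S+S≈ k ⟩
        - (+ (n C r) * (+ k) ^ r)      ≈⟨ -‿cong (*-congˡ (+ (n C r)) (difference≈0⇒≈ {(+ k) ^ r} {(+ l) ^ r} eq)) ⟩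
        - (+ (n C r) * (+ l) ^ r)      ≈⟨ S+S≈ l ⟨
        S l + S l                      ∎))
      minus : (+ k) ^ r - - (+ l) ^ r ≈ 0ℤ → S k ≡ - S l
      minus eq = ≈∧∣-∣<m⇒≡ (2n-bound (S k) (- S l) (∣S∣≤n k) (subst (ℕ._≤ n) (sym (ℤ.∣-i∣≡∣i∣ (S l))) (∣S∣≤n l))) (double-cancel (begin
        S k + S k                      ≈⟨ S+S≈ k ⟩
        - (+ (n C r) * (+ k) ^ r)      ≈⟨ -‿cong (*-congˡ (+ (n C r)) (difference≈0⇒≈ {(+ k) ^ r} { - (+ l) ^ r} eq)) ⟩
        - (+ (n C r) * - (+ l) ^ r)    ≡⟨ cong -_ (sym (ℤ.neg-distribʳ-* (+ (n C r)) ((+ l) ^ r))) ⟩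
        - - (+ (n C r) * (+ l) ^ r)    ≈⟨ -‿cong (S+S≈ l) ⟨
        - (S l + S l)                  ≡⟨ ℤ.neg-distrib-+ (S l) (S l) ⟩
        - S l + - S l                  ∎))

    S0≡0 : ∀ {k} → + k ≈ 0ℤ → S k ≡ 0ℤ
    S0≡0 {k} k≈0 = ≈0∧∣∣<m⇒≡0 (ℕ.≤-<-trans (∣S∣≤n k) (ℕ.<-trans (ℕ.n<1+n n) 1+n<p)) (double-cancel (begin
      S k + S k                      ≈⟨ S+S≈ k ⟩
      - (+ (n C r) * (+ k) ^ r)      ≈⟨ -‿cong (*-congˡ (+ (n C r)) (≈-trans (^-cong r k≈0) (reflexive (0^p 0<r)))) ⟩
      - (+ (n C r) * 0ℤ)             ≡⟨ cong -_ (ℤ.*-zeroʳ (+ (n C r))) ⟩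
      0ℤ                             ∎))

    -- Equal squares would make p divide the difference or the sum of two distinct numbers between 1
    -- and n; both are nonzero and smaller than p in size.
    squares-distinct : ∀ {a b} → a ℕ.< n → b ℕ.< n → b ≢ a → ¬ + (suc a ℕ.* suc a) ≈ + (suc b ℕ.* suc b)
    squares-distinct {a} {b} a<n b<n b≢a eq = [ (λ d → b≢a (ℕ.suc-injective (sym (ℤ.+-injective (≈∧∣-∣<m⇒≡ small (difference≈0⇒≈ d)))))) ,
        small-unit (s≤s z≤n) (ℕ.≤-<-trans (ℕ.+-mono-≤ a<n b<n) 2n<p) ]′
      (≈0-split (+ suc a - + suc b) (+ (suc a ℕ.+ suc b)) (begin
        (+ suc a - + suc b) * + (suc a ℕ.+ suc b)          ≡⟨ cong ((+ suc a - + suc b) *_) (ℤ.pos-+ (suc a) (suc b)) ⟩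
        (+ suc a - + suc b) * (+ suc a + + suc b)          ≡⟨ factor (+ suc a) (+ suc b) ⟩
        + suc a * + suc a - + suc b * + suc b              ≡⟨ cong₂ _-_ (ℤ.pos-* (suc a) (suc a)) (ℤ.pos-* (suc b) (suc b)) ⟨
        + (suc a ℕ.* suc a) - + (suc b ℕ.* suc b)          ≈⟨ ≈⇒difference≈0 eq ⟩
        0ℤ                                                 ∎))
      where
      factor : ∀ a b → (a - b) * (a + b) ≡ a * a - b * b
      factor = solve-∀
      small : ∣ + suc a - + suc b ∣ ℕ.< p
      small = ℕ.≤-<-trans (ℤ.∣i-j∣≤∣i∣+∣j∣ (+ suc a) (+ suc b)) (ℕ.≤-<-trans (ℕ.+-mono-≤ a<n b<n) 2n<p)

    -- After expanding the square and summing over k first, each pair (a, b) contributes a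
    -- correlation of χ at the shifts a² and b²: p - 1 on the diagonal and -1 off it. The constant
    -- -1 cancels in each row because the half-sum of χ is 0, which leaves p for each of the n rows.
    ∑S² : ∑ p (λ k → S k * S k) ≡ + n * + p
    ∑S² =
      trans (∑-ext p (λ k → sym (∑-∑-* n n (s k) (s k)))) (
      trans (∑-swap p n (λ k a → ∑ n (λ b → s k a * s k b))) (
      trans (∑-ext n (λ a → ∑-swap p n (λ k b → s k a * s k b))) (
      trans (∑-ext n (λ a → ∑-ext n (λ b → trans
        (∑-ext p (λ k → rearrange (c a) (χ (k ℕ.+ q a)) (c b) (χ (k ℕ.+ q b))))
        (∑-*ˡ p (c a * c b) (λ k → χ (k ℕ.+ q a) * χ (k ℕ.+ q b)))))) (
      trans (∑-cong n row) (∑-const n (+ p))))))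
      where
      c : ℕ → ℤ
      c a = χ (suc a)
      q : ℕ → ℕ
      q a = suc a ℕ.* suc a
      s : ℕ → ℕ → ℤ
      s k a = c a * χ (k ℕ.+ q a)
      corr : ℕ → ℕ → ℤ
      corr a b = ∑ p (λ k → χ (k ℕ.+ q a) * χ (k ℕ.+ q b))
      rearrange : ∀ a b c d → a * b * (c * d) ≡ a * c * (b * d)
      rearrange = solve-∀
      row : ∀ a → a ℕ.< n → ∑ n (λ b → c a * c b * corr a b) ≡ + p
      row a a<n = trans
        (∑-differ-at n {g = λ b → - c a * c b} {i = a} {c = + p} a<n
          (λ b b<n b≢a → trans (cong (c a * c b *_) (χ-correlation-≉ (squares-distinct a<n b<n b≢a))) (away (c a) (c b)))
          (trans (cong (c a * c a *_) (χ-correlation-≡ (q a)))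
            (trans (at (c a) (+ p)) (cong (λ t → - c a * c a + t) (trans (cong (_* + p) (χ-square (suc-unit a<n))) (ℤ.*-identityˡ (+ p)))))))
        (trans (cong (_+ + p) (trans (∑-*ˡ n (- c a) c) (trans (cong (- c a *_) ∑χ≡0) (ℤ.*-zeroʳ (- c a)))))
          (ℤ.+-identityˡ (+ p)))
        where
        away : ∀ a b → a * b * -1ℤ ≡ - a * b
        away = solve-∀
        at : ∀ a m → a * a * (m - 1ℤ) ≡ - a * a + a * a * m
        at = solve-∀

  module Mod4 = Congruence 4
  module Mod8 = Congruence 8

  ∑-+-≡ : ∀ n {f g : ℕ → ℤ} {x y} → ∑ n f ≡ x → ∑ n g ≡ y → ∑ n (λ k → f k + g k) ≡ x + y
  ∑-+-≡ n {f} {g} eq eq' = trans (∑-+ n f g) (cong₂ _+_ eq eq')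

  parity : ∀ m → (Σ ℕ λ t → m ≡ t ℕ.+ t) ⊎ (Σ ℕ λ t → m ≡ suc (t ℕ.+ t))
  parity zero    = inj₁ (0 , refl)
  parity (suc m) = [ (λ { (t , eq) → inj₂ (t , cong suc eq) })
                   , (λ { (t , eq) → inj₁ (suc t , trans (cong suc eq) (cong suc (sym (ℕ.+-suc t t)))) }) ]′ (parity m)

  -1^even : ∀ t → -1ℤ ^ (t ℕ.+ t) ≡ 1ℤ
  -1^even t = trans (^-evenˡ 1ℤ t) (ℤ.^-zeroˡ (t ℕ.+ t))

  square≡square⇒≡± : ∀ x a → x * x ≡ a * a → x ≡ a ⊎ x ≡ - a
  square≡square⇒≡± x a eq = Sum.map (ℤ.i-j≡0⇒i≡j x a) (λ d → ℤ.i-j≡0⇒i≡j x (- a) d)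
    (ℤ.i*j≡0⇒i≡0∨j≡0 (x - a) (trans (factor x a) (ℤ.i≡j⇒i-j≡0 eq)))
    where
    factor : ∀ x a → (x - a) * (x - - a) ≡ x * x - a * a
    factor = solve-∀

  3+4z≢1+4w : ∀ z w → + 3 + + 4 * z ≢ 1ℤ + + 4 * w
  3+4z≢1+4w z w eq = contradiction (Mod4.≈0∧∣∣<m⇒≡0 (s≤s (s≤s (s≤s z≤n))) ((w - z) Mod4.byQuotient
    trans (isolate z) (trans (cong (_- (1ℤ + + 4 * z)) eq) (collect z w)))) λ ()
    where
    isolate : ∀ z → + 2 ≡ + 3 + + 4 * z - (1ℤ + + 4 * z)
    isolate = solve-∀
    collect : ∀ z w → 1ℤ + + 4 * w - (1ℤ + + 4 * z) ≡ 0ℤ + (w - z) * + 4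
    collect = solve-∀

  -- Uniqueness of x² in p = x² + 4y².

  module SumOfTwoSquares (p : ℕ) (prime : Prime p) where
    open PrimeModulus p prime

    -- If c² = 1 + m, the right side is -(3 + 4m) p², which is negative.
    1-4c²≥0⇒c≡0 : ∀ c v → v * v ≡ + p * + p * (1ℤ - + 4 * (c * c)) → c ≡ 0ℤ
    1-4c²≥0⇒c≡0 c v eq = [ (λ e → e) , (λ e → e) ]′ (ℤ.i*j≡0⇒i≡0∨j≡0 c (c²≡0 (abs-square c) (abs-square v)))
      where
      abs-square : ∀ z → Σ ℕ λ m → z * z ≡ + m
      abs-square (+ m)    = m ℕ.* m , sym (ℤ.pos-* m m)
      abs-square -[1+ m ] = suc m ℕ.* suc m , refl
      c²≡0 : (Σ ℕ λ m → c * c ≡ + m) → (Σ ℕ λ m → v * v ≡ + m) → c * c ≡ 0ℤ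
      c²≡0 (zero  , e) _ = e
      c²≡0 (suc m , e) (l , e') = contradiction (ℕ.m+n≡0⇒n≡0 l (ℤ.+-injective total)) (ℕ.≢-nonZero⁻¹ (p ℕ.* p ℕ.* (3 ℕ.+ 4 ℕ.* m)))
        where
        instance
          _ = ℕ.m*n≢0 p p
          _ = ℕ.m*n≢0 (p ℕ.* p) (3 ℕ.+ 4 ℕ.* m)
        total : + (l ℕ.+ p ℕ.* p ℕ.* (3 ℕ.+ 4 ℕ.* m)) ≡ 0ℤ
        total = trans (ℤ.pos-+ l _) (trans (cong₂ _+_ (trans (sym e') (trans eq (cong (λ t → + p * + p * (1ℤ - + 4 * t)) (trans e (ℤ.pos-+ 1 m)))))
            (trans (ℤ.pos-* (p ℕ.* p) _) (cong₂ _*_ (ℤ.pos-* p p) (trans (ℤ.pos-+ 3 (4 ℕ.* m)) (cong (λ t → + 3 + t) (ℤ.pos-* 4 m))))))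
          (cancel (+ p) (+ m)))
          where
          cancel : ∀ p m → p * p * (1ℤ - + 4 * (1ℤ + m)) + p * p * (+ 3 + + 4 * m) ≡ 0ℤ
          cancel = solve-∀

    -- Brahmagupta's identity gives p² = (xa + 4yb)² + 4 (xb - ya)². With xb - ya = cp the first
    -- square is p² (1 - 4c²), so c = 0 and xb = ya; then p (x² - a²) = 4 (xb - ya)(xb + ya)
    -- vanishes.
    unique′ : ∀ a b x y → + p ≡ a * a + + 4 * (b * b) → + p ≡ x * x + + 4 * (y * y) → x * b - y * a ≈ 0ℤ → x * x ≡ a * a
    unique′ a b x y p≡a²+4b² p≡x²+4y² (c byQuotient xb-ya≡cp) =
      ℤ.i-j≡0⇒i≡j (x * x) (a * a) ([ (λ p≡0 → contradiction (ℤ.+-injective p≡0) (ℕ.≢-nonZero⁻¹ p)) , (λ e → e) ]′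
        (ℤ.i*j≡0⇒i≡0∨j≡0 (+ p) (trans px²-pa² (trans (cong (λ t → + 4 * (t * (x * b + y * a))) xb≡ya) refl))))
      where
      norm : ∀ a b x y → (x * a + + 4 * (y * b)) * (x * a + + 4 * (y * b)) ≡ (x * x + + 4 * (y * y)) * (a * a + + 4 * (b * b)) - + 4 * ((x * b - y * a) * (x * b - y * a))
      norm = solve-∀
      collect : ∀ p c → p * p - + 4 * ((0ℤ + c * p) * (0ℤ + c * p)) ≡ p * p * (1ℤ - + 4 * (c * c))
      collect = solve-∀
      c≡0 : c ≡ 0ℤ
      c≡0 = 1-4c²≥0⇒c≡0 c (x * a + + 4 * (y * b)) (trans (norm a b x y) (trans
        (cong₂ (λ u w → u - + 4 * (w * w)) (cong₂ _*_ (sym p≡x²+4y²) (sym p≡a²+4b²)) xb-ya≡cp) (collect (+ p) c)))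
      xb≡ya : x * b - y * a ≡ 0ℤ
      xb≡ya = trans xb-ya≡cp (cong (λ t → 0ℤ + t * + p) c≡0)
      difference : ∀ a b x y → (a * a + + 4 * (b * b)) * (x * x) - (x * x + + 4 * (y * y)) * (a * a) ≡ + 4 * ((x * b - y * a) * (x * b + y * a))
      difference = solve-∀
      px²-pa² : + p * (x * x - a * a) ≡ + 4 * ((x * b - y * a) * (x * b + y * a))
      px²-pa² = trans (distrib (+ p) (x * x) (a * a)) (trans (cong₂ (λ s t → s * (x * x) - t * (a * a)) p≡a²+4b² p≡x²+4y²) (difference a b x y))
        where
        distrib : ∀ p s t → p * (s - t) ≡ p * s - p * t
        distrib = solve-∀

    -- The product (xb - ya)(xb + ya) equals p (b² - y²), so p divides a factor, and replacing y by
    -- -y exchanges the two factors.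
    unique : ∀ a b x y → + p ≡ a * a + + 4 * (b * b) → + p ≡ x * x + + 4 * (y * y) → x * x ≡ a * a
    unique a b x y p≡a²+4b² p≡x²+4y² =
      [ unique′ a b x y p≡a²+4b² p≡x²+4y²
      , unique′ a b x (- y) p≡a²+4b² (trans p≡x²+4y² (cong (λ t → x * x + + 4 * t) (neg² y)))
      ]′ (≈0-split (x * b - y * a) (x * b - - y * a)
           ((b * b - y * y) byQuotient trans (factor a b x y) (trans (cong₂ (λ s t → 0ℤ + (s * (b * b) - t * (y * y))) (sym p≡x²+4y²) (sym p≡a²+4b²)) (collect (+ p) (b * b) (y * y)))))
      where
      neg² : ∀ y → y * y ≡ - y * - y
      neg² = solve-∀
      factor : ∀ a b x y → (x * b - y * a) * (x * b - - y * a) ≡ 0ℤ + ((x * x + + 4 * (y * y)) * (b * b) - (a * a + + 4 * (b * b)) * (y * y))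
      factor = solve-∀
      collect : ∀ p s t → 0ℤ + (p * s - p * t) ≡ 0ℤ + (s - t) * p
      collect = solve-∀

  -- Gauss's congruence for the central binomial coefficient.

  module GaussCongruence (p : ℕ) (prime : Prime p) (r : ℕ) (p≡1+4r : p ≡ suc (r ℕ.+ r ℕ.+ (r ℕ.+ r))) where
    open Jacobsthal p prime r p≡1+4r public
    open import Relation.Binary.Reasoning.Setoid ≈-setoid

    1+[p-1]≡p : 1 ℕ.+ ℕ.pred p ≡ p
    1+[p-1]≡p = ℕ.suc-pred p

    χ1≡1 : χ 1 ≡ 1ℤ
    χ1≡1 = χ-unique (s≤s z≤n) (reflexive (ℤ.^-zeroˡ n))

    χ[p-1]≡1 : χ (ℕ.pred p) ≡ 1ℤ
    χ[p-1]≡1 = trans (sym (χ-reflect 1+[p-1]≡p)) χ1≡1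

    -- If χ were 1 on all of 1, ..., n, its half-sum would be n rather than 0.
    nonresidue : Σ ℕ λ g → χ g ≡ -1ℤ
    nonresidue = [ (λ found → found) , (λ eq → contradiction (ℤ.+-injective (trans (sym eq) ∑χ≡0)) (ℕ.>⇒≢ 0<n)) ]′ (search n ℕ.≤-refl)
      where
      search : ∀ m → m ℕ.≤ n → (Σ ℕ λ g → χ g ≡ -1ℤ) ⊎ ∑ m (λ k → χ (suc k)) ≡ + m
      search zero    _   = inj₂ refl
      search (suc m) m<n = [ inj₁ , (λ eq → [ (λ χ≡1 → inj₂ (trans (cong₂ _+_ eq χ≡1) (ℤ.+-comm (+ m) 1ℤ)))
                                            , (λ χ≡-1 → inj₁ (suc m , χ≡-1)) ]′ (χ-unit-cases (suc-unit m<n))) ]′ (search m (ℕ.<⇒≤ m<n))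

    a b : ℤ
    a = S (ℕ.pred p)
    b = S (proj₁ nonresidue)

    -- S(k)² is 0, a² or b² as χ(k) is 0, 1 or -1. The right side is the quadratic polynomial in
    -- χ(k) through these three values, so that summation over k needs only the sums of χ² and χ.
    2S² : ∀ k → + 2 * (S k * S k) ≡ χ k * χ k * (a * a + b * b) + χ k * (a * a - b * b)
    2S² k = by-cases (≈0? k)
      where
      zero-case : ∀ u v → + 2 * (0ℤ * 0ℤ) ≡ 0ℤ * 0ℤ * (u + v) + 0ℤ * (u - v)
      zero-case = solve-∀
      plus-case : ∀ u v → + 2 * u ≡ 1ℤ * 1ℤ * (u + v) + 1ℤ * (u - v)
      plus-case = solve-∀
      minus-case : ∀ u v → + 2 * v ≡ -1ℤ * -1ℤ * (u + v) + -1ℤ * (u - v)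
      minus-case = solve-∀
      rhs : ℤ → ℤ
      rhs x = x * x * (a * a + b * b) + x * (a * a - b * b)
      by-cases : Dec (+ k ≈ 0ℤ) → + 2 * (S k * S k) ≡ rhs (χ k)
      by-cases (yes k≈0) = trans (cong (λ t → + 2 * (t * t)) (S0≡0 k≈0)) (trans (zero-case (a * a) (b * b)) (cong rhs (sym (χ-zero k≈0))))
      by-cases (no k≉0) =
        [ (λ χ≡1 → trans (cong (+ 2 *_) (S²-cong k≉0 (trans χ≡1 (sym χ[p-1]≡1)))) (trans (plus-case (a * a) (b * b)) (cong rhs (sym χ≡1))))
        , (λ χ≡-1 → trans (cong (+ 2 *_) (S²-cong k≉0 (trans χ≡-1 (sym (proj₂ nonresidue))))) (trans (minus-case (a * a) (b * b)) (cong rhs (sym χ≡-1))))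
        ]′ (χ-unit-cases k≉0)

    p≡a²+b² : + p ≡ a * a + b * b
    p≡a²+b² = ℤ.*-cancelˡ-≡ (+ (n ℕ.+ n)) (+ p) (a * a + b * b) {{nonZero}} (
      trans (trans (cong (_* + p) (ℤ.pos-+ n n)) (regroup (+ n) (+ p))) (
      trans (cong (+ 2 *_) (sym ∑S²)) (
      trans (sym (∑-*ˡ p (+ 2) (λ k → S k * S k))) (
      trans (∑-ext p 2S²) (
      trans (∑-+-≡ p (trans (∑-*ʳ p (a * a + b * b) (λ k → χ k * χ k)) (cong (_* (a * a + b * b)) ∑χ²))
                     (trans (∑-*ʳ p (a * a - b * b) χ) (cong (_* (a * a - b * b)) ∑ₚχ≡0)))
            (ℤ.+-identityʳ _))))))
      where
      nonZero : ℕ.NonZero (n ℕ.+ n)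
      nonZero = ℕ.>-nonZero (ℕ.≤-trans 0<n (ℕ.m≤m+n n n))
      regroup : ∀ n p → (n + n) * p ≡ + 2 * (n * p)
      regroup = solve-∀

    -- Because k (k+2) = (k+1)² - 1, the triple product is the Jacobsthal summand at k + 1 with
    -- parameter p - 1 ≡ -1.
    tripleSum : ∑ p (λ k → χ (k ℕ.+ 0) * χ (k ℕ.+ 1) * χ (k ℕ.+ 2)) ≡ a + a
    tripleSum = trans (∑-ext p pointwise) (trans (∑-periodic p 1 periodic) (S+S (ℕ.pred p)))
      where
      f : ℕ → ℤ
      f j = χ j * χ (ℕ.pred p ℕ.+ j ℕ.* j)
      periodic : ∀ k → f (k ℕ.+ p) ≡ f k
      periodic k = cong₂ _*_ (χ-cong ([k+p]≈k k)) (χ-cong (begin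
        + (ℕ.pred p ℕ.+ (k ℕ.+ p) ℕ.* (k ℕ.+ p))      ≡⟨ trans (ℤ.pos-+ (ℕ.pred p) _) (cong (λ t → + ℕ.pred p + t) (ℤ.pos-* (k ℕ.+ p) (k ℕ.+ p))) ⟩
        + ℕ.pred p + + (k ℕ.+ p) * + (k ℕ.+ p)        ≈⟨ +-cong (≈-refl {+ ℕ.pred p}) (*-cong ([k+p]≈k k) ([k+p]≈k k)) ⟩
        + ℕ.pred p + + k * + k                        ≡⟨ trans (ℤ.pos-+ (ℕ.pred p) _) (cong (λ t → + ℕ.pred p + t) (ℤ.pos-* k k)) ⟨
        + (ℕ.pred p ℕ.+ k ℕ.* k)                      ∎))
      pointwise : ∀ k → χ (k ℕ.+ 0) * χ (k ℕ.+ 1) * χ (k ℕ.+ 2) ≡ f (k ℕ.+ 1)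
      pointwise k = trans (swap (χ (k ℕ.+ 0)) (χ (k ℕ.+ 1)) (χ (k ℕ.+ 2))) (cong (χ (k ℕ.+ 1) *_)
        (trans (sym (χ-* (k ℕ.+ 0) (k ℕ.+ 2))) (χ-cong (≈-trans (≈-sym ([k+p]≈k _)) (reflexive (cong +_ (
          trans (cong ((k ℕ.+ 0) ℕ.* (k ℕ.+ 2) ℕ.+_) (sym 1+[p-1]≡p)) (index k (ℕ.pred p)))))))))
        where
        swap : ∀ x y z → x * y * z ≡ y * (x * z)
        swap = solve-∀
        index : ∀ k m → (k ℕ.+ 0) ℕ.* (k ℕ.+ 2) ℕ.+ (1 ℕ.+ m) ≡ m ℕ.+ (k ℕ.+ 1) ℕ.* (k ℕ.+ 1)
        index = ℕSolver.solve-∀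

    -- ∏ (1 + χ(k+i)), i = 0, 1, 2, is divisible by 8 unless one of its factors is 1, that is k ∈ {0, p-2, p-1}.
    Π : ℕ → ℤ
    Π k = (1ℤ + χ (k ℕ.+ 0)) * (1ℤ + χ (k ℕ.+ 1)) * (1ℤ + χ (k ℕ.+ 2))

    -- In the expanded product the single characters sum to 0, and each of the three correlations
    -- contributes -1.
    ∑Π : ∑ p Π ≡ + p - + 3 + (a + a)
    ∑Π = trans (∑-ext p (λ k → expand (χ (k ℕ.+ 0)) (χ (k ℕ.+ 1)) (χ (k ℕ.+ 2))))
      (trans (∑-+-≡ p (trans (∑-const p 1ℤ) (ℤ.*-identityʳ (+ p)))
        (∑-+-≡ p (∑shift 0) (∑-+-≡ p (∑shift 1) (∑-+-≡ p (∑shift 2)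
        (∑-+-≡ p (corr 0 1 (λ ()) (s≤s z≤n)) (∑-+-≡ p (corr 0 2 (λ ()) ℕ.≤-refl) (∑-+-≡ p (corr 1 2 (λ ()) (s≤s z≤n)) tripleSum)))))))
      (collect (+ p) (a + a)))
      where
      expand : ∀ x y z → (1ℤ + x) * (1ℤ + y) * (1ℤ + z) ≡ 1ℤ + (x + (y + (z + (x * y + (x * z + (y * z + x * y * z))))))
      expand = solve-∀
      collect : ∀ p s → p + (0ℤ + (0ℤ + (0ℤ + (-1ℤ + (-1ℤ + (-1ℤ + s)))))) ≡ p - + 3 + s
      collect = solve-∀
      ∑shift : ∀ u → ∑ p (λ k → χ (k ℕ.+ u)) ≡ 0ℤ
      ∑shift u = trans (∑-periodic p u (λ k → χ-cong ([k+p]≈k k))) ∑ₚχ≡0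
      corr : ∀ u v → + u ≢ + v → ∣ + u - + v ∣ ℕ.≤ 2 → ∑ p (λ k → χ (k ℕ.+ u) * χ (k ℕ.+ v)) ≡ -1ℤ
      corr u v u≢v near = χ-correlation-≉ (λ u≈v → u≢v (≈∧∣-∣<m⇒≡ (ℕ.≤-<-trans near 2<p) u≈v))

    -- The exceptional terms at 0 and p - 2 are both 2 (1 + χ(2)) and the one at p - 1 is 4. The
    -- total 4 (1 + χ(2)) + 4 is 12 or 4.
    ∑Π≈4 : ∑ p Π Mod8.≈ + 4
    ∑Π≈4 = Mod8.≈-trans (Mod8.reflexive (trans (cong (λ t → ∑ t Π) p≡3+m) (cong (λ t → t + Π (suc m) + Π (suc (suc m))) (∑-peel m Π))))
      (Mod8.≈-trans (Mod8.+-cong (Mod8.+-cong (Mod8.+-cong (Mod8.≈-refl {Π 0}) (Mod8.∑≈0 m middle)) (Mod8.≈-refl {Π (suc m)})) (Mod8.≈-refl {Π (suc (suc m))}))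
      (Mod8.≈-trans (Mod8.reflexive (cong₂ _+_ (cong₂ (λ s t → s + 0ℤ + t) Π0 Π[p-2]) Π[p-1])) final))
      where
      m : ℕ
      m = n ℕ.+ n ℕ.∸ 2
      p≡3+m : p ≡ suc (suc (suc m))
      p≡3+m = trans p≡1+4r (cong suc (sym (ℕ.m+[n∸m]≡n (ℕ.+-mono-≤ 0<n 0<n))))
      triple : ∀ {x y z x' y' z'} → x ≡ x' → y ≡ y' → z ≡ z' → (1ℤ + x) * (1ℤ + y) * (1ℤ + z) ≡ (1ℤ + x') * (1ℤ + y') * (1ℤ + z')
      triple refl refl refl = refl
      Π0 : Π 0 ≡ (1ℤ + 0ℤ) * (1ℤ + 1ℤ) * (1ℤ + χ 2)
      Π0 = triple {z = χ 2} (χ-zero ≈-refl) χ1≡1 refl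
      χ-at-p+ : ∀ i j → j ≡ i ℕ.+ p → χ j ≡ χ i
      χ-at-p+ i j j≡i+p = trans (cong χ j≡i+p) (χ-cong ([k+p]≈k i))
      Π[p-2] : Π (suc m) ≡ (1ℤ + χ 2) * (1ℤ + 1ℤ) * (1ℤ + 0ℤ)
      Π[p-2] = triple
        (sym (χ-reflect (trans (cong (2 ℕ.+_) (ℕ.+-identityʳ (suc m))) (sym p≡3+m))))
        (trans (sym (χ-reflect (trans (cong suc (ℕ.+-comm (suc m) 1)) (sym p≡3+m)))) χ1≡1)
        (trans (χ-at-p+ 0 (suc m ℕ.+ 2) (trans (ℕ.+-comm (suc m) 2) (sym p≡3+m))) (χ-zero ≈-refl))
      Π[p-1] : Π (suc (suc m)) ≡ (1ℤ + 1ℤ) * (1ℤ + 0ℤ) * (1ℤ + 1ℤ)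
      Π[p-1] = triple
        (trans (sym (χ-reflect (trans (cong suc (ℕ.+-identityʳ (suc (suc m)))) (sym p≡3+m)))) χ1≡1)
        (trans (χ-at-p+ 0 (suc (suc m) ℕ.+ 1) (trans (ℕ.+-comm (suc (suc m)) 1) (sym p≡3+m))) (χ-zero ≈-refl))
        (trans (χ-at-p+ 1 (suc (suc m) ℕ.+ 2) (trans (ℕ.+-comm (suc (suc m)) 2) (cong suc (sym p≡3+m)))) χ1≡1)
      final : (1ℤ + 0ℤ) * (1ℤ + 1ℤ) * (1ℤ + χ 2) + 0ℤ + (1ℤ + χ 2) * (1ℤ + 1ℤ) * (1ℤ + 0ℤ) + (1ℤ + 1ℤ) * (1ℤ + 0ℤ) * (1ℤ + 1ℤ) Mod8.≈ + 4
      final = [ (λ eq → subst (λ t → total t Mod8.≈ + 4) (sym eq) (1ℤ Mod8.byQuotient refl))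
              , (λ eq → subst (λ t → total t Mod8.≈ + 4) (sym eq) (0ℤ Mod8.byQuotient refl)) ]′ (χ-unit-cases 2≉0)
        where
        total : ℤ → ℤ
        total t = (1ℤ + 0ℤ) * (1ℤ + 1ℤ) * (1ℤ + t) + 0ℤ + (1ℤ + t) * (1ℤ + 1ℤ) * (1ℤ + 0ℤ) + (1ℤ + 1ℤ) * (1ℤ + 0ℤ) * (1ℤ + 1ℤ)
      Even : ℤ → Set
      Even z = Σ ℤ λ e → z ≡ + 2 * e
      1+χ-even : ∀ j → 0 ℕ.< j → j ℕ.< p → Even (1ℤ + χ j)
      1+χ-even j 0<j j<p = [ (λ eq → 1ℤ , cong (λ t → 1ℤ + t) eq) , (λ eq → 0ℤ , cong (λ t → 1ℤ + t) eq) ]′ (χ-unit-cases (small-unit 0<j j<p))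
      even-product : ∀ {x y z} → Even x → Even y → Even z → x * y * z Mod8.≈ 0ℤ
      even-product (e , refl) (f , refl) (g , refl) = (e * f * g) Mod8.byQuotient eq e f g
        where
        eq : ∀ e f g → + 2 * e * (+ 2 * f) * (+ 2 * g) ≡ 0ℤ + e * f * g * + 8
        eq = solve-∀
      middle : ∀ j → j ℕ.< m → Π (suc j) Mod8.≈ 0ℤ
      middle j j<m = even-product (factor 0 z≤n) (factor 1 (s≤s z≤n)) (factor 2 (s≤s (s≤s z≤n)))
        where
        factor : ∀ i → i ℕ.≤ 2 → Even (1ℤ + χ (suc j ℕ.+ i))
        factor i i≤2 = 1+χ-even (suc j ℕ.+ i) (s≤s z≤n) (subst (suc j ℕ.+ i ℕ.<_) (trans (ℕ.+-comm (suc m) 2) (sym p≡3+m)) (ℕ.+-mono-<-≤ (s≤s j<m) i≤2))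

    ρ : ℤ
    ρ = + r

    p≡1+4ρ : + p ≡ 1ℤ + + 4 * ρ
    p≡1+4ρ = trans (cong +_ p≡1+4r) (trans (ℤ.pos-+ 1 (n ℕ.+ n)) (cong (λ t → 1ℤ + t) (trans (ℤ.pos-+ n n) (trans (cong₂ _+_ (ℤ.pos-+ r r) (ℤ.pos-+ r r)) (four ρ)))))
      where
      four : ∀ r → r + r + (r + r) ≡ + 4 * r
      four = solve-∀

    -- Halves p - 3 + 2a ≡ 4 (mod 8) after inserting p = 1 + 4r. Thus a is known modulo 4 once the
    -- parity of r is.
    a≡3-2r+4q : Σ ℤ λ q → a ≡ + 3 - + 2 * ρ + + 4 * q
    a≡3-2r+4q = let q Mod8.byQuotient eq = Mod8.≈-trans (Mod8.reflexive (sym ∑Π)) ∑Π≈4 in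
      q , ℤ.*-cancelˡ-≡ (+ 2) a (+ 3 - + 2 * ρ + + 4 * q) (
      trans (isolate (+ p) a) (trans (cong₂ (λ s t → s - t + + 3) eq p≡1+4ρ) (collect q ρ)))
      where
      isolate : ∀ p a → + 2 * a ≡ p - + 3 + (a + a) - p + + 3
      isolate = solve-∀
      collect : ∀ q r → + 4 + q * + 8 - (1ℤ + + 4 * r) + + 3 ≡ + 2 * (+ 3 - + 2 * r + + 4 * q)
      collect = solve-∀

    -- Both p and a are odd, so b² = p - a² is even. This brings p = a² + b² to the form a² + 4c².
    b-even : Σ ℤ λ c → b ≡ + 2 * c
    b-even = halve ([ (λ d → d) , (λ d → d) ]′ (euclidsLemma ∣ b ∣ ∣ b ∣ prime[2] (subst (2 ℕ.∣_) (ℤ.abs-* b b) (Congruence.≈0⇒∣ 2 b²≈0))))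
      where
      q : ℤ
      q = proj₁ a≡3-2r+4q
      b²≈0 : Congruence._≈_ 2 (b * b) 0ℤ
      b²≈0 = (+ 2 * (ρ - (1ℤ - ρ + + 2 * q) - (1ℤ - ρ + + 2 * q) * (1ℤ - ρ + + 2 * q))) Congruence.byQuotient
        trans (isolate (a * a) (b * b)) (trans (cong₂ (λ s t → s - t * t) (trans (sym p≡a²+b²) p≡1+4ρ) (proj₂ a≡3-2r+4q)) (collect ρ q))
        where
        isolate : ∀ s t → t ≡ s + t - s
        isolate = solve-∀
        collect : ∀ r q → 1ℤ + + 4 * r - (+ 3 - + 2 * r + + 4 * q) * (+ 3 - + 2 * r + + 4 * q)
                          ≡ 0ℤ + + 2 * (r - (1ℤ - r + + 2 * q) - (1ℤ - r + + 2 * q) * (1ℤ - r + + 2 * q)) * + 2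
        collect = solve-∀
      halve : 2 ℕ.∣ ∣ b ∣ → Σ ℤ λ c → b ≡ + 2 * c
      halve 2∣b = let c Congruence.byQuotient e = Congruence.∣⇒≈0 2 2∣b in c , trans e (trans (ℤ.+-identityˡ _) (ℤ.*-comm c (+ 2)))

    a+a≈ : a + a ≈ - (+ (n C r) * -1ℤ ^ r)
    a+a≈ = ≈-trans (S+S≈ (ℕ.pred p)) (-‿cong (*-congˡ (+ (n C r)) (^-cong r (sum≡p⇒≈- {1} 1+[p-1]≡p))))

    -- Uniqueness gives x = ± a, and x ≡ 1 (mod 4) selects the sign: a ≡ 3 for even r, so x = -a,
    -- and a ≡ 1 for odd r, so x = a. Either way 2x = -(-1)^r 2a, which is C(2r,r) modulo p by
    -- `a+a≈`.
    gauss : ∀ x y → + p ≡ x * x + + 4 * (y * y) → (+ 4) ∣ℤ (x - 1ℤ) → + (n C r) ≈ + 2 * x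
    gauss x y p≡x²+4y² 4∣x-1 = [ even-case , odd-case ]′ (parity r)
      where
      x-1≈0 : x - 1ℤ Mod4.≈ 0ℤ
      x-1≈0 = Mod4.∣⇒≈0 4∣x-1
      q c w : ℤ
      q = proj₁ a≡3-2r+4q
      c = proj₁ b-even
      w = Mod4._≈_.quotient x-1≈0
      a≡ : a ≡ + 3 - + 2 * ρ + + 4 * q
      a≡ = proj₂ a≡3-2r+4q
      b≡2c : b ≡ + 2 * c
      b≡2c = proj₂ b-even
      x-1≡ : x - 1ℤ ≡ 0ℤ + w * + 4
      x-1≡ = Mod4._≈_.equality x-1≈0
      x≡1+4w : x ≡ 1ℤ + + 4 * w
      x≡1+4w = trans (isolate x) (trans (cong (λ t → 1ℤ + t) x-1≡) (collect w))
        where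
        isolate : ∀ x → x ≡ 1ℤ + (x - 1ℤ)
        isolate = solve-∀
        collect : ∀ w → 1ℤ + (0ℤ + w * + 4) ≡ 1ℤ + + 4 * w
        collect = solve-∀
      x≡±a : x ≡ a ⊎ x ≡ - a
      x≡±a = square≡square⇒≡± x a (SumOfTwoSquares.unique p prime a c x y (trans p≡a²+b² (cong (λ t → a * a + t) (trans (cong (λ t → t * t) b≡2c) (four c)))) p≡x²+4y²)
        where
        four : ∀ c → + 2 * c * (+ 2 * c) ≡ + 4 * (c * c)
        four = solve-∀
      even-case : (Σ ℕ λ t → r ≡ t ℕ.+ t) → + (n C r) ≈ + 2 * x
      even-case (t , r≡2t) = [ (λ x≡a → contradiction (sym (trans (sym x≡1+4w) (trans x≡a a≡3+4z))) (3+4z≢1+4w (q - + t) w)) , (λ x≡-a → begin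
          + (n C r)                              ≡⟨ unsign (+ (n C r)) ⟩
          - - (+ (n C r) * 1ℤ)                   ≡⟨ cong (λ s → - - (+ (n C r) * s)) (trans (cong (-1ℤ ^_) r≡2t) (-1^even t)) ⟨
          - - (+ (n C r) * -1ℤ ^ r)              ≈⟨ -‿cong a+a≈ ⟨
          - (a + a)                              ≡⟨ double a ⟩
          + 2 * - a                              ≡⟨ cong (+ 2 *_) x≡-a ⟨
          + 2 * x                                ∎) ]′ x≡±a
        where
        unsign : ∀ c → c ≡ - - (c * 1ℤ)
        unsign = solve-∀
        double : ∀ a → - (a + a) ≡ + 2 * - a
        double = solve-∀
        a≡3+4z : a ≡ + 3 + + 4 * (q - + t)
        a≡3+4z = trans a≡ (trans (cong (λ s → + 3 - + 2 * s + + 4 * q) (trans (cong +_ r≡2t) (ℤ.pos-+ t t))) (collect q (+ t)))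
          where
          collect : ∀ q t → + 3 - + 2 * (t + t) + + 4 * q ≡ + 3 + + 4 * (q - t)
          collect = solve-∀
      odd-case : (Σ ℕ λ t → r ≡ suc (t ℕ.+ t)) → + (n C r) ≈ + 2 * x
      odd-case (t , r≡1+2t) = [ (λ x≡a → begin
          + (n C r)                              ≡⟨ unsign (+ (n C r)) ⟩
          - (+ (n C r) * (-1ℤ * 1ℤ))             ≡⟨ cong (λ s → - (+ (n C r) * s)) (trans (cong (-1ℤ ^_) r≡1+2t) (cong (-1ℤ *_) (-1^even t))) ⟨
          - (+ (n C r) * -1ℤ ^ r)                ≈⟨ a+a≈ ⟨
          a + a                                  ≡⟨ double a ⟩
          + 2 * a                                ≡⟨ cong (+ 2 *_) x≡a ⟨
          + 2 * x                                ∎) , (λ x≡-a → contradiction (sym (trans (sym x≡1+4w) (trans x≡-a -a≡3+4z))) (3+4z≢1+4w (+ t - q - 1ℤ) w)) ]′ x≡±a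
        where
        unsign : ∀ c → c ≡ - (c * (-1ℤ * 1ℤ))
        unsign = solve-∀
        double : ∀ a → a + a ≡ + 2 * a
        double = solve-∀
        -a≡3+4z : - a ≡ + 3 + + 4 * (+ t - q - 1ℤ)
        -a≡3+4z = trans (cong -_ (trans a≡ (cong (λ s → + 3 - + 2 * s + + 4 * q) (trans (cong +_ r≡1+2t) (trans (ℤ.pos-+ 1 (t ℕ.+ t)) (cong (λ s → 1ℤ + s) (ℤ.pos-+ t t))))))) (collect q (+ t))
          where
          collect : ∀ q t → - (+ 3 - + 2 * (1ℤ + (t + t)) + + 4 * q) ≡ + 3 + + 4 * (t - q - 1ℤ)
          collect = solve-∀

open import Defs
open import Data.Rational as ℚ using (ℚ; mkℚ; _+_; _*_; _-_; -_; 0ℚ; 1ℚ; ½; toℚᵘ; fromℚᵘ)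
import Data.Rational.Properties as ℚ
open import Data.Rational.Unnormalised as ℚᵘ using (mkℚᵘ; *≡*)
import Data.Rational.Unnormalised.Properties as ℚᵘ
open import Tactic.RingSolver using (solve-∀)
open import Tactic.RingSolver.Core.AlmostCommutativeRing using (AlmostCommutativeRing; fromCommutativeRing)

-- Rational arithmetic, generalised binomial coefficients, and the sums F and T.

module BinomialSums where
  open import Algebra.Properties.AbelianGroup ℚ.+-0-abelianGroup using (∙-cancelˡ)
  open ≡-Reasoning

  ring : AlmostCommutativeRing 0ℓ 0ℓ
  ring = fromCommutativeRing ℚ.+-*-commutativeRing (λ x → dec⇒maybe (0ℚ ℚ.≟ x))

  ℤ→ℚ-+ : ∀ a b → ℤ→ℚ (a ℤ.+ b) ≡ ℤ→ℚ a + ℤ→ℚ b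
  ℤ→ℚ-+ a b = begin
    fromℚᵘ (mkℚᵘ (a ℤ.+ b) 0)                    ≡⟨ ℚ.fromℚᵘ-cong {mkℚᵘ (a ℤ.+ b) 0} {mkℚᵘ a 0 ℚᵘ.+ mkℚᵘ b 0} (*≡* (eq a b)) ⟩
    fromℚᵘ (mkℚᵘ a 0 ℚᵘ.+ mkℚᵘ b 0)              ≡⟨ ℚ.fromℚᵘ-cong (ℚᵘ.+-cong (ℚ.toℚᵘ-fromℚᵘ (mkℚᵘ a 0)) (ℚ.toℚᵘ-fromℚᵘ (mkℚᵘ b 0))) ⟨
    fromℚᵘ (toℚᵘ (ℤ→ℚ a) ℚᵘ.+ toℚᵘ (ℤ→ℚ b))      ≡⟨ ℚ.fromℚᵘ-cong (ℚ.toℚᵘ-homo-+ (ℤ→ℚ a) (ℤ→ℚ b)) ⟨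
    fromℚᵘ (toℚᵘ (ℤ→ℚ a + ℤ→ℚ b))                ≡⟨ ℚ.fromℚᵘ-toℚᵘ (ℤ→ℚ a + ℤ→ℚ b) ⟩
    ℤ→ℚ a + ℤ→ℚ b                                ∎
    where
    eq : ∀ a b → (a ℤ.+ b) ℤ.* + 1 ≡ (a ℤ.* + 1 ℤ.+ b ℤ.* + 1) ℤ.* + 1
    eq = ℤSolver.solve-∀

  ℤ→ℚ-* : ∀ a b → ℤ→ℚ (a ℤ.* b) ≡ ℤ→ℚ a * ℤ→ℚ b
  ℤ→ℚ-* a b = begin
    fromℚᵘ (mkℚᵘ (a ℤ.* b) 0)                    ≡⟨ ℚ.fromℚᵘ-cong (ℚᵘ.*-cong {mkℚᵘ a 0} {toℚᵘ (ℤ→ℚ a)} {mkℚᵘ b 0} {toℚᵘ (ℤ→ℚ b)}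
                                                      (ℚᵘ.≃-sym (ℚ.toℚᵘ-fromℚᵘ (mkℚᵘ a 0))) (ℚᵘ.≃-sym (ℚ.toℚᵘ-fromℚᵘ (mkℚᵘ b 0)))) ⟩
    fromℚᵘ (toℚᵘ (ℤ→ℚ a) ℚᵘ.* toℚᵘ (ℤ→ℚ b))      ≡⟨ ℚ.fromℚᵘ-cong (ℚ.toℚᵘ-homo-* (ℤ→ℚ a) (ℤ→ℚ b)) ⟨
    fromℚᵘ (toℚᵘ (ℤ→ℚ a * ℤ→ℚ b))                ≡⟨ ℚ.fromℚᵘ-toℚᵘ (ℤ→ℚ a * ℤ→ℚ b) ⟩
    ℤ→ℚ a * ℤ→ℚ b                                ∎

  ℤ→ℚ-injective : ∀ {a b} → ℤ→ℚ a ≡ ℤ→ℚ b → a ≡ b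
  ℤ→ℚ-injective {a} {b} eq with ℚ.fromℚᵘ-injective {mkℚᵘ a 0} {mkℚᵘ b 0} eq
  ... | *≡* a*1≡b*1 = trans (sym (ℤ.*-identityʳ a)) (trans a*1≡b*1 (ℤ.*-identityʳ b))

  ℤ→ℚ-neg : ∀ a → ℤ→ℚ (ℤ.- a) ≡ - ℤ→ℚ a
  ℤ→ℚ-neg a = ∙-cancelˡ (ℤ→ℚ a) (ℤ→ℚ (ℤ.- a)) (- ℤ→ℚ a) (begin
    ℤ→ℚ a + ℤ→ℚ (ℤ.- a)     ≡⟨ ℤ→ℚ-+ a (ℤ.- a) ⟨
    ℤ→ℚ (a ℤ.+ ℤ.- a)       ≡⟨ cong ℤ→ℚ (ℤ.+-inverseʳ a) ⟩
    0ℚ                      ≡⟨ ℚ.+-inverseʳ (ℤ→ℚ a) ⟨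
    ℤ→ℚ a + - ℤ→ℚ a         ∎)

  ℕ→ℚ-+ : ∀ m n → ℕ→ℚ (m ℕ.+ n) ≡ ℕ→ℚ m + ℕ→ℚ n
  ℕ→ℚ-+ m n = trans (cong ℤ→ℚ (ℤ.pos-+ m n)) (ℤ→ℚ-+ (+ m) (+ n))

  ℕ→ℚ-* : ∀ m n → ℕ→ℚ (m ℕ.* n) ≡ ℕ→ℚ m * ℕ→ℚ n
  ℕ→ℚ-* m n = trans (cong ℤ→ℚ (ℤ.pos-* m n)) (ℤ→ℚ-* (+ m) (+ n))

  ℕ→ℚ-suc : ∀ n → ℕ→ℚ (suc n) ≡ ℕ→ℚ n + 1ℚ
  ℕ→ℚ-suc n = trans (ℕ→ℚ-+ 1 n) (ℚ.+-comm 1ℚ (ℕ→ℚ n))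

  ℕ→ℚ-^ : ∀ m n → ℕ→ℚ (m ℕ.^ n) ≡ ℕ→ℚ m ^ n
  ℕ→ℚ-^ m zero    = refl
  ℕ→ℚ-^ m (suc n) = trans (ℕ→ℚ-* m (m ℕ.^ n)) (cong (ℕ→ℚ m *_) (ℕ→ℚ-^ m n))

  ℕ→ℚ-injective : ∀ {m n} → ℕ→ℚ m ≡ ℕ→ℚ n → m ≡ n
  ℕ→ℚ-injective eq = ℤ.+-injective (ℤ→ℚ-injective eq)

  ℕ→ℚ-suc≢0 : ∀ {n} → ℕ→ℚ (suc n) ≢ 0ℚ
  ℕ→ℚ-suc≢0 {n} eq = contradiction (ℕ→ℚ-injective {suc n} {0} eq) λ ()

  *-recipʳ : ∀ {q} → q ≢ 0ℚ → q * recip q ≡ 1ℚ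
  *-recipʳ {q@(mkℚ (+ zero) _ _)}    q≢0 = contradiction (ℚ.↥p≡0⇒p≡0 q refl) q≢0
  *-recipʳ {q@(mkℚ (+ suc _) _ _)}   q≢0 = ℚ.*-inverseʳ q
  *-recipʳ {q@(mkℚ -[1+ _ ] _ _)}    q≢0 = ℚ.*-inverseʳ q

  *-recip-sucʳ : ∀ n → ℕ→ℚ (suc n) * recip (ℕ→ℚ (suc n)) ≡ 1ℚ
  *-recip-sucʳ n = *-recipʳ (ℕ→ℚ-suc≢0 {n})

  divide : ∀ {c a b} → c ≢ 0ℚ → c * a ≡ b → a ≡ b * recip c
  divide {c} {a} {b} c≢0 ca≡b = begin
    a                    ≡⟨ ℚ.*-identityʳ a ⟨
    a * 1ℚ               ≡⟨ cong (a *_) (*-recipʳ c≢0) ⟨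
    a * (c * recip c)    ≡⟨ eq a c (recip c) ⟩
    c * a * recip c      ≡⟨ cong (_* recip c) ca≡b ⟩
    b * recip c          ∎
    where
    eq : ∀ a c d → a * (c * d) ≡ c * a * d
    eq = solve-∀ ring

  *-cancelˡ-≢0 : ∀ {c a b} → c ≢ 0ℚ → c * a ≡ c * b → a ≡ b
  *-cancelˡ-≢0 c≢0 ca≡cb = trans (divide c≢0 ca≡cb) (sym (divide c≢0 refl))

  *-≢0 : ∀ {a b} → a ≢ 0ℚ → b ≢ 0ℚ → a * b ≢ 0ℚ
  *-≢0 {a} a≢0 b≢0 ab≡0 = b≢0 (*-cancelˡ-≢0 a≢0 (trans ab≡0 (sym (ℚ.*-zeroʳ a))))

  ^-≢0 : ∀ {a} n → a ≢ 0ℚ → a ^ n ≢ 0ℚ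
  ^-≢0 zero    a≢0 ()
  ^-≢0 (suc n) a≢0 = *-≢0 a≢0 (^-≢0 n a≢0)

  ^-distrib-* : ∀ a b n → (a * b) ^ n ≡ a ^ n * b ^ n
  ^-distrib-* a b zero    = refl
  ^-distrib-* a b (suc n) = trans (cong (a * b *_) (^-distrib-* a b n)) (eq a b (a ^ n) (b ^ n))
    where
    eq : ∀ a b s t → a * b * (s * t) ≡ a * s * (b * t)
    eq = solve-∀ ring

  ^-+ : ∀ a m n → a ^ (m ℕ.+ n) ≡ a ^ m * a ^ n
  ^-+ a zero    n = sym (ℚ.*-identityˡ (a ^ n))
  ^-+ a (suc m) n = trans (cong (a *_) (^-+ a m n)) (sym (ℚ.*-assoc a (a ^ m) (a ^ n)))

  sgn-suc : ∀ n → sgn (suc n) ≡ - sgn n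
  sgn-suc n = eq (sgn n)
    where
    eq : ∀ s → (- 1ℚ) * s ≡ - s
    eq = solve-∀ ring

  sgn² : ∀ n → sgn n * sgn n ≡ 1ℚ
  sgn² n = trans (sym (^-distrib-* (- 1ℚ) (- 1ℚ) n)) (1^ n)
    where
    1^ : ∀ n → 1ℚ ^ n ≡ 1ℚ
    1^ zero    = refl
    1^ (suc n) = trans (ℚ.*-identityˡ (1ℚ ^ n)) (1^ n)

  sgn-even : ∀ n → sgn (n ℕ.+ n) ≡ 1ℚ
  sgn-even n = trans (^-+ (- 1ℚ) n n) (sgn² n)

  Σ<-ext : ∀ n {f g : ℕ → ℚ} → (∀ k → f k ≡ g k) → Σ< n f ≡ Σ< n g
  Σ<-ext zero    eq = refl
  Σ<-ext (suc n) eq = cong₂ _+_ (Σ<-ext n eq) (eq n)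

  Σ<-neg : ∀ n (f : ℕ → ℚ) → Σ< n (λ k → - f k) ≡ - Σ< n f
  Σ<-neg zero    f = refl
  Σ<-neg (suc n) f = trans (cong (_+ - f n) (Σ<-neg n f)) (sym (ℚ.neg-distrib-+ (Σ< n f) (f n)))

  Σ<-*ˡ : ∀ n c (f : ℕ → ℚ) → Σ< n (λ k → c * f k) ≡ c * Σ< n f
  Σ<-*ˡ zero    c f = sym (ℚ.*-zeroʳ c)
  Σ<-*ˡ (suc n) c f = trans (cong (_+ c * f n) (Σ<-*ˡ n c f)) (sym (ℚ.*-distribˡ-+ c (Σ< n f) (f n)))

  Σ<-peel : ∀ n (f : ℕ → ℚ) → Σ< (suc n) f ≡ f 0 + Σ< n (λ k → f (suc k))
  Σ<-peel zero    f = ℚ.+-comm 0ℚ (f 0)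
  Σ<-peel (suc n) f = trans (cong (_+ f (suc n)) (Σ<-peel n f)) (ℚ.+-assoc (f 0) (Σ< n (λ k → f (suc k))) (f (suc n)))

  Σ<-split : ∀ m n (f : ℕ → ℚ) → Σ< (m ℕ.+ n) f ≡ Σ< m f + Σ< n (λ k → f (m ℕ.+ k))
  Σ<-split m zero    f = trans (cong (λ t → Σ< t f) (ℕ.+-identityʳ m)) (sym (ℚ.+-identityʳ (Σ< m f)))
  Σ<-split m (suc n) f = begin
    Σ< (m ℕ.+ suc n) f                                       ≡⟨ cong (λ t → Σ< t f) (ℕ.+-suc m n) ⟩
    Σ< (m ℕ.+ n) f + f (m ℕ.+ n)                             ≡⟨ cong (_+ f (m ℕ.+ n)) (Σ<-split m n f) ⟩
    Σ< m f + Σ< n (λ k → f (m ℕ.+ k)) + f (m ℕ.+ n)          ≡⟨ ℚ.+-assoc (Σ< m f) (Σ< n (λ k → f (m ℕ.+ k))) (f (m ℕ.+ n)) ⟩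
    Σ< m f + (Σ< n (λ k → f (m ℕ.+ k)) + f (m ℕ.+ n))        ∎

  Σ<-reverse : ∀ n (f : ℕ → ℚ) → Σ< n f ≡ Σ< n (λ k → f (n ℕ.∸ suc k))
  Σ<-reverse zero    f = refl
  Σ<-reverse (suc n) f = begin
    Σ< n f + f n                              ≡⟨ cong (_+ f n) (Σ<-reverse n f) ⟩
    Σ< n (λ k → f (n ℕ.∸ suc k)) + f n        ≡⟨ ℚ.+-comm (Σ< n (λ k → f (n ℕ.∸ suc k))) (f n) ⟩
    f n + Σ< n (λ k → f (n ℕ.∸ suc k))        ≡⟨ Σ<-peel n (λ k → f (n ℕ.∸ k)) ⟨
    Σ< (suc n) (λ k → f (n ℕ.∸ k))            ∎

  -- Generalised binomial coefficients β z k = z (z-1) ⋯ (z-k+1) / k!.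
  β : ℚ → ℕ → ℚ
  β z zero    = 1ℚ
  β z (suc k) = β z k * (z - ℕ→ℚ k) * recip (ℕ→ℚ (suc k))

  β-suc : ∀ z k → ℕ→ℚ (suc k) * β z (suc k) ≡ (z - ℕ→ℚ k) * β z k
  β-suc z k = begin
    ℕ→ℚ (suc k) * (β z k * (z - ℕ→ℚ k) * recip (ℕ→ℚ (suc k)))    ≡⟨ eq (ℕ→ℚ (suc k)) (recip (ℕ→ℚ (suc k))) (β z k) (z - ℕ→ℚ k) ⟩
    ℕ→ℚ (suc k) * recip (ℕ→ℚ (suc k)) * ((z - ℕ→ℚ k) * β z k)    ≡⟨ cong (_* ((z - ℕ→ℚ k) * β z k)) (*-recip-sucʳ k) ⟩
    1ℚ * ((z - ℕ→ℚ k) * β z k)                                    ≡⟨ ℚ.*-identityˡ ((z - ℕ→ℚ k) * β z k) ⟩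
    (z - ℕ→ℚ k) * β z k                                           ∎
    where
    eq : ∀ c d b x → c * (b * x * d) ≡ c * d * (x * b)
    eq = solve-∀ ring

  -- Both sides are z (z-1) ⋯ (z-k) / k!.
  β-pred : ∀ z k → (z - ℕ→ℚ k) * β z k ≡ z * β (z - 1ℚ) k
  β-pred z zero    = eq z
    where
    eq : ∀ z → (z - 0ℚ) * 1ℚ ≡ z * 1ℚ
    eq = solve-∀ ring
  β-pred z (suc k) = *-cancelˡ-≢0 (ℕ→ℚ-suc≢0 {k}) (begin
    c * ((z - c) * β z (suc k))                              ≡⟨ swap c (z - c) (β z (suc k)) ⟩
    (z - c) * (c * β z (suc k))                              ≡⟨ cong ((z - c) *_) (trans (β-suc z k) (β-pred z k)) ⟩
    (z - c) * (z * β (z - 1ℚ) k)                             ≡⟨ cong (λ t → (z - t) * (z * β (z - 1ℚ) k)) (ℕ→ℚ-suc k) ⟩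
    (z - (ℕ→ℚ k + 1ℚ)) * (z * β (z - 1ℚ) k)                  ≡⟨ shift z (ℕ→ℚ k) (β (z - 1ℚ) k) ⟩
    z * ((z - 1ℚ - ℕ→ℚ k) * β (z - 1ℚ) k)                    ≡⟨ cong (z *_) (β-suc (z - 1ℚ) k) ⟨
    z * (c * β (z - 1ℚ) (suc k))                             ≡⟨ swap z c (β (z - 1ℚ) (suc k)) ⟩
    c * (z * β (z - 1ℚ) (suc k))                             ∎)
    where
    c : ℚ
    c = ℕ→ℚ (suc k)
    swap : ∀ a b d → a * (b * d) ≡ b * (a * d)
    swap = solve-∀ ring
    shift : ∀ z k b → (z - (k + 1ℚ)) * (z * b) ≡ z * ((z - 1ℚ - k) * b)
    shift = solve-∀ ring

  β-absorb : ∀ z k → ℕ→ℚ (suc k) * β z (suc k) ≡ z * β (z - 1ℚ) k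
  β-absorb z k = trans (β-suc z k) (β-pred z k)

  -- Multiplied by k + 1, all three terms become multiples of β(z-1,k), and z = (z - 1 - k) + (k +
  -- 1).
  β-pascal : ∀ z k → β z (suc k) ≡ β (z - 1ℚ) (suc k) + β (z - 1ℚ) k
  β-pascal z k = *-cancelˡ-≢0 (ℕ→ℚ-suc≢0 {k}) (begin
    c * β z (suc k)                                          ≡⟨ β-absorb z k ⟩
    z * b                                                    ≡⟨ eq z (ℕ→ℚ k) b ⟩
    (z - 1ℚ - ℕ→ℚ k) * b + (ℕ→ℚ k + 1ℚ) * b                  ≡⟨ cong₂ (λ s t → s + t * b) (β-suc (z - 1ℚ) k) (ℕ→ℚ-suc k) ⟨
    c * β (z - 1ℚ) (suc k) + c * b                           ≡⟨ ℚ.*-distribˡ-+ c (β (z - 1ℚ) (suc k)) b ⟨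
    c * (β (z - 1ℚ) (suc k) + b)                             ∎)
    where
    c b : ℚ
    c = ℕ→ℚ (suc k)
    b = β (z - 1ℚ) k
    eq : ∀ z k b → z * b ≡ (z - 1ℚ - k) * b + (k + 1ℚ) * b
    eq = solve-∀ ring

  ℕ→ℚ-suc-1 : ∀ n → ℕ→ℚ (suc n) - 1ℚ ≡ ℕ→ℚ n
  ℕ→ℚ-suc-1 n = trans (cong (_- 1ℚ) (ℕ→ℚ-suc n)) (eq (ℕ→ℚ n))
    where
    eq : ∀ a → a + 1ℚ - 1ℚ ≡ a
    eq = solve-∀ ring

  β-nCk : ∀ n k → ℕ→ℚ (n C k) ≡ β (ℕ→ℚ n) k
  β-nCk n       zero    = refl
  β-nCk zero    (suc k) = trans (cong ℕ→ℚ (k>n⇒nCk≡0 {0} {suc k} (s≤s z≤n))) (sym (β0≡0 k))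
    where
    β0≡0 : ∀ k → β 0ℚ (suc k) ≡ 0ℚ
    β0≡0 k = *-cancelˡ-≢0 (ℕ→ℚ-suc≢0 {k}) (trans (β-absorb 0ℚ k) (trans (ℚ.*-zeroˡ (β (0ℚ - 1ℚ) k)) (sym (ℚ.*-zeroʳ (ℕ→ℚ (suc k))))))
  β-nCk (suc n) (suc k) = begin
    ℕ→ℚ (suc n C suc k)                          ≡⟨ cong ℕ→ℚ (nCk+nC[k+1]≡[n+1]C[k+1] n k) ⟨
    ℕ→ℚ ((n C k) ℕ.+ (n C suc k))                ≡⟨ ℕ→ℚ-+ (n C k) (n C suc k) ⟩
    ℕ→ℚ (n C k) + ℕ→ℚ (n C suc k)                ≡⟨ cong₂ _+_ (β-nCk n k) (β-nCk n (suc k)) ⟩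
    β (ℕ→ℚ n) k + β (ℕ→ℚ n) (suc k)              ≡⟨ ℚ.+-comm (β (ℕ→ℚ n) k) (β (ℕ→ℚ n) (suc k)) ⟩
    β (ℕ→ℚ n) (suc k) + β (ℕ→ℚ n) k              ≡⟨ cong (λ z → β z (suc k) + β z k) (ℕ→ℚ-suc-1 n) ⟨
    β (ℕ→ℚ (suc n) - 1ℚ) (suc k) + β (ℕ→ℚ (suc n) - 1ℚ) k   ≡⟨ β-pascal (ℕ→ℚ (suc n)) k ⟨
    β (ℕ→ℚ (suc n)) (suc k)                      ∎

  central : ℕ → ℚ
  central k = ℕ→ℚ ((2 ℕ.* k) C k)

  -- The upper index goes down twice: from 2k+2 by absorption, and from 2k+1 by `β-pred`, whose
  -- factor 2k + 1 - k accounts for the auxiliary k + 1.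
  central-suc : ∀ k → ℕ→ℚ (suc k) * central (suc k) ≡ ℕ→ℚ 2 * (ℕ→ℚ 2 * ℕ→ℚ k + 1ℚ) * central k
  central-suc k = *-cancelˡ-≢0 {ℕ→ℚ (suc k)} (ℕ→ℚ-suc≢0 {k}) (begin
    ℕ→ℚ (suc k) * (ℕ→ℚ (suc k) * central (suc k))
      ≡⟨ cong (λ t → ℕ→ℚ (suc k) * (ℕ→ℚ (suc k) * t)) (trans (β-nCk (2 ℕ.* suc k) (suc k)) (cong (λ z → β z (suc k)) (2*suc k))) ⟩
    ℕ→ℚ (suc k) * (ℕ→ℚ (suc k) * β (x + 1ℚ + 1ℚ) (suc k))
      ≡⟨ cong (ℕ→ℚ (suc k) *_) (trans (β-absorb (x + 1ℚ + 1ℚ) k) (cong (λ z → (x + 1ℚ + 1ℚ) * β z k) (minus (x + 1ℚ)))) ⟩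
    ℕ→ℚ (suc k) * ((x + 1ℚ + 1ℚ) * β (x + 1ℚ) k)
      ≡⟨ cong (_* ((x + 1ℚ + 1ℚ) * β (x + 1ℚ) k)) (ℕ→ℚ-suc k) ⟩
    (ℕ→ℚ k + 1ℚ) * ((x + 1ℚ + 1ℚ) * β (x + 1ℚ) k)
      ≡⟨ regroup (ℕ→ℚ k) (β (x + 1ℚ) k) ⟩
    ℕ→ℚ 2 * (ℕ→ℚ k + 1ℚ) * ((x + 1ℚ - ℕ→ℚ k) * β (x + 1ℚ) k)
      ≡⟨ cong (ℕ→ℚ 2 * (ℕ→ℚ k + 1ℚ) *_) (trans (β-pred (x + 1ℚ) k) (cong (λ z → (x + 1ℚ) * β z k) (minus x))) ⟩
    ℕ→ℚ 2 * (ℕ→ℚ k + 1ℚ) * ((x + 1ℚ) * β x k)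
      ≡⟨ cong₂ (λ s t → ℕ→ℚ 2 * s * ((x + 1ℚ) * t)) (ℕ→ℚ-suc k) (trans (β-nCk (2 ℕ.* k) k) (cong (λ z → β z k) (ℕ→ℚ-* 2 k))) ⟨
    ℕ→ℚ 2 * ℕ→ℚ (suc k) * ((x + 1ℚ) * central k)
      ≡⟨ swap (ℕ→ℚ 2) (ℕ→ℚ (suc k)) (x + 1ℚ) (central k) ⟩
    ℕ→ℚ (suc k) * (ℕ→ℚ 2 * (x + 1ℚ) * central k) ∎)
    where
    x : ℚ
    x = ℕ→ℚ 2 * ℕ→ℚ k
    minus : ∀ z → z + 1ℚ - 1ℚ ≡ z
    minus = solve-∀ ring
    distrib : ∀ k → ℕ→ℚ 2 * (k + 1ℚ) ≡ ℕ→ℚ 2 * k + 1ℚ + 1ℚ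
    distrib = solve-∀ ring
    2*suc : ∀ k → ℕ→ℚ (2 ℕ.* suc k) ≡ ℕ→ℚ 2 * ℕ→ℚ k + 1ℚ + 1ℚ
    2*suc k = trans (ℕ→ℚ-* 2 (suc k)) (trans (cong (ℕ→ℚ 2 *_) (ℕ→ℚ-suc k)) (distrib (ℕ→ℚ k)))
    regroup : ∀ k b → (k + 1ℚ) * ((ℕ→ℚ 2 * k + 1ℚ + 1ℚ) * b) ≡ ℕ→ℚ 2 * (k + 1ℚ) * ((ℕ→ℚ 2 * k + 1ℚ - k) * b)
    regroup = solve-∀ ring
    swap : ∀ a c d e → a * c * (d * e) ≡ c * (a * d * e)
    swap = solve-∀ ring

  -- Both sides obey the recurrence of `central-suc`, since (1 - 2k)(1 + 2k) is produced by the
  -- factor 1/2 - k of β together with the new factor 1 - 2(k+1).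
  central-β : ∀ k → central k ≡ β ½ k * ((- ℕ→ℚ 4) ^ k * (1ℚ - ℕ→ℚ 2 * ℕ→ℚ k))
  central-β zero    = refl
  central-β (suc k) = *-cancelˡ-≢0 {ℕ→ℚ (suc k)} (ℕ→ℚ-suc≢0 {k}) (begin
    ℕ→ℚ (suc k) * central (suc k)
      ≡⟨ trans (central-suc k) (cong (ℕ→ℚ 2 * (ℕ→ℚ 2 * ℕ→ℚ k + 1ℚ) *_) (central-β k)) ⟩
    ℕ→ℚ 2 * (ℕ→ℚ 2 * ℕ→ℚ k + 1ℚ) * (β ½ k * ((- ℕ→ℚ 4) ^ k * (1ℚ - ℕ→ℚ 2 * ℕ→ℚ k)))
      ≡⟨ eq (ℕ→ℚ k) (β ½ k) ((- ℕ→ℚ 4) ^ k) ⟩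
    (½ - ℕ→ℚ k) * β ½ k * ((- ℕ→ℚ 4) * (- ℕ→ℚ 4) ^ k * (1ℚ - ℕ→ℚ 2 * (ℕ→ℚ k + 1ℚ)))
      ≡⟨ cong₂ (λ s t → s * ((- ℕ→ℚ 4) ^ suc k * (1ℚ - ℕ→ℚ 2 * t))) (β-suc ½ k) (ℕ→ℚ-suc k) ⟨
    ℕ→ℚ (suc k) * β ½ (suc k) * ((- ℕ→ℚ 4) ^ suc k * (1ℚ - ℕ→ℚ 2 * ℕ→ℚ (suc k)))
      ≡⟨ ℚ.*-assoc (ℕ→ℚ (suc k)) (β ½ (suc k)) _ ⟩
    ℕ→ℚ (suc k) * (β ½ (suc k) * ((- ℕ→ℚ 4) ^ suc k * (1ℚ - ℕ→ℚ 2 * ℕ→ℚ (suc k)))) ∎)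
    where
    eq : ∀ k b s → ℕ→ℚ 2 * (ℕ→ℚ 2 * k + 1ℚ) * (b * (s * (1ℚ - ℕ→ℚ 2 * k)))
                   ≡ (½ - k) * b * ((- ℕ→ℚ 4) * s * (1ℚ - ℕ→ℚ 2 * (k + 1ℚ)))
    eq = solve-∀ ring

  twoKm1≡ : ∀ k → twoKm1 k ≡ ℕ→ℚ 2 * ℕ→ℚ k - 1ℚ
  twoKm1≡ k = cong (_- 1ℚ) (ℕ→ℚ-* 2 k)

  twoKm1≢0 : ∀ k → twoKm1 k ≢ 0ℚ
  twoKm1≢0 k eq = odd k (ℕ→ℚ-injective {2 ℕ.* k} {1} (trans (shift (ℕ→ℚ (2 ℕ.* k))) (cong (_+ 1ℚ) eq)))
    where
    shift : ∀ a → a ≡ a - 1ℚ + 1ℚ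
    shift = solve-∀ ring
    odd : ∀ k → 2 ℕ.* k ≢ 1
    odd (suc k) eq = contradiction (trans (sym (ℕ.+-suc k (k ℕ.+ 0))) (ℕ.suc-injective eq)) λ ()

  -16≢0 : - ℕ→ℚ 16 ≢ 0ℚ
  -16≢0 ()

  [-4]^k² : ∀ k → (- ℕ→ℚ 4) ^ k * (- ℕ→ℚ 4) ^ k ≡ sgn k * (- ℕ→ℚ 16) ^ k
  [-4]^k² k = trans (sym (^-distrib-* (- ℕ→ℚ 4) (- ℕ→ℚ 4) k)) (^-distrib-* (- 1ℚ) (- ℕ→ℚ 16) k)

  -- Squaring `central-β` yields (-4)^(2k) = (-1)^k (-16)^k and (1 - 2k)², which absorb the whole
  -- denominator up to the sign.
  term1-β : ∀ k → term1 k ≡ sgn k * (β ½ k * β ½ k)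
  term1-β k = sym (divide (*-≢0 (^-≢0 k -16≢0) (*-≢0 (twoKm1≢0 k) (*-≢0 (twoKm1≢0 k) (λ ())))) (begin
    (- ℕ→ℚ 16) ^ k * (twoKm1 k ^ 2) * (sgn k * (b * b))      ≡⟨ cong (λ t → (- ℕ→ℚ 16) ^ k * (t ^ 2) * (sgn k * (b * b))) (twoKm1≡ k) ⟩
    (- ℕ→ℚ 16) ^ k * ((x - 1ℚ) ^ 2) * (sgn k * (b * b))      ≡⟨ regroup ((- ℕ→ℚ 16) ^ k) x (sgn k) b ⟩
    sgn k * (- ℕ→ℚ 16) ^ k * ((1ℚ - x) * b * ((1ℚ - x) * b)) ≡⟨ cong (_* ((1ℚ - x) * b * ((1ℚ - x) * b))) ([-4]^k² k) ⟨
    s * s * ((1ℚ - x) * b * ((1ℚ - x) * b))                  ≡⟨ square s (1ℚ - x) b ⟩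
    (b * (s * (1ℚ - x))) ^ 2                                 ≡⟨ cong (_^ 2) (central-β k) ⟨
    central k ^ 2                                            ∎))
    where
    b s x : ℚ
    b = β ½ k
    s = (- ℕ→ℚ 4) ^ k
    x = ℕ→ℚ 2 * ℕ→ℚ k
    regroup : ∀ e x s b → e * ((x - 1ℚ) * ((x - 1ℚ) * 1ℚ)) * (s * (b * b)) ≡ s * e * ((1ℚ - x) * b * ((1ℚ - x) * b))
    regroup = solve-∀ ring
    square : ∀ s y b → s * s * (y * b * (y * b)) ≡ b * (s * y) * (b * (s * y) * 1ℚ)
    square = solve-∀ ring

  β-½≡ : ∀ k → β (½ - 1ℚ) k ≡ (1ℚ - ℕ→ℚ 2 * ℕ→ℚ k) * β ½ k
  β-½≡ k = begin
    β (½ - 1ℚ) k                          ≡⟨ double (β (½ - 1ℚ) k) ⟩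
    ℕ→ℚ 2 * (½ * β (½ - 1ℚ) k)            ≡⟨ cong (ℕ→ℚ 2 *_) (β-pred ½ k) ⟨
    ℕ→ℚ 2 * ((½ - ℕ→ℚ k) * β ½ k)         ≡⟨ eq (ℕ→ℚ k) (β ½ k) ⟩
    (1ℚ - ℕ→ℚ 2 * ℕ→ℚ k) * β ½ k          ∎
    where
    double : ∀ b → b ≡ ℕ→ℚ 2 * (½ * b)
    double = solve-∀ ring
    eq : ∀ k b → ℕ→ℚ 2 * ((½ - k) * b) ≡ (1ℚ - ℕ→ℚ 2 * k) * b
    eq = solve-∀ ring

  -- With only one factor 2k - 1 in the denominator, one factor 1 - 2k survives; it turns one
  -- β(1/2,k) into β(-1/2,k), and 2k - 1 = -(1 - 2k) gives the minus sign.
  term2-β : ∀ k → term2 k ≡ - (sgn k * (β ½ k * β (½ - 1ℚ) k))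
  term2-β k = sym (divide (*-≢0 (^-≢0 k -16≢0) (twoKm1≢0 k)) (begin
    (- ℕ→ℚ 16) ^ k * twoKm1 k * - (sgn k * (b * β (½ - 1ℚ) k))    ≡⟨ cong₂ (λ t u → (- ℕ→ℚ 16) ^ k * t * - (sgn k * (b * u))) (twoKm1≡ k) (β-½≡ k) ⟩
    (- ℕ→ℚ 16) ^ k * (x - 1ℚ) * - (sgn k * (b * ((1ℚ - x) * b)))  ≡⟨ regroup ((- ℕ→ℚ 16) ^ k) x (sgn k) b ⟩
    sgn k * (- ℕ→ℚ 16) ^ k * ((1ℚ - x) * b * ((1ℚ - x) * b))      ≡⟨ cong (_* ((1ℚ - x) * b * ((1ℚ - x) * b))) ([-4]^k² k) ⟨
    s * s * ((1ℚ - x) * b * ((1ℚ - x) * b))                       ≡⟨ square s (1ℚ - x) b ⟩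
    (b * (s * (1ℚ - x))) ^ 2                                      ≡⟨ cong (_^ 2) (central-β k) ⟨
    central k ^ 2                                                 ∎))
    where
    b s x : ℚ
    b = β ½ k
    s = (- ℕ→ℚ 4) ^ k
    x = ℕ→ℚ 2 * ℕ→ℚ k
    regroup : ∀ e x s b → e * (x - 1ℚ) * - (s * (b * ((1ℚ - x) * b))) ≡ s * e * ((1ℚ - x) * b * ((1ℚ - x) * b))
    regroup = solve-∀ ring
    square : ∀ s y b → s * s * (y * b * (y * b)) ≡ b * (s * y) * (b * (s * y) * 1ℚ)
    square = solve-∀ ring

  F T : ℕ → ℚ → ℚ
  F n a = Σ< n (λ k → sgn k * (β a k * β a k))
  T n a = Σ< n (λ k → sgn k * (β a k * β (a - 1ℚ) k))

  -- The certificate of Zeilberger's algorithm for the sum F, found by comparing coefficients of k.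
  certificate : ℚ → ℚ → ℚ
  certificate a k = ℕ→ℚ 6 * a * k - ℕ→ℚ 2 * k * k - ℕ→ℚ 2 * k - ℕ→ℚ 5 * a * a + ℕ→ℚ 3 * a

  -- The k-th summand of the left side is the difference of the right sides for n = k and n = k - 1,
  -- so only the last boundary term survives.
  F-recurrence : ∀ n a → a * (a - 1ℚ) * F (suc n) a + ℕ→ℚ 4 * (a - 1ℚ) * (a - 1ℚ) * F (suc n) (a - 1ℚ - 1ℚ)
                         ≡ sgn (suc n) * (β (a - 1ℚ) n * β (a - 1ℚ) n * certificate a (ℕ→ℚ (suc n)))
  F-recurrence zero a = eq a
    where
    eq : ∀ a → a * (a - 1ℚ) * (0ℚ + 1ℚ * (1ℚ * 1ℚ)) + ℕ→ℚ 4 * (a - 1ℚ) * (a - 1ℚ) * (0ℚ + 1ℚ * (1ℚ * 1ℚ))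
               ≡ (- 1ℚ) * 1ℚ * (1ℚ * 1ℚ * (ℕ→ℚ 6 * a * ℕ→ℚ 1 - ℕ→ℚ 2 * ℕ→ℚ 1 * ℕ→ℚ 1 - ℕ→ℚ 2 * ℕ→ℚ 1 - ℕ→ℚ 5 * a * a + ℕ→ℚ 3 * a))
    eq = solve-∀ ring
  F-recurrence (suc n) a = begin
    a * (a - 1ℚ) * (F (suc n) a + s * (β a N * β a N)) + ℕ→ℚ 4 * (a - 1ℚ) * (a - 1ℚ) * (F (suc n) (a - 1ℚ - 1ℚ) + s * (β (a - 1ℚ - 1ℚ) N * β (a - 1ℚ - 1ℚ) N))
      ≡⟨ regroup a s (F (suc n) a) (F (suc n) (a - 1ℚ - 1ℚ)) (β a N) (β (a - 1ℚ - 1ℚ) N) ⟩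
    a * (a - 1ℚ) * F (suc n) a + ℕ→ℚ 4 * (a - 1ℚ) * (a - 1ℚ) * F (suc n) (a - 1ℚ - 1ℚ)
      + s * (a * (a - 1ℚ) * (β a N * β a N) + ℕ→ℚ 4 * ((a - 1ℚ) * β (a - 1ℚ - 1ℚ) N * ((a - 1ℚ) * β (a - 1ℚ - 1ℚ) N)))
      ≡⟨ cong₂ (λ u v → u + s * v) (F-recurrence n a)
           (cong₂ (λ u v → a * (a - 1ℚ) * (u * u) + ℕ→ℚ 4 * (v * v)) βaN (trans (sym (β-pred (a - 1ℚ) N)) (cong ((a - 1ℚ - c) *_) βa-1N))) ⟩
    s * (β (a - 1ℚ) n * β (a - 1ℚ) n * certificate a c) + s * (a * (a - 1ℚ) * (a * w * (a * w)) + ℕ→ℚ 4 * ((a - 1ℚ - c) * (w * (a - c)) * ((a - 1ℚ - c) * (w * (a - c)))))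
      ≡⟨ cong (λ u → s * (u * u * certificate a c) + s * (a * (a - 1ℚ) * (a * w * (a * w)) + ℕ→ℚ 4 * ((a - 1ℚ - c) * (w * (a - c)) * ((a - 1ℚ - c) * (w * (a - c)))))) (sym cw) ⟩
    s * (c * w * (c * w) * certificate a c) + s * (a * (a - 1ℚ) * (a * w * (a * w)) + ℕ→ℚ 4 * ((a - 1ℚ - c) * (w * (a - c)) * ((a - 1ℚ - c) * (w * (a - c)))))
      ≡⟨ identity s a w c ⟩
    (- 1ℚ) * s * (w * (a - c) * (w * (a - c)) * certificate a (c + 1ℚ))
      ≡⟨ cong₂ (λ u v → (- 1ℚ) * s * (u * u * certificate a v)) βa-1N (ℕ→ℚ-suc N) ⟨
    (- 1ℚ) * s * (β (a - 1ℚ) N * β (a - 1ℚ) N * certificate a (ℕ→ℚ (suc N))) ∎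
    where
    N : ℕ
    N = suc n
    s c w : ℚ
    s = sgn N
    c = ℕ→ℚ N
    -- A common factor of all coefficients in this step: β(a-1,n) = c w, β(a,N) = a w and β(a-1,N) =
    -- (a - c) w. The step then is a polynomial identity in s, a, w and c.
    w = recip c * β (a - 1ℚ) n
    cw : c * w ≡ β (a - 1ℚ) n
    cw = trans (sym (ℚ.*-assoc c (recip c) (β (a - 1ℚ) n))) (trans (cong (_* β (a - 1ℚ) n) (*-recip-sucʳ n)) (ℚ.*-identityˡ (β (a - 1ℚ) n)))
    swap : ∀ a b d → a * (b * d) ≡ b * (a * d)
    swap = solve-∀ ring
    βaN : β a N ≡ a * w
    βaN = *-cancelˡ-≢0 (ℕ→ℚ-suc≢0 {n}) (trans (β-absorb a n) (trans (cong (a *_) (sym cw)) (swap a c w)))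
    shift : ∀ a n → a - 1ℚ - n ≡ a - (n + 1ℚ)
    shift = solve-∀ ring
    βa-1N : β (a - 1ℚ) N ≡ w * (a - c)
    βa-1N = *-cancelˡ-≢0 (ℕ→ℚ-suc≢0 {n}) (trans (β-suc (a - 1ℚ) n)
      (trans (cong₂ _*_ (trans (shift a (ℕ→ℚ n)) (cong (λ t → a - t) (sym (ℕ→ℚ-suc n)))) (sym cw)) (rotate (a - c) c w)))
      where
      rotate : ∀ x c w → x * (c * w) ≡ c * (w * x)
      rotate = solve-∀ ring
    regroup : ∀ a s u v x y → a * (a - 1ℚ) * (u + s * (x * x)) + ℕ→ℚ 4 * (a - 1ℚ) * (a - 1ℚ) * (v + s * (y * y))
              ≡ a * (a - 1ℚ) * u + ℕ→ℚ 4 * (a - 1ℚ) * (a - 1ℚ) * v + s * (a * (a - 1ℚ) * (x * x) + ℕ→ℚ 4 * ((a - 1ℚ) * y * ((a - 1ℚ) * y)))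
    regroup = solve-∀ ring
    identity : ∀ s a w c →
      s * (c * w * (c * w) * (ℕ→ℚ 6 * a * c - ℕ→ℚ 2 * c * c - ℕ→ℚ 2 * c - ℕ→ℚ 5 * a * a + ℕ→ℚ 3 * a))
        + s * (a * (a - 1ℚ) * (a * w * (a * w)) + ℕ→ℚ 4 * ((a - 1ℚ - c) * (w * (a - c)) * ((a - 1ℚ - c) * (w * (a - c)))))
      ≡ (- 1ℚ) * s * (w * (a - c) * (w * (a - c)) * (ℕ→ℚ 6 * a * (c + 1ℚ) - ℕ→ℚ 2 * (c + 1ℚ) * (c + 1ℚ) - ℕ→ℚ 2 * (c + 1ℚ) - ℕ→ℚ 5 * a * a + ℕ→ℚ 3 * a))
    identity = solve-∀ ring

  -- Both sums are expanded with β a k = β (a-1) k + β (a-1) (k-1); the squares telescope.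
  T-F : ∀ n a → ℕ→ℚ 2 * T (suc n) a + sgn n * (β (a - 1ℚ) n * β (a - 1ℚ) n) ≡ ℕ→ℚ 2 * F (suc n) (a - 1ℚ) + F (suc n) a
  T-F zero    a = refl
  T-F (suc n) a = begin
    ℕ→ℚ 2 * (T (suc n) a + (- 1ℚ) * s * (β a (suc n) * x)) + (- 1ℚ) * s * (x * x)
      ≡⟨ cong (λ t → ℕ→ℚ 2 * (T (suc n) a + (- 1ℚ) * s * (t * x)) + (- 1ℚ) * s * (x * x)) (β-pascal a n) ⟩
    ℕ→ℚ 2 * (T (suc n) a + (- 1ℚ) * s * ((x + y) * x)) + (- 1ℚ) * s * (x * x)
      ≡⟨ regroup (T (suc n) a) s x y ⟩
    ℕ→ℚ 2 * T (suc n) a + s * (y * y) + (ℕ→ℚ 2 * ((- 1ℚ) * s * (x * x)) + (- 1ℚ) * s * ((x + y) * (x + y)))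
      ≡⟨ cong₂ (λ u v → u + (ℕ→ℚ 2 * ((- 1ℚ) * s * (x * x)) + (- 1ℚ) * s * (v * v))) (T-F n a) (sym (β-pascal a n)) ⟩
    ℕ→ℚ 2 * F (suc n) (a - 1ℚ) + F (suc n) a + (ℕ→ℚ 2 * ((- 1ℚ) * s * (x * x)) + (- 1ℚ) * s * (z * z))
      ≡⟨ collect (F (suc n) (a - 1ℚ)) (F (suc n) a) ((- 1ℚ) * s * (x * x)) ((- 1ℚ) * s * (z * z)) ⟩
    ℕ→ℚ 2 * (F (suc n) (a - 1ℚ) + (- 1ℚ) * s * (x * x)) + (F (suc n) a + (- 1ℚ) * s * (z * z)) ∎
    where
    s x y z : ℚ
    s = sgn n
    x = β (a - 1ℚ) (suc n)
    y = β (a - 1ℚ) n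
    z = β a (suc n)
    regroup : ∀ t s x y → ℕ→ℚ 2 * (t + (- 1ℚ) * s * ((x + y) * x)) + (- 1ℚ) * s * (x * x)
              ≡ ℕ→ℚ 2 * t + s * (y * y) + (ℕ→ℚ 2 * ((- 1ℚ) * s * (x * x)) + (- 1ℚ) * s * ((x + y) * (x + y)))
    regroup = solve-∀ ring
    collect : ∀ f g u v → ℕ→ℚ 2 * f + g + (ℕ→ℚ 2 * u + v) ≡ ℕ→ℚ 2 * (f + u) + (g + v)
    collect = solve-∀ ring

  β-vanish : ∀ n j → β (ℕ→ℚ n) (suc n ℕ.+ j) ≡ 0ℚ
  β-vanish n zero    = trans (cong (β (ℕ→ℚ n)) (ℕ.+-identityʳ (suc n))) (trans (cong (λ t → β (ℕ→ℚ n) n * t * recip (ℕ→ℚ (suc n))) (ℚ.+-inverseʳ (ℕ→ℚ n))) (eq (β (ℕ→ℚ n) n) (recip (ℕ→ℚ (suc n)))))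
    where
    eq : ∀ a b → a * 0ℚ * b ≡ 0ℚ
    eq = solve-∀ ring
  β-vanish n (suc j) = trans (cong (β (ℕ→ℚ n)) (ℕ.+-suc (suc n) j)) (trans (cong (λ t → t * (ℕ→ℚ n - ℕ→ℚ (suc n ℕ.+ j)) * recip (ℕ→ℚ (suc (suc n ℕ.+ j)))) (β-vanish n j))
    (eq (ℕ→ℚ n - ℕ→ℚ (suc n ℕ.+ j)) (recip (ℕ→ℚ (suc (suc n ℕ.+ j))))))
    where
    eq : ∀ a b → 0ℚ * a * b ≡ 0ℚ
    eq = solve-∀ ring

  -- The range is allowed to exceed n + 1 because Pascal's rule shifts it.
  Σβ≡2^ : ∀ n j → Σ< (suc n ℕ.+ j) (β (ℕ→ℚ n)) ≡ ℕ→ℚ 2 ^ n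
  Σβ≡2^ zero zero    = refl
  Σβ≡2^ zero (suc j) = trans (cong₂ _+_ (Σβ≡2^ zero j) (β-vanish zero j)) refl
  Σβ≡2^ (suc n) j = begin
    Σ< (suc m) (β (ℕ→ℚ (suc n)))
      ≡⟨ Σ<-peel m (β (ℕ→ℚ (suc n))) ⟩
    1ℚ + Σ< m (λ k → β (ℕ→ℚ (suc n)) (suc k))
      ≡⟨ cong (λ t → 1ℚ + t) (trans (Σ<-ext m (λ k → trans (β-pascal (ℕ→ℚ (suc n)) k) (cong (λ z → β z (suc k) + β z k) (ℕ→ℚ-suc-1 n)))) (Σ<-+ m (λ k → β (ℕ→ℚ n) (suc k)) (β (ℕ→ℚ n)))) ⟩
    1ℚ + (Σ< m (λ k → β (ℕ→ℚ n) (suc k)) + Σ< m (β (ℕ→ℚ n)))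
      ≡⟨ ℚ.+-assoc 1ℚ (Σ< m (λ k → β (ℕ→ℚ n) (suc k))) (Σ< m (β (ℕ→ℚ n))) ⟨
    1ℚ + Σ< m (λ k → β (ℕ→ℚ n) (suc k)) + Σ< m (β (ℕ→ℚ n))
      ≡⟨ cong₂ _+_ (trans (sym (Σ<-peel m (β (ℕ→ℚ n)))) (trans (cong (λ t → Σ< t (β (ℕ→ℚ n))) (sym (ℕ.+-suc (suc n) j))) (Σβ≡2^ n (suc j)))) (Σβ≡2^ n j) ⟩
    ℕ→ℚ 2 ^ n + ℕ→ℚ 2 ^ n
      ≡⟨ double (ℕ→ℚ 2 ^ n) ⟩
    ℕ→ℚ 2 * ℕ→ℚ 2 ^ n ∎
    where
    m : ℕ
    m = suc n ℕ.+ j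
    Σ<-+ : ∀ m (f g : ℕ → ℚ) → Σ< m (λ k → f k + g k) ≡ Σ< m f + Σ< m g
    Σ<-+ zero    f g = refl
    Σ<-+ (suc m) f g = trans (cong (_+ (f m + g m)) (Σ<-+ m f g)) (interchange (Σ< m f) (Σ< m g) (f m) (g m))
      where
      interchange : ∀ a b c d → a + b + (c + d) ≡ a + c + (b + d)
      interchange = solve-∀ ring
    double : ∀ a → a + a ≡ ℕ→ℚ 2 * a
    double = solve-∀ ring

open IntegerSums using ([1+k]*[1+n]C[1+k]≡[1+n]*nCk)
open GaussBinomial using (module Congruence; module QuadraticCharacter; module GaussCongruence)
open BinomialSums

-- The ring of p-integral rationals and its congruences modulo p and p².

module Localisation (p : ℕ) (prime : Prime p) where

  -- Any denominator prime to p is allowed, not just the reduced one. Closure under sums and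
  -- products then needs no gcd; reduction is dealt with once, in `integral⇒pIntegral`.
  record Integral (q : ℚ) : Set where
    constructor fraction
    field
      den       : ℕ
      num       : ℤ
      p∤den     : ¬ (p ℕ.∣ den)
      q*den≡num : q * ℕ→ℚ den ≡ ℤ→ℚ num

  p∤1 : ¬ (p ℕ.∣ 1)
  p∤1 p∣1 = contradiction (ℕ.∣1⇒≡1 p∣1) (ℕ.nonTrivial⇒≢1 {{prime⇒nonTrivial prime}})

  p∤* : ∀ {a b} → ¬ (p ℕ.∣ a) → ¬ (p ℕ.∣ b) → ¬ (p ℕ.∣ (a ℕ.* b))
  p∤* {a} {b} p∤a p∤b p∣ab = [ p∤a , p∤b ]′ (euclidsLemma a b prime p∣ab)

  p∤small : ∀ {k} → suc k ℕ.< p → ¬ (p ℕ.∣ suc k)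
  p∤small k<p = ℕ.>⇒∤ k<p

  integral-ℤ : ∀ z → Integral (ℤ→ℚ z)
  integral-ℤ z = fraction 1 z p∤1 (ℚ.*-identityʳ (ℤ→ℚ z))

  integral-ℕ : ∀ k → Integral (ℕ→ℚ k)
  integral-ℕ k = integral-ℤ (+ k)

  integral-+ : ∀ {a b} → Integral a → Integral b → Integral (a + b)
  integral-+ {a} {b} (fraction d z p∤d ad≡z) (fraction e w p∤e be≡w) = fraction (d ℕ.* e) (z ℤ.* + e ℤ.+ w ℤ.* + d) (p∤* p∤d p∤e) (begin
    (a + b) * ℕ→ℚ (d ℕ.* e)                        ≡⟨ cong ((a + b) *_) (ℕ→ℚ-* d e) ⟩
    (a + b) * (ℕ→ℚ d * ℕ→ℚ e)                      ≡⟨ eq a b (ℕ→ℚ d) (ℕ→ℚ e) ⟩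
    a * ℕ→ℚ d * ℕ→ℚ e + b * ℕ→ℚ e * ℕ→ℚ d          ≡⟨ cong₂ (λ s t → s * ℕ→ℚ e + t * ℕ→ℚ d) ad≡z be≡w ⟩
    ℤ→ℚ z * ℕ→ℚ e + ℤ→ℚ w * ℕ→ℚ d                  ≡⟨ cong₂ _+_ (ℤ→ℚ-* z (+ e)) (ℤ→ℚ-* w (+ d)) ⟨
    ℤ→ℚ (z ℤ.* + e) + ℤ→ℚ (w ℤ.* + d)              ≡⟨ ℤ→ℚ-+ (z ℤ.* + e) (w ℤ.* + d) ⟨
    ℤ→ℚ (z ℤ.* + e ℤ.+ w ℤ.* + d)                  ∎)
    where
    open ≡-Reasoning
    eq : ∀ a b d e → (a + b) * (d * e) ≡ a * d * e + b * e * d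
    eq = solve-∀ ring

  integral-* : ∀ {a b} → Integral a → Integral b → Integral (a * b)
  integral-* {a} {b} (fraction d z p∤d ad≡z) (fraction e w p∤e be≡w) = fraction (d ℕ.* e) (z ℤ.* w) (p∤* p∤d p∤e) (begin
    a * b * ℕ→ℚ (d ℕ.* e)                ≡⟨ cong (a * b *_) (ℕ→ℚ-* d e) ⟩
    a * b * (ℕ→ℚ d * ℕ→ℚ e)              ≡⟨ eq a b (ℕ→ℚ d) (ℕ→ℚ e) ⟩
    a * ℕ→ℚ d * (b * ℕ→ℚ e)              ≡⟨ cong₂ _*_ ad≡z be≡w ⟩
    ℤ→ℚ z * ℤ→ℚ w                        ≡⟨ ℤ→ℚ-* z w ⟨
    ℤ→ℚ (z ℤ.* w)                        ∎)
    where
    open ≡-Reasoning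
    eq : ∀ a b d e → a * b * (d * e) ≡ a * d * (b * e)
    eq = solve-∀ ring

  integral-neg : ∀ {a} → Integral a → Integral (- a)
  integral-neg {a} int = subst Integral (eq a) (integral-* (integral-ℤ -[1+ 0 ]) int)
    where
    eq : ∀ a → (- 1ℚ) * a ≡ - a
    eq = solve-∀ ring

  integral-- : ∀ {a b} → Integral a → Integral b → Integral (a - b)
  integral-- a b = integral-+ a (integral-neg b)

  integral-^ : ∀ {a} n → Integral a → Integral (a ^ n)
  integral-^ zero    a = integral-ℕ 1
  integral-^ (suc n) a = integral-* a (integral-^ n a)

  integral-sgn : ∀ n → Integral (sgn n)
  integral-sgn n = integral-^ n (integral-ℤ -[1+ 0 ])

  integral-recip : ∀ {k} → suc k ℕ.< p → Integral (recip (ℕ→ℚ (suc k)))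
  integral-recip {k} k<p = fraction (suc k) (+ 1) (p∤small k<p) (trans (ℚ.*-comm (recip (ℕ→ℚ (suc k))) (ℕ→ℚ (suc k))) (*-recip-sucʳ k))

  integral-Σ< : ∀ n {f : ℕ → ℚ} → (∀ k → k ℕ.< n → Integral (f k)) → Integral (Σ< n f)
  integral-Σ< zero    f = integral-ℕ 0
  integral-Σ< (suc n) f = integral-+ (integral-Σ< n (λ k k<n → f k (ℕ.m<n⇒m<1+n k<n))) (f n ℕ.≤-refl)

  -- Clearing denominators and using that numerator and denominator of q are coprime, the reduced
  -- denominator divides every other one.
  integral⇒pIntegral : ∀ {q} → Integral q → pIntegral p q
  integral⇒pIntegral {q@(mkℚ num den-1 coprime)} (fraction d z p∤d qd≡z) p∣den = p∤d (ℕ.∣-trans p∣den den∣d)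
    where
    cleared : num ℤ.* + d ≡ z ℤ.* + suc den-1
    cleared with ℚᵘ.≃-trans (ℚᵘ.*-cong (ℚᵘ.≃-refl {toℚᵘ q}) (ℚᵘ.≃-sym (ℚ.toℚᵘ-fromℚᵘ (mkℚᵘ (+ d) 0))))
                   (ℚᵘ.≃-trans (ℚᵘ.≃-sym (ℚ.toℚᵘ-homo-* q (ℕ→ℚ d))) (ℚᵘ.≃-trans (ℚ.toℚᵘ-cong qd≡z) (ℚ.toℚᵘ-fromℚᵘ (mkℚᵘ z 0))))
    ... | *≡* eq = trans (sym (ℤ.*-identityʳ (num ℤ.* + d))) (trans eq (cong (λ t → z ℤ.* + suc t) (ℕ.*-identityʳ den-1)))
    den∣d : suc den-1 ℕ.∣ d
    den∣d = coprime-divisor (coprime-sym (recomputeCoprime coprime)) (ℕ.divides ℤ.∣ z ∣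
      (trans (sym (ℤ.abs-* num (+ d))) (trans (cong ℤ.∣_∣ cleared) (ℤ.abs-* z (+ suc den-1)))))

  module Modulo (M : ℚ) (M-integral : Integral M) where
    infix 4 _≈_
    record _≈_ (a b : ℚ) : Set where
      constructor congruent
      field
        quotient : ℚ
        integral : Integral quotient
        equality : a ≡ b + M * quotient

    reflexive : ∀ {a b} → a ≡ b → a ≈ b
    reflexive {a} refl = congruent 0ℚ (integral-ℕ 0) (eq a M)
      where
      eq : ∀ a m → a ≡ a + m * 0ℚ
      eq = solve-∀ ring

    ≈-refl : ∀ {a} → a ≈ a
    ≈-refl = reflexive refl

    ≈-sym : ∀ {a b} → a ≈ b → b ≈ a
    ≈-sym {a} {b} (congruent c int refl) = congruent (- c) (integral-neg int) (eq b M c)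
      where
      eq : ∀ b m c → b ≡ b + m * c + m * - c
      eq = solve-∀ ring

    ≈-trans : ∀ {a b c} → a ≈ b → b ≈ c → a ≈ c
    ≈-trans {c = c} (congruent x xi refl) (congruent y yi refl) = congruent (x + y) (integral-+ xi yi) (eq c M x y)
      where
      eq : ∀ c m x y → c + m * y + m * x ≡ c + m * (x + y)
      eq = solve-∀ ring

    +-cong : ∀ {a b c d} → a ≈ b → c ≈ d → a + c ≈ b + d
    +-cong {b = b} {d = d} (congruent x xi refl) (congruent y yi refl) = congruent (x + y) (integral-+ xi yi) (eq b d M x y)
      where
      eq : ∀ b d m x y → b + m * x + (d + m * y) ≡ b + d + m * (x + y)
      eq = solve-∀ ring

    *-congˡ : ∀ {c a b} → Integral c → a ≈ b → c * a ≈ c * b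
    *-congˡ {c} {b = b} ci (congruent x xi refl) = congruent (c * x) (integral-* ci xi) (eq b c M x)
      where
      eq : ∀ b c m x → c * (b + m * x) ≡ c * b + m * (c * x)
      eq = solve-∀ ring

    *-congʳ : ∀ {c a b} → Integral c → a ≈ b → a * c ≈ b * c
    *-congʳ {c} {a} {b} ci a≈b = ≈-trans (reflexive (ℚ.*-comm a c)) (≈-trans (*-congˡ ci a≈b) (reflexive (ℚ.*-comm c b)))

    *-cong : ∀ {a b c d} → Integral c → Integral b → a ≈ b → c ≈ d → a * c ≈ b * d
    *-cong ci bi a≈b c≈d = ≈-trans (*-congʳ ci a≈b) (*-congˡ bi c≈d)

    -‿cong : ∀ {a b} → a ≈ b → - a ≈ - b
    -‿cong {b = b} (congruent x xi refl) = congruent (- x) (integral-neg xi) (eq b M x)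
      where
      eq : ∀ b m x → - (b + m * x) ≡ - b + m * - x
      eq = solve-∀ ring

    Σ<-cong : ∀ n {f g : ℕ → ℚ} → (∀ k → k ℕ.< n → f k ≈ g k) → Σ< n f ≈ Σ< n g
    Σ<-cong zero    f≈g = ≈-refl
    Σ<-cong (suc n) f≈g = +-cong (Σ<-cong n (λ k k<n → f≈g k (ℕ.m<n⇒m<1+n k<n))) (f≈g n ℕ.≤-refl)

    Σ<≈0 : ∀ n {f : ℕ → ℚ} → (∀ k → k ℕ.< n → f k ≈ 0ℚ) → Σ< n f ≈ 0ℚ
    Σ<≈0 zero    f≈0 = ≈-refl
    Σ<≈0 (suc n) f≈0 = ≈-trans (+-cong (Σ<≈0 n (λ k k<n → f≈0 k (ℕ.m<n⇒m<1+n k<n))) (f≈0 n ℕ.≤-refl)) (reflexive refl)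

    multiple≈0 : ∀ {c} → Integral c → M * c ≈ 0ℚ
    multiple≈0 {c} int = congruent c int (sym (ℚ.+-identityˡ (M * c)))

    ≈-setoid : Setoid 0ℓ 0ℓ
    ≈-setoid = record
      { Carrier = ℚ
      ; _≈_ = _≈_
      ; isEquivalence = record { refl = ≈-refl ; sym = ≈-sym ; trans = ≈-trans }
      }

  P : ℚ
  P = ℕ→ℚ p

  P-integral : Integral P
  P-integral = integral-ℕ p

  module Mod-p = Modulo P P-integral
  module Mod-p² = Modulo (P * P) (integral-* P-integral P-integral)
  open Mod-p² public

  -- A quantity that carries a factor p needs its cofactor modulo p only.
  *P-lift : ∀ {a b} → a Mod-p.≈ b → P * a ≈ P * b
  *P-lift {b = b} (Mod-p.congruent x xi refl) = congruent x xi (eq b P x)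
    where
    eq : ∀ b p x → p * (b + p * x) ≡ p * b + p * p * x
    eq = solve-∀ ring

  -- Each factor contributes one p. Applied to the squares of β past its index, this truncates the
  -- sums.
  *≈0 : ∀ {a b} → a Mod-p.≈ 0ℚ → b Mod-p.≈ 0ℚ → a * b ≈ 0ℚ
  *≈0 (Mod-p.congruent x xi refl) (Mod-p.congruent y yi refl) = congruent (x * y) (integral-* xi yi) (eq P x y)
    where
    eq : ∀ p x y → (0ℚ + p * x) * (0ℚ + p * y) ≡ 0ℚ + p * p * (x * y)
    eq = solve-∀ ring

  ≈⇒≈-mod-p : ∀ {a b} → a ≈ b → a Mod-p.≈ b
  ≈⇒≈-mod-p {b = b} (congruent x xi refl) = Mod-p.congruent (P * x) (integral-* P-integral xi) (eq b P x)
    where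
    eq : ∀ b p x → b + p * p * x ≡ b + p * (p * x)
    eq = solve-∀ ring

  ≈⇒Cong : ∀ {a b} → a ≈ b → Cong p a b (ℕ→ℚ (p ℕ.* p))
  ≈⇒Cong {b = b} (congruent x xi refl) = x , integral⇒pIntegral xi , trans (eq b (P * P) x) (cong (_* x) (sym (ℕ→ℚ-* p p)))
    where
    eq : ∀ b m x → b + m * x - b ≡ m * x
    eq = solve-∀ ring

  multiple-of-p-not-1 : ∀ {c} → Integral c → P * c ≢ 1ℚ
  multiple-of-p-not-1 {c} (fraction d z p∤d cd≡z) Pc≡1 = p∤d (ℕ.divides ℤ.∣ z ∣ (trans (cong ℤ.∣_∣ d≡zp) (ℤ.abs-* z (+ p))))
    where
    open ≡-Reasoning
    rotate : ∀ p c d → p * c * d ≡ c * d * p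
    rotate = solve-∀ ring
    d≡zp : + d ≡ z ℤ.* + p
    d≡zp = ℤ→ℚ-injective (begin
      ℕ→ℚ d                ≡⟨ ℚ.*-identityˡ (ℕ→ℚ d) ⟨
      1ℚ * ℕ→ℚ d           ≡⟨ cong (_* ℕ→ℚ d) Pc≡1 ⟨
      P * c * ℕ→ℚ d        ≡⟨ rotate P c (ℕ→ℚ d) ⟩
      c * ℕ→ℚ d * P        ≡⟨ cong (_* P) cd≡z ⟩
      ℤ→ℚ z * P            ≡⟨ ℤ→ℚ-* z (+ p) ⟨
      ℤ→ℚ (z ℤ.* + p)      ∎)

  -- An integer that divides ±1 modulo p is prime to p, hence invertible.
  solve-for : ∀ {e} z r → Integral e → e * ℤ→ℚ z Mod-p.≈ sgn r → e Mod-p.≈ sgn r * recip (ℤ→ℚ z)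
  solve-for {e} z r ei ez≈s = Mod-p.≈-trans (Mod-p.reflexive (trans (sym (ℚ.*-identityʳ e)) (trans (cong (e *_) (sym z*recip≡1)) (sym (ℚ.*-assoc e (ℤ→ℚ z) (recip (ℤ→ℚ z)))))))
                                        (Mod-p.*-congʳ recip-integral ez≈s)
    where
    p∤z : ¬ (p ℕ.∣ ℤ.∣ z ∣)
    p∤z (ℕ.divides k ∣z∣≡kp) = multiple-of-p-not-1 (integral-* (integral-sgn r) (integral-- (integral-* ei w-int) xi)) (begin
      P * (sgn r * (e * w - x))             ≡⟨ regroup P (sgn r) e w x ⟩
      sgn r * (e * (w * P) - P * x)         ≡⟨ cong (λ t → sgn r * (e * t - P * x)) (sym z≡wP) ⟩
      sgn r * (e * ℤ→ℚ z - P * x)           ≡⟨ cong (λ t → sgn r * (t - P * x)) ez≡ ⟩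
      sgn r * (sgn r + P * x - P * x)       ≡⟨ cancel (sgn r) (P * x) ⟩
      sgn r * sgn r                         ≡⟨ sgn² r ⟩
      1ℚ                                    ∎)
      where
      open ≡-Reasoning
      x : ℚ
      x = Mod-p._≈_.quotient ez≈s
      xi : Integral x
      xi = Mod-p._≈_.integral ez≈s
      ez≡ : e * ℤ→ℚ z ≡ sgn r + P * x
      ez≡ = Mod-p._≈_.equality ez≈s
      multiple : Σ ℤ λ w → z ≡ w ℤ.* + p
      multiple = [ (λ eq → + k , trans (sym eq) (trans (cong +_ ∣z∣≡kp) (ℤ.pos-* k p)))
                 , (λ eq → ℤ.- + k , trans (sym (ℤ.neg-involutive z)) (trans (cong ℤ.-_ (trans (sym eq) (trans (cong +_ ∣z∣≡kp) (ℤ.pos-* k p)))) (ℤ.neg-distribˡ-* (+ k) (+ p))))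
                 ]′ (ℤ.+∣i∣≡i⊎+∣i∣≡-i z)
      w : ℚ
      w = ℤ→ℚ (proj₁ multiple)
      w-int : Integral w
      w-int = integral-ℤ (proj₁ multiple)
      z≡wP : ℤ→ℚ z ≡ w * P
      z≡wP = trans (cong ℤ→ℚ (proj₂ multiple)) (ℤ→ℚ-* (proj₁ multiple) (+ p))
      regroup : ∀ p s e w x → p * (s * (e * w - x)) ≡ s * (e * (w * p) - p * x)
      regroup = solve-∀ ring
      cancel : ∀ s y → s * (s + y - y) ≡ s * s
      cancel = solve-∀ ring
    z≢0 : ℤ→ℚ z ≢ 0ℚ
    z≢0 eq = p∤z (subst (λ t → p ℕ.∣ ℤ.∣ t ∣) (sym (ℤ→ℚ-injective {z} {+ 0} eq)) (p ℕ.∣0))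
    z*recip≡1 : ℤ→ℚ z * recip (ℤ→ℚ z) ≡ 1ℚ
    z*recip≡1 = *-recipʳ z≢0
    recip*z≡1 : recip (ℤ→ℚ z) * ℤ→ℚ z ≡ 1ℚ
    recip*z≡1 = trans (ℚ.*-comm (recip (ℤ→ℚ z)) (ℤ→ℚ z)) z*recip≡1
    recip-integral : Integral (recip (ℤ→ℚ z))
    recip-integral = [ (λ eq → fraction ℤ.∣ z ∣ (+ 1) p∤z (trans (cong (λ t → recip (ℤ→ℚ z) * ℤ→ℚ t) eq) recip*z≡1))
                     , (λ eq → fraction ℤ.∣ z ∣ -[1+ 0 ] p∤z (trans (cong (λ t → recip (ℤ→ℚ z) * ℤ→ℚ t) eq)
                         (trans (cong (recip (ℤ→ℚ z) *_) (ℤ→ℚ-neg z)) (trans (sym (ℚ.neg-distribʳ-* (recip (ℤ→ℚ z)) (ℤ→ℚ z))) (cong -_ recip*z≡1)))))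
                     ]′ (ℤ.+∣i∣≡i⊎+∣i∣≡-i z)

-- The sums F at the arguments j - p/2, modulo p².

module ShiftedSums (p : ℕ) (prime : Prime p) (n : ℕ) (p≡1+2n : p ≡ suc (n ℕ.+ n)) where
  open Localisation p prime public
  open QuadraticCharacter p prime n p≡1+2n using (0<n; 2<p; 2n<p; 1+n<p)
  open import Relation.Binary.Reasoning.Setoid ≈-setoid

  ½-integral : Integral ½
  ½-integral = fraction 2 (+ 1) (p∤small 2<p) refl

  τ : ℚ
  τ = ½ * P

  τ-integral : Integral τ
  τ-integral = integral-* ½-integral P-integral

  drop-τ² : ∀ {x y} → Integral y → x + τ * τ * y ≈ x
  drop-τ² {x} {y} yi = congruent (½ * ½ * y) (integral-* (integral-* ½-integral ½-integral) yi) (eq x y P)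
    where
    eq : ∀ x y p → x + ½ * p * (½ * p) * y ≡ x + p * p * (½ * ½ * y)
    eq = solve-∀ ring

  at : ℕ → ℚ
  at j = ℕ→ℚ j - τ

  at-integral : ∀ j → Integral (at j)
  at-integral j = integral-- (integral-ℕ j) τ-integral

  at-pred : ∀ j → at (suc j) - 1ℚ ≡ at j
  at-pred j = trans (cong (λ t → t - τ - 1ℚ) (ℕ→ℚ-suc j)) (eq (ℕ→ℚ j) τ)
    where
    eq : ∀ j t → j + 1ℚ - t - 1ℚ ≡ j - t
    eq = solve-∀ ring

  ½≡at : ½ ≡ at (suc n)
  ½≡at = trans (eq (ℕ→ℚ n)) (cong₂ (λ s t → s - ½ * t) (sym (ℕ→ℚ-suc n))
    (trans (cong (_+ 1ℚ) (sym (ℕ→ℚ-+ n n))) (trans (sym (ℕ→ℚ-suc (n ℕ.+ n))) (cong ℕ→ℚ (sym p≡1+2n)))))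
    where
    eq : ∀ n → ½ ≡ n + 1ℚ - ½ * (n + n + 1ℚ)
    eq = solve-∀ ring

  β-integral : ∀ {z} k → k ℕ.< p → Integral z → Integral (β z k)
  β-integral zero    _   zi = integral-ℕ 1
  β-integral (suc k) k<p zi = integral-* (integral-* (β-integral k (ℕ.<-trans (ℕ.n<1+n k) k<p) zi) (integral-- zi (integral-ℕ k))) (integral-recip k<p)

  -- Past k = j the product β (at j) k contains the factor j - τ - j = - p/2.
  β≈0 : ∀ j k → j ℕ.< k → k ℕ.< p → β (at j) k Mod-p.≈ 0ℚ
  β≈0 j (suc k) j<1+k k<p = [ later , here ]′ (ℕ.m<1+n⇒m<n∨m≡n j<1+k)
    where
    k<p′ : k ℕ.< p
    k<p′ = ℕ.<-trans (ℕ.n<1+n k) k<p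
    β-int : Integral (β (at j) k)
    β-int = β-integral k k<p′ (at-integral j)
    later : j ℕ.< k → β (at j) (suc k) Mod-p.≈ 0ℚ
    later j<k = Mod-p.≈-trans (Mod-p.*-congʳ (integral-recip k<p) (Mod-p.*-congʳ (integral-- (at-integral j) (integral-ℕ k)) (β≈0 j k j<k k<p′)))
      (Mod-p.reflexive (eq (at j - ℕ→ℚ k) (recip (ℕ→ℚ (suc k)))))
      where
      eq : ∀ a b → 0ℚ * a * b ≡ 0ℚ
      eq = solve-∀ ring
    here : j ≡ k → β (at j) (suc k) Mod-p.≈ 0ℚ
    here refl = Mod-p.≈-trans (Mod-p.reflexive (eq (β (at j) j) (ℕ→ℚ j) P (recip (ℕ→ℚ (suc j)))))
      (Mod-p.multiple≈0 (integral-* (integral-neg (integral-* ½-integral β-int)) (integral-recip k<p)))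
      where
      eq : ∀ b j p r → b * (j - ½ * p - j) * r ≡ p * (- (½ * b) * r)
      eq = solve-∀ ring

  -- The length p is written as a successor, the form in which `F-recurrence` and `T-F` are stated.
  𝓕 : ℚ → ℚ
  𝓕 = F (suc (n ℕ.+ n))

  summand-integral : ∀ {z} k → k ℕ.< p → Integral z → Integral (sgn k * (β z k * β z k))
  summand-integral k k<p zi = integral-* (integral-sgn k) (integral-* (β-integral k k<p zi) (β-integral k k<p zi))

  𝓕-integral : ∀ j → Integral (𝓕 (at j))
  𝓕-integral j = integral-Σ< (suc (n ℕ.+ n)) (λ k k<p → summand-integral k (subst (k ℕ.<_) (sym p≡1+2n) k<p) (at-integral j))

  summand≈0 : ∀ j k → j ℕ.< k → k ℕ.< p → sgn k * (β (at j) k * β (at j) k) ≈ 0ℚ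
  summand≈0 j k j<k k<p = ≈-trans (*-congˡ (integral-sgn k) (*≈0 (β≈0 j k j<k k<p) (β≈0 j k j<k k<p))) (reflexive (ℚ.*-zeroʳ (sgn k)))

  -- Every coefficient with k ≥ 1 is a multiple of p, so only the term k = 0 survives the squaring.
  𝓕[0-τ] : 𝓕 (at 0) ≈ 1ℚ
  𝓕[0-τ] = begin
    𝓕 (at 0)                                       ≡⟨ Σ<-peel (n ℕ.+ n) _ ⟩
    1ℚ * (1ℚ * 1ℚ) + Σ< (n ℕ.+ n) (λ k → sgn (suc k) * (β (at 0) (suc k) * β (at 0) (suc k)))
      ≈⟨ +-cong (≈-refl {1ℚ * (1ℚ * 1ℚ)}) (Σ<≈0 (n ℕ.+ n) (λ k k<2n → summand≈0 0 (suc k) (s≤s z≤n) (subst (suc k ℕ.<_) (sym p≡1+2n) (s≤s k<2n)))) ⟩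
    1ℚ ∎

  -- The terms k = 0 and k = 1 survive: 1 - (1 - τ)² = 2τ - τ², and 2τ = p.
  𝓕[1-τ] : 𝓕 (at 1) ≈ P
  𝓕[1-τ] = begin
    𝓕 (at 1)
      ≡⟨ trans (Σ<-peel (n ℕ.+ n) f) (cong (λ t → f 0 + t) (trans (cong (λ t → Σ< t (λ k → f (suc k))) 2n≡) (Σ<-peel m (λ k → f (suc k))))) ⟩
    f 0 + (f 1 + Σ< m (λ k → f (suc (suc k))))
      ≈⟨ +-cong (≈-refl {f 0}) (+-cong (≈-refl {f 1}) (Σ<≈0 m (λ k k<m → summand≈0 1 (suc (suc k)) (s≤s (s≤s z≤n))
           (subst (suc (suc k) ℕ.<_) (trans (cong suc (sym 2n≡)) (sym p≡1+2n)) (s≤s (s≤s k<m)))))) ⟩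
    f 0 + (f 1 + 0ℚ)
      ≡⟨ eq P ⟩
    P + τ * τ * (- 1ℚ)
      ≈⟨ drop-τ² (integral-ℤ -[1+ 0 ]) ⟩
    P ∎
    where
    f : ℕ → ℚ
    f k = sgn k * (β (at 1) k * β (at 1) k)
    m : ℕ
    m = ℕ.pred (n ℕ.+ n)
    2n≡ : n ℕ.+ n ≡ suc m
    2n≡ = sym (ℕ.suc-pred (n ℕ.+ n) {{ℕ.>-nonZero (ℕ.≤-trans 0<n (ℕ.m≤m+n n n))}})
    eq : ∀ p → 1ℚ * (1ℚ * 1ℚ) + ((- 1ℚ) * 1ℚ * (1ℚ * (1ℚ - ½ * p - 0ℚ) * 1ℚ * (1ℚ * (1ℚ - ½ * p - 0ℚ) * 1ℚ)) + 0ℚ) ≡ p + ½ * p * (½ * p) * (- 1ℚ)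
    eq = solve-∀ ring

  -- (N + τ) / N² inverts N - τ up to a multiple of τ².
  cancel-at : ∀ i {x y} → suc i ℕ.< p → Integral x → Integral y → at (suc i) * x ≈ at (suc i) * y → x ≈ y
  cancel-at i {x} {y} i<p xi yi eq = begin
    x                                          ≈⟨ drop-τ² (integral-neg (integral-* (integral-* vi vi) xi)) ⟨
    x + τ * τ * - (v * v * x)                  ≡⟨ unfold x ⟨
    u * (at (suc i) * x)                       ≈⟨ *-congˡ ui eq ⟩
    u * (at (suc i) * y)                       ≡⟨ unfold y ⟩
    y + τ * τ * - (v * v * y)                  ≈⟨ drop-τ² (integral-neg (integral-* (integral-* vi vi) yi)) ⟩
    y                                          ∎
    where
    N u v : ℚ
    N = ℕ→ℚ (suc i)
    v = recip N
    u = (N + τ) * (v * v)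
    vi : Integral v
    vi = integral-recip i<p
    ui : Integral u
    ui = integral-* (integral-+ (integral-ℕ (suc i)) τ-integral) (integral-* vi vi)
    unfold : ∀ x → u * (at (suc i) * x) ≡ x + τ * τ * - (v * v * x)
    unfold x = trans (expand N v τ x) (trans (cong (λ t → t * t * x + τ * τ * - (v * v * x)) (*-recip-sucʳ i)) (cong (λ t → t + τ * τ * - (v * v * x)) (ℚ.*-identityˡ x)))
      where
      expand : ∀ n v t x → (n + t) * (v * v) * ((n - t) * x) ≡ n * v * (n * v) * x + t * t * - (v * v * x)
      expand = solve-∀ ring

  -- The boundary term of `F-recurrence` contains the square of β(a-1,p-1), where a - 1 = j + 1 - τ
  -- and j + 1 < p - 1, so it vanishes. Both remaining terms share the unit a - 1, which `cancel-at`
  -- removes.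
  𝓕-step : ∀ j → suc (suc j) ℕ.< p → at (suc (suc j)) * 𝓕 (at (suc (suc j))) ≈ - (ℕ→ℚ 4 * (at (suc j) * 𝓕 (at j)))
  𝓕-step j 2+j<p = cancel-at j 1+j<p (integral-* (at-integral (suc (suc j))) (𝓕-integral (suc (suc j))))
    (integral-neg (integral-* (integral-ℕ 4) (integral-* (at-integral (suc j)) (𝓕-integral j)))) (begin
    b * (a * 𝓕 a)
      ≡⟨ isolate a b (𝓕 a) (𝓕 c) ⟩
    b * - (ℕ→ℚ 4 * (b * 𝓕 c)) + (a * b * 𝓕 a + ℕ→ℚ 4 * b * b * 𝓕 c)
      ≡⟨ cong (λ t → b * - (ℕ→ℚ 4 * (b * 𝓕 c)) + t) recurrence ⟩
    b * - (ℕ→ℚ 4 * (b * 𝓕 c)) + sgn (suc (n ℕ.+ n)) * (β b (n ℕ.+ n) * β b (n ℕ.+ n) * certificate a (ℕ→ℚ (suc (n ℕ.+ n))))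
      ≈⟨ +-cong (≈-refl {b * - (ℕ→ℚ 4 * (b * 𝓕 c))}) boundary ⟩
    b * - (ℕ→ℚ 4 * (b * 𝓕 c)) + 0ℚ
      ≡⟨ ℚ.+-identityʳ (b * - (ℕ→ℚ 4 * (b * 𝓕 c))) ⟩
    b * - (ℕ→ℚ 4 * (b * 𝓕 c)) ∎)
    where
    1+j<p : suc j ℕ.< p
    1+j<p = ℕ.<-trans (ℕ.n<1+n (suc j)) 2+j<p
    a b c : ℚ
    a = at (suc (suc j))
    b = at (suc j)
    c = at j
    isolate : ∀ a b u v → b * (a * u) ≡ b * - (ℕ→ℚ 4 * (b * v)) + (a * b * u + ℕ→ℚ 4 * b * b * v)
    isolate = solve-∀ ring
    recurrence : a * b * 𝓕 a + ℕ→ℚ 4 * b * b * 𝓕 c ≡ sgn (suc (n ℕ.+ n)) * (β b (n ℕ.+ n) * β b (n ℕ.+ n) * certificate a (ℕ→ℚ (suc (n ℕ.+ n))))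
    recurrence = trans (cong₂ (λ s t → a * s * 𝓕 a + ℕ→ℚ 4 * s * s * 𝓕 t) (sym (at-pred (suc j))) (trans (sym (at-pred j)) (cong (_- 1ℚ) (sym (at-pred (suc j))))))
      (trans (F-recurrence (n ℕ.+ n) a)
        (cong (λ t → sgn (suc (n ℕ.+ n)) * (β t (n ℕ.+ n) * β t (n ℕ.+ n) * certificate a (ℕ→ℚ (suc (n ℕ.+ n))))) (at-pred (suc j))))
    certificate-integral : ∀ {a k} → Integral a → Integral k → Integral (certificate a k)
    certificate-integral ai ki = integral-+ (integral-- (integral-- (integral-- (integral-* (integral-* (integral-ℕ 6) ai) ki) (integral-* (integral-* (integral-ℕ 2) ki) ki))
      (integral-* (integral-ℕ 2) ki)) (integral-* (integral-* (integral-ℕ 5) ai) ai)) (integral-* (integral-ℕ 3) ai)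
    boundary : sgn (suc (n ℕ.+ n)) * (β b (n ℕ.+ n) * β b (n ℕ.+ n) * certificate a (ℕ→ℚ (suc (n ℕ.+ n)))) ≈ 0ℚ
    boundary = ≈-trans (*-congˡ (integral-sgn (suc (n ℕ.+ n))) (*-congʳ (certificate-integral (at-integral (suc (suc j))) (integral-ℕ (suc (n ℕ.+ n)))) (*≈0 β≈ β≈)))
      (reflexive (vanish (sgn (suc (n ℕ.+ n))) (certificate a (ℕ→ℚ (suc (n ℕ.+ n))))))
      where
      β≈ : β b (n ℕ.+ n) Mod-p.≈ 0ℚ
      β≈ = β≈0 (suc j) (n ℕ.+ n) (ℕ.≤-pred (subst (suc (suc j) ℕ.<_) p≡1+2n 2+j<p)) 2n<p
      vanish : ∀ s k → s * (0ℚ * k) ≡ 0ℚ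
      vanish = solve-∀ ring

  harmonic : ℕ → ℚ
  harmonic m = Σ< m (λ k → sgn k * recip (ℕ→ℚ (suc k)))

  harmonic-integral : ∀ m → m ℕ.< p → Integral (harmonic m)
  harmonic-integral m m<p = integral-Σ< m (λ k k<m → integral-* (integral-sgn k) (integral-recip (ℕ.≤-<-trans k<m m<p)))

  -- The product of -4 (2j+1)/(2j+2) over j < i: the solution of the recurrence of `𝓕-step` on even
  -- indices when τ is set to 0.
  signedCentral : ℕ → ℚ
  signedCentral i = sgn i * central i

  signedCentral-integral : ∀ i → Integral (signedCentral i)
  signedCentral-integral i = integral-* (integral-sgn i) (integral-ℕ ((2 ℕ.* i) C i))

  ℕ→ℚ-double : ∀ i → ℕ→ℚ (i ℕ.+ i) ≡ ℕ→ℚ 2 * ℕ→ℚ i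
  ℕ→ℚ-double i = trans (ℕ→ℚ-+ i i) (eq (ℕ→ℚ i))
    where
    eq : ∀ a → a + a ≡ ℕ→ℚ 2 * a
    eq = solve-∀ ring

  ℕ→ℚ-1+double : ∀ i → ℕ→ℚ (suc (i ℕ.+ i)) ≡ ℕ→ℚ 2 * ℕ→ℚ i + 1ℚ
  ℕ→ℚ-1+double i = trans (ℕ→ℚ-suc (i ℕ.+ i)) (cong (_+ 1ℚ) (ℕ→ℚ-double i))

  ℕ→ℚ-2+double : ∀ i → ℕ→ℚ (suc (suc (i ℕ.+ i))) ≡ ℕ→ℚ 2 * ℕ→ℚ (suc i)
  ℕ→ℚ-2+double i = trans (cong (λ t → ℕ→ℚ (suc t)) (sym (ℕ.+-suc i i))) (ℕ→ℚ-double (suc i))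

  signedCentral-suc : ∀ i → ℕ→ℚ (suc (suc (i ℕ.+ i))) * signedCentral (suc i) ≡ - (ℕ→ℚ 4 * ℕ→ℚ (suc (i ℕ.+ i)) * signedCentral i)
  signedCentral-suc i = trans (cong (_* signedCentral (suc i)) (ℕ→ℚ-2+double i)) (trans (regroup (ℕ→ℚ (suc i)) (sgn i) (central (suc i)))
    (trans (cong (λ t → - (ℕ→ℚ 2 * sgn i) * t) (central-suc i)) (trans (collect (ℕ→ℚ 2 * ℕ→ℚ i + 1ℚ) (sgn i) (central i))
      (cong (λ t → - (ℕ→ℚ 4 * t * signedCentral i)) (sym (ℕ→ℚ-1+double i))))))
    where
    regroup : ∀ a s c → ℕ→ℚ 2 * a * ((- 1ℚ) * s * c) ≡ - (ℕ→ℚ 2 * s) * (a * c)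
    regroup = solve-∀ ring
    collect : ∀ x s c → - (ℕ→ℚ 2 * s) * (ℕ→ℚ 2 * x * c) ≡ - (ℕ→ℚ 4 * x * (s * c))
    collect = solve-∀ ring

  -- A step multiplies by -4 (M - τ)/(N - τ) with M = 2i + 1 and N = 2i + 2. To first order in τ
  -- this is (-4M/N)(1 - τ (1/M - 1/N)); the first factor updates the central binomial coefficient,
  -- the second extends the alternating harmonic sum by two terms.
  𝓕-even : ∀ i → i ℕ.+ i ℕ.< p → 𝓕 (at (i ℕ.+ i)) ≈ signedCentral i * (1ℚ - τ * harmonic (i ℕ.+ i))
  𝓕-even zero    _ = ≈-trans 𝓕[0-τ] (reflexive (eq τ))
    where
    eq : ∀ t → 1ℚ ≡ 1ℚ * 1ℚ * (1ℚ - t * 0ℚ)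
    eq = solve-∀ ring
  𝓕-even (suc i) 2i+2<p = subst (λ t → 𝓕 (at t) ≈ c′ * (1ℚ - τ * harmonic t)) (sym 2i+2≡) (cancel-at (suc (i ℕ.+ i)) <p (𝓕-integral (suc (suc (i ℕ.+ i))))
      (integral-* c′i (integral-- (integral-ℕ 1) (integral-* τ-integral (harmonic-integral (suc (suc (i ℕ.+ i))) <p)))) (begin
    at (suc (suc (i ℕ.+ i))) * 𝓕 (at (suc (suc (i ℕ.+ i))))
      ≈⟨ 𝓕-step (i ℕ.+ i) <p ⟩
    - (ℕ→ℚ 4 * ((M - τ) * 𝓕 (at (i ℕ.+ i))))
      ≈⟨ -‿cong (*-congˡ (integral-ℕ 4) (*-congˡ (at-integral (suc (i ℕ.+ i))) (𝓕-even i (ℕ.<-trans (ℕ.n<1+n (i ℕ.+ i)) (ℕ.<-trans (ℕ.n<1+n (suc (i ℕ.+ i))) <p))))) ⟩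
    - (ℕ→ℚ 4 * ((M - τ) * (c * (1ℚ - τ * H))))
      -- The multiple of τ² added here is the exact error of the first-order expansion. From here on
      -- only equalities are used: M u = 1, N v = 1, the recurrence of c, and ring identities.
      ≈⟨ drop-τ² remainder-integral ⟨
    - (ℕ→ℚ 4 * ((M - τ) * (c * (1ℚ - τ * H)))) + τ * τ * (ℕ→ℚ 4 * c * H + c′ * (H + u - v))
      ≡⟨ expand₁ M τ c c′ H u v ⟩
    - (ℕ→ℚ 4 * c) * (M * (1ℚ - τ * H) - τ * 1ℚ) + τ * τ * (c′ * (H + u - v))
      ≡⟨ cong (λ t → - (ℕ→ℚ 4 * c) * (M * (1ℚ - τ * H) - τ * t) + τ * τ * (c′ * (H + u - v))) (*-recip-sucʳ (i ℕ.+ i)) ⟨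
    - (ℕ→ℚ 4 * c) * (M * (1ℚ - τ * H) - τ * (M * u)) + τ * τ * (c′ * (H + u - v))
      ≡⟨ expand₂ M τ c c′ H u v ⟩
    - (ℕ→ℚ 4 * M * c) * (1ℚ - τ * H - τ * u) + τ * c′ * 1ℚ - τ * c′ + τ * τ * (c′ * (H + u - v))
      ≡⟨ cong₂ (λ s t → s * (1ℚ - τ * H - τ * u) + τ * c′ * t - τ * c′ + τ * τ * (c′ * (H + u - v))) (signedCentral-suc i) (*-recip-sucʳ (suc (i ℕ.+ i))) ⟨
    N * c′ * (1ℚ - τ * H - τ * u) + τ * c′ * (N * v) - τ * c′ + τ * τ * (c′ * (H + u - v))
      ≡⟨ expand₃ N τ c′ H u v ⟩
    (N - τ) * (c′ * (1ℚ - τ * (H + 1ℚ * u + (- 1ℚ) * 1ℚ * v)))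
      ≡⟨ cong (λ s → (N - τ) * (c′ * (1ℚ - τ * (H + s * u + (- 1ℚ) * s * v)))) (sgn-even i) ⟨
    (N - τ) * (c′ * (1ℚ - τ * harmonic (suc (suc (i ℕ.+ i))))) ∎))
    where
    2i+2≡ : suc i ℕ.+ suc i ≡ suc (suc (i ℕ.+ i))
    2i+2≡ = cong suc (ℕ.+-suc i i)
    <p : suc (suc (i ℕ.+ i)) ℕ.< p
    <p = subst (ℕ._< p) 2i+2≡ 2i+2<p
    M N c c′ H u v : ℚ
    M = ℕ→ℚ (suc (i ℕ.+ i))
    N = ℕ→ℚ (suc (suc (i ℕ.+ i)))
    c = signedCentral i
    c′ = signedCentral (suc i)
    H = harmonic (i ℕ.+ i)
    u = recip M
    v = recip N
    c′i : Integral c′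
    c′i = signedCentral-integral (suc i)
    remainder-integral : Integral (ℕ→ℚ 4 * c * H + c′ * (H + u - v))
    remainder-integral = integral-+ (integral-* (integral-* (integral-ℕ 4) (signedCentral-integral i)) Hi)
      (integral-* c′i (integral-- (integral-+ Hi (integral-recip (ℕ.<-trans (ℕ.n<1+n _) <p))) (integral-recip <p)))
      where
      Hi : Integral H
      Hi = harmonic-integral (i ℕ.+ i) (ℕ.<-trans (ℕ.n<1+n _) (ℕ.<-trans (ℕ.n<1+n _) <p))
    expand₁ : ∀ M t c c′ H u v → - (ℕ→ℚ 4 * ((M - t) * (c * (1ℚ - t * H)))) + t * t * (ℕ→ℚ 4 * c * H + c′ * (H + u - v))
              ≡ - (ℕ→ℚ 4 * c) * (M * (1ℚ - t * H) - t * 1ℚ) + t * t * (c′ * (H + u - v))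
    expand₁ = solve-∀ ring
    expand₂ : ∀ M t c c′ H u v → - (ℕ→ℚ 4 * c) * (M * (1ℚ - t * H) - t * (M * u)) + t * t * (c′ * (H + u - v))
              ≡ - (ℕ→ℚ 4 * M * c) * (1ℚ - t * H - t * u) + t * c′ * 1ℚ - t * c′ + t * t * (c′ * (H + u - v))
    expand₂ = solve-∀ ring
    expand₃ : ∀ N t c′ H u v → N * c′ * (1ℚ - t * H - t * u) + t * c′ * (N * v) - t * c′ + t * t * (c′ * (H + u - v))
              ≡ (N - t) * (c′ * (1ℚ - t * (H + 1ℚ * u + (- 1ℚ) * 1ℚ * v)))
    expand₃ = solve-∀ ring

  -- The product of -4 (2j+2)/(2j+3) over j < i, the odd-index counterpart of `signedCentral`.
  oddRatio : ℕ → ℚ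
  oddRatio zero    = 1ℚ
  oddRatio (suc i) = - (ℕ→ℚ 4 * ℕ→ℚ (suc (suc (i ℕ.+ i))) * oddRatio i) * recip (ℕ→ℚ (suc (suc (suc (i ℕ.+ i)))))

  oddRatio-suc : ∀ i → ℕ→ℚ (suc (suc (suc (i ℕ.+ i)))) * oddRatio (suc i) ≡ - (ℕ→ℚ 4 * ℕ→ℚ (suc (suc (i ℕ.+ i))) * oddRatio i)
  oddRatio-suc i = trans (swap N y (recip N)) (trans (cong (y *_) (*-recip-sucʳ (suc (suc (i ℕ.+ i))))) (ℚ.*-identityʳ y))
    where
    N y : ℚ
    N = ℕ→ℚ (suc (suc (suc (i ℕ.+ i))))
    y = - (ℕ→ℚ 4 * ℕ→ℚ (suc (suc (i ℕ.+ i))) * oddRatio i)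
    swap : ∀ a b c → a * (b * c) ≡ b * (a * c)
    swap = solve-∀ ring

  oddRatio-integral : ∀ i → suc (i ℕ.+ i) ℕ.< p → Integral (oddRatio i)
  oddRatio-integral zero    _ = integral-ℕ 1
  oddRatio-integral (suc i) 2i+3<p = integral-* (integral-neg (integral-* (integral-* (integral-ℕ 4) (integral-ℕ (suc (suc (i ℕ.+ i)))))
      (oddRatio-integral i (ℕ.<-trans (ℕ.n<1+n _) (ℕ.<-trans (ℕ.n<1+n _) <p))))) (integral-recip <p)
    where
    <p : suc (suc (suc (i ℕ.+ i))) ℕ.< p
    <p = subst (ℕ._< p) (cong (λ t → suc (suc t)) (ℕ.+-suc i i)) 2i+3<p

  -- The chain starts from the value p, so replacing each M - τ and N - τ by M and N changes the
  -- result by a multiple of p² only; there is no harmonic correction.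
  𝓕-odd : ∀ i → suc (i ℕ.+ i) ℕ.< p → 𝓕 (at (suc (i ℕ.+ i))) ≈ P * oddRatio i
  𝓕-odd zero    _ = ≈-trans 𝓕[1-τ] (reflexive (sym (ℚ.*-identityʳ P)))
  𝓕-odd (suc i) 2i+3<p = subst (λ t → 𝓕 (at t) ≈ P * oddRatio (suc i)) (sym 2i+3≡) (cancel-at (suc (suc (i ℕ.+ i))) <p (𝓕-integral (suc (suc (suc (i ℕ.+ i)))))
      (integral-* P-integral e′i) (begin
    (N - τ) * 𝓕 (N - τ)
      ≈⟨ 𝓕-step (suc (i ℕ.+ i)) <p ⟩
    - (ℕ→ℚ 4 * ((M - τ) * 𝓕 (at (suc (i ℕ.+ i)))))
      ≈⟨ -‿cong (*-congˡ (integral-ℕ 4) (*-congˡ (at-integral (suc (suc (i ℕ.+ i)))) (𝓕-odd i <p′))) ⟩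
    - (ℕ→ℚ 4 * ((M - τ) * (P * e)))
      ≈⟨ drop-τ² (integral-neg (integral-+ (integral-* (integral-ℕ 2) e′i) (integral-* (integral-ℕ 8) (oddRatio-integral i <p′)))) ⟨
    - (ℕ→ℚ 4 * ((M - τ) * (P * e))) + τ * τ * - (ℕ→ℚ 2 * e′ + ℕ→ℚ 8 * e)
      ≡⟨ expand₁ M P e e′ ⟩
    P * - (ℕ→ℚ 4 * M * e) - τ * (P * e′)
      ≡⟨ cong (λ t → P * t - τ * (P * e′)) (oddRatio-suc i) ⟨
    P * (N * e′) - τ * (P * e′)
      ≡⟨ expand₂ N τ P e′ ⟩
    (N - τ) * (P * e′) ∎))
    where
    2i+3≡ : suc (suc i ℕ.+ suc i) ≡ suc (suc (suc (i ℕ.+ i)))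
    2i+3≡ = cong (λ t → suc (suc t)) (ℕ.+-suc i i)
    <p : suc (suc (suc (i ℕ.+ i))) ℕ.< p
    <p = subst (ℕ._< p) 2i+3≡ 2i+3<p
    <p′ : suc (i ℕ.+ i) ℕ.< p
    <p′ = ℕ.<-trans (ℕ.n<1+n _) (ℕ.<-trans (ℕ.n<1+n _) <p)
    M N e e′ : ℚ
    M = ℕ→ℚ (suc (suc (i ℕ.+ i)))
    N = ℕ→ℚ (suc (suc (suc (i ℕ.+ i))))
    e = oddRatio i
    e′ = oddRatio (suc i)
    e′i : Integral e′
    e′i = oddRatio-integral (suc i) 2i+3<p
    expand₁ : ∀ M p e e′ → - (ℕ→ℚ 4 * ((M - ½ * p) * (p * e))) + ½ * p * (½ * p) * - (ℕ→ℚ 2 * e′ + ℕ→ℚ 8 * e) ≡ p * - (ℕ→ℚ 4 * M * e) - ½ * p * (p * e′)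
    expand₁ = solve-∀ ring
    expand₂ : ∀ N t p e′ → p * (N * e′) - t * (p * e′) ≡ (N - t) * (p * e′)
    expand₂ = solve-∀ ring

  -- From i to i + 1 the left side is multiplied by -4 (2i+2)/(2i+3) · (2i+3)/(2i+1) · 2
  -- (2i+1)/(i+1) = -16.
  oddRatio-central : ∀ i → oddRatio i * (ℕ→ℚ (suc (i ℕ.+ i)) * central i) ≡ (- ℕ→ℚ 16) ^ i
  oddRatio-central zero    = refl
  oddRatio-central (suc i) =
    trans (cong (λ t → e′ * (ℕ→ℚ (suc (suc t)) * central (suc i))) (ℕ.+-suc i i)) (
    trans (regroup e′ N (central (suc i))) (
    trans (cong (_* central (suc i)) (trans (oddRatio-suc i) (cong (λ t → - (ℕ→ℚ 4 * t * e)) (ℕ→ℚ-2+double i)))) (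
    trans (isolate (ℕ→ℚ (suc i)) e (central (suc i))) (
    trans (cong (- (ℕ→ℚ 8 * e) *_) (central-suc i)) (
    trans (collect (ℕ→ℚ 2 * ℕ→ℚ i + 1ℚ) e (central i)) (
    cong (- ℕ→ℚ 16 *_) (trans (cong (λ t → e * (t * central i)) (sym (ℕ→ℚ-1+double i))) (oddRatio-central i))))))))
    where
    e e′ N : ℚ
    e = oddRatio i
    e′ = oddRatio (suc i)
    N = ℕ→ℚ (suc (suc (suc (i ℕ.+ i))))
    regroup : ∀ e n c → e * (n * c) ≡ n * e * c
    regroup = solve-∀ ring
    isolate : ∀ k e c → - (ℕ→ℚ 4 * (ℕ→ℚ 2 * k) * e) * c ≡ - (ℕ→ℚ 8 * e) * (k * c)
    isolate = solve-∀ ring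
    collect : ∀ x e c → - (ℕ→ℚ 8 * e) * (ℕ→ℚ 2 * x * c) ≡ - ℕ→ℚ 16 * (e * (x * c))
    collect = solve-∀ ring

  -- The upper index 2n = p - 1 is -1 modulo p, so the factor p - 1 - k cancels against k + 1 up to
  -- the sign.
  [-1-]-binomial : ∀ k → k ℕ.≤ n ℕ.+ n → β (ℕ→ℚ (n ℕ.+ n)) k Mod-p.≈ sgn k
  [-1-]-binomial zero    _   = Mod-p.≈-refl
  [-1-]-binomial (suc k) k<2n = Mod-p.≈-trans (Mod-p.*-congʳ (integral-recip 1+k<p) (Mod-p.*-cong (integral-- (integral-ℕ (n ℕ.+ n)) (integral-ℕ k)) (integral-sgn k)
      ([-1-]-binomial k (ℕ.<⇒≤ k<2n)) factor))
    (Mod-p.reflexive (trans (regroup (sgn k) (ℕ→ℚ (suc k)) (recip (ℕ→ℚ (suc k)))) (trans (cong (- 1ℚ * sgn k *_) (*-recip-sucʳ k)) (ℚ.*-identityʳ (- 1ℚ * sgn k)))))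
    where
    1+k<p : suc k ℕ.< p
    1+k<p = ℕ.≤-<-trans k<2n 2n<p
    factor : ℕ→ℚ (n ℕ.+ n) - ℕ→ℚ k Mod-p.≈ - ℕ→ℚ (suc k)
    factor = Mod-p.congruent 1ℚ (integral-ℕ 1) (trans (eq (ℕ→ℚ (n ℕ.+ n)) (ℕ→ℚ k))
      (cong₂ (λ s t → - s + t * 1ℚ) (sym (ℕ→ℚ-suc k)) (trans (sym (ℕ→ℚ-suc (n ℕ.+ n))) (cong ℕ→ℚ (sym p≡1+2n)))))
      where
      eq : ∀ m k → m - k ≡ - (k + 1ℚ) + (m + 1ℚ) * 1ℚ
      eq = solve-∀ ring
    regroup : ∀ s k r → s * - k * r ≡ - 1ℚ * s * (k * r)
    regroup = solve-∀ ring

  -- Reflecting j to p - j pairs the terms of the alternating harmonic sum up to p - 1.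
  harmonic-double : harmonic (n ℕ.+ n) Mod-p.≈ ℕ→ℚ 2 * harmonic n
  harmonic-double = Mod-p.≈-trans (Mod-p.reflexive (trans (Σ<-split n n h) (cong (λ t → harmonic n + t) (Σ<-reverse n (λ k → h (n ℕ.+ k))))))
    (Mod-p.≈-trans (Mod-p.+-cong (Mod-p.≈-refl {harmonic n}) (Mod-p.Σ<-cong n reflect)) (Mod-p.reflexive (double (harmonic n))))
    where
    h : ℕ → ℚ
    h k = sgn k * recip (ℕ→ℚ (suc k))
    double : ∀ a → a + a ≡ ℕ→ℚ 2 * a
    double = solve-∀ ring
    reflect : ∀ k → k ℕ.< n → h (n ℕ.+ (n ℕ.∸ suc k)) Mod-p.≈ h k
    reflect k k<n = Mod-p.congruent (- (sgn k * (x * y))) (integral-neg (integral-* (integral-sgn k) (integral-* (integral-recip 1+i<p) (integral-recip 1+k<p)))) (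
      trans (cong (_* x) sgn-i) (trans (insert (sgn k) x y) (trans (cong₂ (λ s t → sgn k * y + (- (sgn k * (x * s)) - sgn k * (t * y))) (sym ky≡1) (sym ix≡1))
        (trans (regroup (sgn k) x y (ℕ→ℚ (suc k)) (ℕ→ℚ (suc i))) (cong (λ t → sgn k * y + t * - (sgn k * (x * y))) sum)))))
      where
      i : ℕ
      i = n ℕ.+ (n ℕ.∸ suc k)
      i+1+k≡2n : i ℕ.+ suc k ≡ n ℕ.+ n
      i+1+k≡2n = trans (ℕ.+-assoc n (n ℕ.∸ suc k) (suc k)) (cong (n ℕ.+_) (ℕ.m∸n+n≡m k<n))
      1+i<p : suc i ℕ.< p
      1+i<p = ℕ.≤-<-trans (ℕ.≤-trans (ℕ.≤-trans (ℕ.≤-reflexive (ℕ.+-comm 1 i)) (ℕ.+-monoʳ-≤ i (s≤s z≤n))) (ℕ.≤-reflexive i+1+k≡2n)) 2n<p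
      1+k<p : suc k ℕ.< p
      1+k<p = ℕ.≤-<-trans (ℕ.≤-trans k<n (ℕ.m≤m+n n n)) 2n<p
      x y : ℚ
      x = recip (ℕ→ℚ (suc i))
      y = recip (ℕ→ℚ (suc k))
      ix≡1 : ℕ→ℚ (suc i) * x ≡ 1ℚ
      ix≡1 = *-recip-sucʳ i
      ky≡1 : ℕ→ℚ (suc k) * y ≡ 1ℚ
      ky≡1 = *-recip-sucʳ k
      sum : ℕ→ℚ (suc k) + ℕ→ℚ (suc i) ≡ P
      sum = trans (sym (ℕ→ℚ-+ (suc k) (suc i))) (cong ℕ→ℚ (trans (ℕ.+-comm (suc k) (suc i)) (trans (cong suc i+1+k≡2n) (sym p≡1+2n))))
      sgn-i : sgn i ≡ - sgn k
      sgn-i = trans (sym (ℚ.*-identityʳ (sgn i))) (trans (cong (sgn i *_) (sym (sgn² (suc k)))) (trans (sym (ℚ.*-assoc (sgn i) (sgn (suc k)) (sgn (suc k))))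
        (trans (cong (_* sgn (suc k)) (trans (sym (^-+ (- 1ℚ) i (suc k))) (trans (cong sgn i+1+k≡2n) (sgn-even n)))) (trans (ℚ.*-identityˡ (sgn (suc k))) (sgn-suc k)))))
      insert : ∀ s x y → - s * x ≡ s * y + (- (s * (x * 1ℚ)) - s * (1ℚ * y))
      insert = solve-∀ ring
      regroup : ∀ s x y k i → s * y + (- (s * (x * (k * y))) - s * (i * x * y)) ≡ s * y + (k + i) * - (s * (x * y))
      regroup = solve-∀ ring

  -- The inner binomial coefficients of 2^p sum to 2^p - 2, and C(p,k+1) = p/(k+1) · C(p-1,k) ≡
  -- (-1)^k p/(k+1) modulo p². Hence p times the full alternating sum is 2^p - 2, and
  -- `harmonic-double` allows both sides to be halved.
  P*harmonic : P * harmonic n ≈ ℕ→ℚ (2 ℕ.^ (n ℕ.+ n)) - 1ℚ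
  P*harmonic = begin
    P * harmonic n                                   ≡⟨ halve P (harmonic n) ⟩
    ½ * (P * (ℕ→ℚ 2 * harmonic n))                   ≈⟨ *-congˡ ½-integral (*P-lift harmonic-double) ⟨
    ½ * (P * harmonic (n ℕ.+ n))                     ≡⟨ cong (½ *_) (Σ<-*ˡ (n ℕ.+ n) P (λ k → sgn k * recip (ℕ→ℚ (suc k)))) ⟨
    ½ * Σ< (n ℕ.+ n) (λ k → P * (sgn k * recip (ℕ→ℚ (suc k))))
      ≈⟨ *-congˡ ½-integral (Σ<-cong (n ℕ.+ n) term) ⟨
    ½ * Σ< (n ℕ.+ n) (λ k → β P (suc k))             ≡⟨ cong (½ *_) inner ⟩
    ½ * (ℕ→ℚ 2 * ℕ→ℚ 2 ^ (n ℕ.+ n) - 1ℚ - 1ℚ)        ≡⟨ collect (ℕ→ℚ 2 ^ (n ℕ.+ n)) ⟩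
    ℕ→ℚ 2 ^ (n ℕ.+ n) - 1ℚ                           ≡⟨ cong (_- 1ℚ) (ℕ→ℚ-^ 2 (n ℕ.+ n)) ⟨
    ℕ→ℚ (2 ℕ.^ (n ℕ.+ n)) - 1ℚ                       ∎
    where
    halve : ∀ p h → p * h ≡ ½ * (p * (ℕ→ℚ 2 * h))
    halve = solve-∀ ring
    collect : ∀ t → ½ * (ℕ→ℚ 2 * t - 1ℚ - 1ℚ) ≡ t - 1ℚ
    collect = solve-∀ ring
    P-1≡ : P - 1ℚ ≡ ℕ→ℚ (n ℕ.+ n)
    P-1≡ = trans (cong (λ t → ℕ→ℚ t - 1ℚ) p≡1+2n) (ℕ→ℚ-suc-1 (n ℕ.+ n))
    term : ∀ k → k ℕ.< n ℕ.+ n → β P (suc k) ≈ P * (sgn k * recip (ℕ→ℚ (suc k)))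
    term k k<2n = ≈-trans (reflexive (trans (divide (ℕ→ℚ-suc≢0 {k}) (trans (β-absorb P k) (cong (λ z → P * β z k) P-1≡))) (ℚ.*-assoc P (β (ℕ→ℚ (n ℕ.+ n)) k) (recip (ℕ→ℚ (suc k))))))
      (*P-lift (Mod-p.*-congʳ (integral-recip (ℕ.≤-<-trans k<2n 2n<p)) ([-1-]-binomial k (ℕ.<⇒≤ k<2n))))
    total : Σ< (suc p) (β P) ≡ ℕ→ℚ 2 ^ p
    total = trans (cong (λ t → Σ< t (β P)) (cong suc (sym (ℕ.+-identityʳ p)))) (Σβ≡2^ p 0)
    last : β P p ≡ 1ℚ
    last = trans (sym (β-nCk p p)) (cong ℕ→ℚ (nCn≡1 p))
    inner : Σ< (n ℕ.+ n) (λ k → β P (suc k)) ≡ ℕ→ℚ 2 * ℕ→ℚ 2 ^ (n ℕ.+ n) - 1ℚ - 1ℚ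
    inner = trans (isolate (Σ< (n ℕ.+ n) (λ k → β P (suc k)))) (cong (λ t → t - 1ℚ - 1ℚ) (trans (cong₂ _+_ (trans (sym (Σ<-peel (n ℕ.+ n) (β P))) (cong (λ t → Σ< t (β P)) (sym p≡1+2n))) (sym last))
      (trans total (cong (ℕ→ℚ 2 ^_) p≡1+2n))))
      where
      isolate : ∀ s → s ≡ 1ℚ + s + 1ℚ - 1ℚ - 1ℚ
      isolate = solve-∀ ring

  -- Fermat's theorem for the base 2, read off from `P*harmonic`, whose left side is a multiple of
  -- p.
  2^[p-1]≈1 : ℕ→ℚ (2 ℕ.^ (n ℕ.+ n)) Mod-p.≈ 1ℚ
  2^[p-1]≈1 = Mod-p.≈-trans (Mod-p.reflexive (shift (ℕ→ℚ (2 ℕ.^ (n ℕ.+ n))))) (Mod-p.≈-trans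
    (Mod-p.+-cong (Mod-p.≈-trans (Mod-p.≈-sym (≈⇒≈-mod-p P*harmonic)) (Mod-p.multiple≈0 (harmonic-integral n (ℕ.<-trans (ℕ.n<1+n n) 1+n<p)))) (Mod-p.≈-refl {1ℚ}))
    (Mod-p.reflexive (ℚ.+-identityˡ 1ℚ)))
    where
    shift : ∀ a → a ≡ a - 1ℚ + 1ℚ
    shift = solve-∀ ring

16^≡2^ : ∀ r → ℕ→ℚ 16 ^ r ≡ ℕ→ℚ 2 ^ (r ℕ.+ r ℕ.+ (r ℕ.+ r))
16^≡2^ r = trans (^-distrib-* (ℕ→ℚ 4) (ℕ→ℚ 4) r) (trans (cong₂ _*_ 4^≡ 4^≡) (sym (^-+ (ℕ→ℚ 2) (r ℕ.+ r) (r ℕ.+ r))))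
  where
  4^≡ : ℕ→ℚ 4 ^ r ≡ ℕ→ℚ 2 ^ (r ℕ.+ r)
  4^≡ = trans (^-distrib-* (ℕ→ℚ 2) (ℕ→ℚ 2) r) (sym (^-+ (ℕ→ℚ 2) r r))

[-16]^≡ : ∀ r → (- ℕ→ℚ 16) ^ r ≡ sgn r * ℕ→ℚ 2 ^ (r ℕ.+ r ℕ.+ (r ℕ.+ r))
[-16]^≡ r = trans (^-distrib-* (- 1ℚ) (ℕ→ℚ 16) r) (cong (sgn r *_) (16^≡2^ r))

central≡ : ∀ r → central r ≡ ℕ→ℚ ((r ℕ.+ r) C r)
central≡ r = cong (λ t → ℕ→ℚ ((r ℕ.+ t) C r)) (ℕ.+-identityʳ r)

-- The two sums of the theorem in terms of F at 1/2 and -1/2.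

module Sums (p : ℕ) (prime : Prime p) (n : ℕ) (p≡1+2n : p ≡ suc (n ℕ.+ n)) where
  open ShiftedSums p prime n p≡1+2n public
  open QuadraticCharacter p prime n p≡1+2n using (0<n; 2n<p) public
  open import Relation.Binary.Reasoning.Setoid ≈-setoid

  Σterm1 : Σ< p term1 ≡ 𝓕 (at (suc n))
  Σterm1 = trans (Σ<-ext p term1-β) (trans (cong (λ m → F m ½) p≡1+2n) (cong 𝓕 ½≡at))

  -- Comes from `T-F` at a = 1/2. Its extra square β(-1/2,p-1)² is dropped, since -1/2 = n - τ and n
  -- < p - 1.
  Σterm2 : Σ< p term2 ≈ - (½ * 𝓕 (at (suc n))) - 𝓕 (at n)
  Σterm2 = begin
    Σ< p term2
      ≡⟨ trans (Σ<-ext p term2-β) (trans (Σ<-neg p (λ k → sgn k * (β ½ k * β (½ - 1ℚ) k))) (cong (λ m → - T m ½) p≡1+2n)) ⟩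
    - T (suc (n ℕ.+ n)) ½
      ≡⟨ isolate (T (suc (n ℕ.+ n)) ½) boundary ⟩
    - (½ * (ℕ→ℚ 2 * T (suc (n ℕ.+ n)) ½ + boundary)) + ½ * boundary
      ≡⟨ cong (λ t → - (½ * t) + ½ * boundary) (trans (T-F (n ℕ.+ n) ½) (cong₂ (λ s t → ℕ→ℚ 2 * 𝓕 s + 𝓕 t) ½-1≡at ½≡at)) ⟩
    - (½ * (ℕ→ℚ 2 * 𝓕 (at n) + 𝓕 (at (suc n)))) + ½ * boundary
      ≈⟨ +-cong (≈-refl { - (½ * (ℕ→ℚ 2 * 𝓕 (at n) + 𝓕 (at (suc n))))}) (≈-trans (*-congˡ ½-integral boundary≈0) (reflexive (ℚ.*-zeroʳ ½))) ⟩
    - (½ * (ℕ→ℚ 2 * 𝓕 (at n) + 𝓕 (at (suc n)))) + 0ℚ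
      ≡⟨ collect (𝓕 (at n)) (𝓕 (at (suc n))) ⟩
    - (½ * 𝓕 (at (suc n))) - 𝓕 (at n) ∎
    where
    ½-1≡at : ½ - 1ℚ ≡ at n
    ½-1≡at = trans (cong (_- 1ℚ) ½≡at) (at-pred n)
    boundary : ℚ
    boundary = sgn (n ℕ.+ n) * (β (½ - 1ℚ) (n ℕ.+ n) * β (½ - 1ℚ) (n ℕ.+ n))
    boundary≈0 : boundary ≈ 0ℚ
    boundary≈0 = subst (λ z → sgn (n ℕ.+ n) * (β z (n ℕ.+ n) * β z (n ℕ.+ n)) ≈ 0ℚ) (sym ½-1≡at)
      (summand≈0 n (n ℕ.+ n) (ℕ.m<m+n n 0<n) 2n<p)
    isolate : ∀ t b → - t ≡ - (½ * (ℕ→ℚ 2 * t + b)) + ½ * b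
    isolate = solve-∀ ring
    collect : ∀ f g → - (½ * (ℕ→ℚ 2 * f + g)) + 0ℚ ≡ - (½ * g) - f
    collect = solve-∀ ring

  ℕ→ℚ-1+2n : P ≡ ℕ→ℚ 2 * ℕ→ℚ n + 1ℚ
  ℕ→ℚ-1+2n = trans (cong ℕ→ℚ p≡1+2n) (ℕ→ℚ-1+double n)

-- The case p = 4r + 1: the index (p+1)/2 = 2r + 1 lies on the odd chain.

module OneModFour (p : ℕ) (prime : Prime p) (r : ℕ) (p≡1+4r : p ≡ suc (r ℕ.+ r ℕ.+ (r ℕ.+ r))) where
  open Sums p prime (r ℕ.+ r) p≡1+4r
  open GaussCongruence p prime r p≡1+4r using (gauss)

  suc2r<p : suc (r ℕ.+ r) ℕ.< p
  suc2r<p = QuadraticCharacter.1+n<p p prime (r ℕ.+ r) p≡1+4r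

  e : ℚ
  e = oddRatio r

  e-integral : Integral e
  e-integral = oddRatio-integral r suc2r<p

  C≈2x : ∀ x y → + p ≡ x ℤ.* x ℤ.+ + 4 ℤ.* (y ℤ.* y) → (+ 4) ∣ℤ (x ℤ.- + 1) → central r Mod-p.≈ ℕ→ℚ 2 * ℤ→ℚ x
  C≈2x x y p≡x²+4y² 4∣x-1 = Mod-p.congruent (ℤ→ℚ q) (integral-ℤ q) (trans (central≡ r) (trans (cong ℤ→ℚ eq)
      (trans (ℤ→ℚ-+ (+ 2 ℤ.* x) (q ℤ.* + p)) (cong₂ _+_ (ℤ→ℚ-* (+ 2) x) (trans (ℤ→ℚ-* q (+ p)) (ℚ.*-comm (ℤ→ℚ q) P))))))
    where
    open Congruence p using (_≈_) renaming (module _≈_ to cong-mod)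
    q : ℤ
    q = cong-mod.quotient (gauss x y p≡x²+4y² 4∣x-1)
    eq : + ((r ℕ.+ r) C r) ≡ + 2 ℤ.* x ℤ.+ q ℤ.* + p
    eq = cong-mod.equality (gauss x y p≡x²+4y² 4∣x-1)

  -- As 2 (2r+1) = p + 1 ≡ 1, half of e C(2r,r) is congruent to (2r+1) e C(2r,r) = (-16)^r = (-1)^r
  -- 2^(p-1), and Fermat removes the power of 2. Gauss's congruence identifies half of C(2r,r) with
  -- x.
  e*x≈ : ∀ x y → + p ≡ x ℤ.* x ℤ.+ + 4 ℤ.* (y ℤ.* y) → (+ 4) ∣ℤ (x ℤ.- + 1) → e * ℤ→ℚ x Mod-p.≈ sgn r
  e*x≈ x y p≡x²+4y² 4∣x-1 = begin
    e * ℤ→ℚ x                                      ≡⟨ halve e (ℤ→ℚ x) ⟩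
    ½ * (e * (ℕ→ℚ 2 * ℤ→ℚ x))                      ≈⟨ Mod-p.*-congˡ ½-integral (Mod-p.*-congˡ e-integral (C≈2x x y p≡x²+4y² 4∣x-1)) ⟨
    ½ * (e * central r)                            ≡⟨ split (½ * (e * central r)) P ⟩
    (P + 1ℚ) * (½ * (e * central r)) + P * - (½ * (e * central r))
      ≈⟨ Mod-p.+-cong (Mod-p.≈-refl {(P + 1ℚ) * (½ * (e * central r))}) (Mod-p.multiple≈0 (integral-neg (integral-* ½-integral (integral-* e-integral (integral-ℕ ((2 ℕ.* r) C r)))))) ⟩
    (P + 1ℚ) * (½ * (e * central r)) + 0ℚ          ≡⟨ cong (λ t → (t + 1ℚ) * (½ * (e * central r)) + 0ℚ) ℕ→ℚ-1+2n ⟩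
    (ℕ→ℚ 2 * ℕ→ℚ (r ℕ.+ r) + 1ℚ + 1ℚ) * (½ * (e * central r)) + 0ℚ
      ≡⟨ trans (collect (ℕ→ℚ (r ℕ.+ r)) e (central r)) (cong (λ t → e * (t * central r)) (sym (ℕ→ℚ-suc (r ℕ.+ r)))) ⟩
    e * (ℕ→ℚ (suc (r ℕ.+ r)) * central r)          ≡⟨ trans (oddRatio-central r) ([-16]^≡ r) ⟩
    sgn r * ℕ→ℚ 2 ^ (r ℕ.+ r ℕ.+ (r ℕ.+ r))        ≡⟨ cong (sgn r *_) (ℕ→ℚ-^ 2 (r ℕ.+ r ℕ.+ (r ℕ.+ r))) ⟨
    sgn r * ℕ→ℚ (2 ℕ.^ (r ℕ.+ r ℕ.+ (r ℕ.+ r)))    ≈⟨ Mod-p.*-congˡ (integral-sgn r) 2^[p-1]≈1 ⟩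
    sgn r * 1ℚ                                     ≡⟨ ℚ.*-identityʳ (sgn r) ⟩
    sgn r                                          ∎
    where
    open import Relation.Binary.Reasoning.Setoid Mod-p.≈-setoid
    halve : ∀ e x → e * x ≡ ½ * (e * (ℕ→ℚ 2 * x))
    halve = solve-∀ ring
    split : ∀ a p → a ≡ (p + 1ℚ) * a + p * - a
    split = solve-∀ ring
    collect : ∀ n e c → (ℕ→ℚ 2 * n + 1ℚ + 1ℚ) * (½ * (e * c)) + 0ℚ ≡ e * ((n + 1ℚ) * c)
    collect = solve-∀ ring

  theorem : ∀ x y → + p ≡ x ℤ.* x ℤ.+ + 4 ℤ.* (y ℤ.* y) → (+ 4) ∣ℤ (x ℤ.- + 1) →
            Cong p (Σ< p term1) (sgn r * (P ÷ ℤ→ℚ x)) (ℕ→ℚ (p ℕ.* p))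
  theorem x y p≡x²+4y² 4∣x-1 = ≈⇒Cong (begin
    Σ< p term1                           ≡⟨ Σterm1 ⟩
    𝓕 (at (suc (r ℕ.+ r)))               ≈⟨ 𝓕-odd r suc2r<p ⟩
    P * e                                ≈⟨ *P-lift (solve-for x r e-integral (e*x≈ x y p≡x²+4y² 4∣x-1)) ⟩
    P * (sgn r * recip (ℤ→ℚ x))          ≡⟨ swap P (sgn r) (recip (ℤ→ℚ x)) ⟩
    sgn r * (P * recip (ℤ→ℚ x))          ∎)
    where
    open import Relation.Binary.Reasoning.Setoid ≈-setoid
    swap : ∀ a b c → a * (b * c) ≡ b * (a * c)
    swap = solve-∀ ring

-- The case p = 4r + 3: 1/2 lies on the even chain and -1/2 on the odd one.

module ThreeModFour (p : ℕ) (prime : Prime p) (r : ℕ) (p≡3+4r : p ≡ suc (suc (r ℕ.+ r) ℕ.+ suc (r ℕ.+ r))) where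
  n : ℕ
  n = suc (r ℕ.+ r)

  open Sums p prime n p≡3+4r
  open QuadraticCharacter p prime n p≡3+4r using (1+n<p)
  open import Relation.Binary.Reasoning.Setoid ≈-setoid

  B Q : ℚ
  B = ℕ→ℚ (n C r)
  Q = ℕ→ℚ (2 ℕ.* p ℕ.+ 3) - ℕ→ℚ (2 ℕ.^ (n ℕ.+ n))

  Q≡ : Q ≡ ℕ→ℚ 2 * P + ℕ→ℚ 3 - ℕ→ℚ (2 ℕ.^ (n ℕ.+ n))
  Q≡ = cong (_- ℕ→ℚ (2 ℕ.^ (n ℕ.+ n))) (trans (ℕ→ℚ-+ (2 ℕ.* p) 3) (cong (_+ ℕ→ℚ 3) (ℕ→ℚ-* 2 p)))

  central-suc-r : central (suc r) ≡ ℕ→ℚ 2 * B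
  central-suc-r = trans (central≡ (suc r)) (trans (cong (λ t → ℕ→ℚ (t C suc r)) (cong suc (ℕ.+-suc r r))) (*-cancelˡ-≢0 (ℕ→ℚ-suc≢0 {r}) (
    trans (sym (ℕ→ℚ-* (suc r) (suc n C suc r))) (trans (cong ℕ→ℚ ([1+k]*[1+n]C[1+k]≡[1+n]*nCk n r)) (trans (ℕ→ℚ-* (suc n) (n C r))
      (trans (cong (_* B) (ℕ→ℚ-2+double r)) (swap (ℕ→ℚ (suc r)) B)))))))
    where
    swap : ∀ a b → ℕ→ℚ 2 * a * b ≡ a * (ℕ→ℚ 2 * b)
    swap = solve-∀ ring

  -- Since n is odd, the last harmonic term is -1/(n+1) = -2/(p+1), which contributes p/(p+1) ≡ p.
  -- The rest gives -(2^(p-1) - 1)/2 by `P*harmonic`, and 1 + p - (2^(p-1) - 1)/2 is half of 2p + 3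
  -- - 2^(p-1).
  factor≈ : 1ℚ - τ * harmonic (suc n) ≈ ½ * Q
  factor≈ = begin
    1ℚ - τ * (harmonic n + - 1ℚ * sgn (r ℕ.+ r) * R)
      ≡⟨ cong (λ s → 1ℚ - τ * (harmonic n + - 1ℚ * s * R)) (sgn-even r) ⟩
    1ℚ - τ * (harmonic n + - 1ℚ * 1ℚ * R)
      ≡⟨ expand P (harmonic n) R ⟩
    1ℚ - ½ * (P * harmonic n) + ½ * P * ((P + 1ℚ) * R) + P * P * - (½ * R)
      ≈⟨ +-cong (+-cong (+-cong (≈-refl {1ℚ}) (-‿cong (*-congˡ ½-integral P*harmonic))) (reflexive (cong (½ * P *_) [P+1]R≡2)))
           (multiple≈0 (integral-neg (integral-* ½-integral (integral-recip 1+n<p)))) ⟩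
    1ℚ - ½ * (ℕ→ℚ (2 ℕ.^ (n ℕ.+ n)) - 1ℚ) + ½ * P * ℕ→ℚ 2 + 0ℚ
      ≡⟨ collect P (ℕ→ℚ (2 ℕ.^ (n ℕ.+ n))) ⟩
    ½ * (ℕ→ℚ 2 * P + ℕ→ℚ 3 - ℕ→ℚ (2 ℕ.^ (n ℕ.+ n)))
      ≡⟨ cong (½ *_) Q≡ ⟨
    ½ * Q ∎
    where
    R : ℚ
    R = recip (ℕ→ℚ (suc n))
    expand : ∀ p h r → 1ℚ - ½ * p * (h + - 1ℚ * 1ℚ * r) ≡ 1ℚ - ½ * (p * h) + ½ * p * ((p + 1ℚ) * r) + p * p * - (½ * r)
    expand = solve-∀ ring
    collect : ∀ p t → 1ℚ - ½ * (t - 1ℚ) + ½ * p * ℕ→ℚ 2 + 0ℚ ≡ ½ * (ℕ→ℚ 2 * p + ℕ→ℚ 3 - t)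
    collect = solve-∀ ring
    double : ∀ n r → (ℕ→ℚ 2 * n + 1ℚ + 1ℚ) * r ≡ ℕ→ℚ 2 * ((n + 1ℚ) * r)
    double = solve-∀ ring
    [P+1]R≡2 : (P + 1ℚ) * R ≡ ℕ→ℚ 2
    [P+1]R≡2 = trans (cong (λ t → (t + 1ℚ) * R) ℕ→ℚ-1+2n) (trans (double (ℕ→ℚ n) R)
      (trans (cong (λ t → ℕ→ℚ 2 * (t * R)) (sym (ℕ→ℚ-suc n))) (cong (ℕ→ℚ 2 *_) (*-recip-sucʳ n))))

  -- The even chain ends at index 2 (r+1) with C(2r+2,r+1) = 2 C(2r+1,r); this 2 cancels the 1/2 of
  -- `factor≈`.
  𝓕½≈ : 𝓕 (at (suc n)) ≈ sgn (suc r) * (Q * B)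
  𝓕½≈ = begin
    𝓕 (at (suc n))                                             ≡⟨ cong (λ t → 𝓕 (at t)) 2h≡ ⟨
    𝓕 (at (suc r ℕ.+ suc r))                                   ≈⟨ 𝓕-even (suc r) (subst (ℕ._< p) (sym 2h≡) 1+n<p) ⟩
    signedCentral (suc r) * (1ℚ - τ * harmonic (suc r ℕ.+ suc r)) ≡⟨ cong (λ t → signedCentral (suc r) * (1ℚ - τ * harmonic t)) 2h≡ ⟩
    signedCentral (suc r) * (1ℚ - τ * harmonic (suc n))        ≈⟨ *-congˡ (signedCentral-integral (suc r)) factor≈ ⟩
    sgn (suc r) * central (suc r) * (½ * Q)                    ≡⟨ cong (λ t → sgn (suc r) * t * (½ * Q)) central-suc-r ⟩
    sgn (suc r) * (ℕ→ℚ 2 * B) * (½ * Q)                        ≡⟨ collect (sgn (suc r)) B Q ⟩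
    sgn (suc r) * (Q * B)                                      ∎
    where
    2h≡ : suc r ℕ.+ suc r ≡ suc n
    2h≡ = cong suc (ℕ.+-suc r r)
    collect : ∀ s b q → s * (ℕ→ℚ 2 * b) * (½ * q) ≡ s * (q * b)
    collect = solve-∀ ring

  e : ℚ
  e = oddRatio r

  e-integral : Integral e
  e-integral = oddRatio-integral r (ℕ.<-trans (ℕ.n<1+n n) 1+n<p)

  -- Absorption turns the left side into (r+1) C(2r+1,r+1), and the two middle coefficients of an
  -- odd row agree.
  nC[1+r]≡B : ℕ→ℚ (suc (r ℕ.+ r)) * central r ≡ ℕ→ℚ (suc r) * B
  nC[1+r]≡B = trans (cong (ℕ→ℚ (suc (r ℕ.+ r)) *_) (central≡ r)) (trans (sym (ℕ→ℚ-* (suc (r ℕ.+ r)) ((r ℕ.+ r) C r)))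
    (trans (cong ℕ→ℚ (trans (sym ([1+k]*[1+n]C[1+k]≡[1+n]*nCk (r ℕ.+ r) r)) (cong (suc r ℕ.*_) symmetric))) (ℕ→ℚ-* (suc r) (n C r))))
    where
    symmetric : n C suc r ≡ n C r
    symmetric = sym (trans (nCk≡nC[n∸k] (ℕ.≤-trans (ℕ.m≤m+n r r) (ℕ.n≤1+n (r ℕ.+ r)))) (cong (n C_) (ℕ.m+n∸n≡m (suc r) r)))

  -- Here p + 1 = 4 (r+1), so e B ≡ (p+1) e B = 4 e (2r+1) C(2r,r) = 4 (-16)^r = (-1)^r 2^(p-1),
  -- which Fermat reduces to (-1)^r.
  e*B≈ : e * B Mod-p.≈ sgn r
  e*B≈ = Mod-p.≈-trans (Mod-p.reflexive (multiple (e * B) P)) (Mod-p.≈-trans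
      (Mod-p.+-cong (Mod-p.≈-trans (Mod-p.reflexive [P+1]eB≡) (Mod-p.*-congˡ (integral-sgn r) 2^[p-1]≈1)) (Mod-p.multiple≈0 (integral-neg (integral-* e-integral (integral-ℕ (n C r))))))
      (Mod-p.reflexive (trans (ℚ.+-identityʳ (sgn r * 1ℚ)) (ℚ.*-identityʳ (sgn r)))))
    where
    multiple : ∀ a p → a ≡ (p + 1ℚ) * a + p * - a
    multiple = solve-∀ ring
    collect : ∀ r e b → (ℕ→ℚ 2 * (ℕ→ℚ 2 * r + 1ℚ) + 1ℚ + 1ℚ) * (e * b) ≡ ℕ→ℚ 4 * (e * ((r + 1ℚ) * b))
    collect = solve-∀ ring
    expand : ∀ s t → ℕ→ℚ 4 * (s * t) ≡ s * (ℕ→ℚ 2 * (ℕ→ℚ 2 * t))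
    expand = solve-∀ ring
    exponent : suc (suc (r ℕ.+ r ℕ.+ (r ℕ.+ r))) ≡ n ℕ.+ n
    exponent = cong suc (sym (ℕ.+-suc (r ℕ.+ r) (r ℕ.+ r)))
    [P+1]eB≡ : (P + 1ℚ) * (e * B) ≡ sgn r * ℕ→ℚ (2 ℕ.^ (n ℕ.+ n))
    [P+1]eB≡ = trans (cong (λ t → (t + 1ℚ) * (e * B)) (trans ℕ→ℚ-1+2n (cong (λ t → ℕ→ℚ 2 * t + 1ℚ) (ℕ→ℚ-1+double r)))) (trans (collect (ℕ→ℚ r) e B)
      (trans (cong (λ t → ℕ→ℚ 4 * (e * t)) (trans (cong (_* B) (sym (ℕ→ℚ-suc r))) (sym nC[1+r]≡B)))
      (trans (cong (ℕ→ℚ 4 *_) (trans (oddRatio-central r) ([-16]^≡ r)))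
      (trans (expand (sgn r) (ℕ→ℚ 2 ^ (r ℕ.+ r ℕ.+ (r ℕ.+ r)))) (cong (sgn r *_) (trans (cong (ℕ→ℚ 2 ^_) exponent) (sym (ℕ→ℚ-^ 2 (n ℕ.+ n)))))))))

  theorem₁ : Cong p (Σ< p term1) (sgn (suc r) * (Q * B)) (ℕ→ℚ (p ℕ.* p))
  theorem₁ = ≈⇒Cong (≈-trans (reflexive Σterm1) 𝓕½≈)

  -- The term F(1/2) gives the part with 2p + 3 - 2^(p-1), its minus sign being absorbed by
  -- (-1)^(r+1). The term F(-1/2) = F(n - τ) is p times `oddRatio r`, which `e*B≈` identifies modulo
  -- p with (-1)^r / B.
  theorem₂ : Cong p (Σ< p term2) (recip (ℕ→ℚ 2) * (sgn r * (Q * B)) - sgn r * (P ÷ B)) (ℕ→ℚ (p ℕ.* p))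
  theorem₂ = ≈⇒Cong (begin
    Σ< p term2                                         ≈⟨ Σterm2 ⟩
    - (½ * 𝓕 (at (suc n))) - 𝓕 (at n)                  ≈⟨ +-cong (-‿cong (*-congˡ ½-integral 𝓕½≈)) (-‿cong (≈-trans (𝓕-odd r (ℕ.<-trans (ℕ.n<1+n n) 1+n<p))
                                                            (*P-lift (solve-for (+ (n C r)) r e-integral e*B≈)))) ⟩
    - (½ * (sgn (suc r) * (Q * B))) - P * (sgn r * recip B)   ≡⟨ collect (sgn r) (Q * B) P (recip B) ⟩
    ½ * (sgn r * (Q * B)) - sgn r * (P * recip B)      ∎)
    where
    collect : ∀ s q p b → - (½ * (- 1ℚ * s * q)) - p * (s * b) ≡ ½ * (s * q) - s * (p * b)
    collect = solve-∀ ring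

theorem3p2 : (p : ℕ) → Prime p →
    (p % 4 ≡ 1 →
    (x y : ℤ) → ℤ.+ p ≡ x ℤ.* x ℤ.+ ℤ.+ 4 ℤ.* (y ℤ.* y) → (ℤ.+ 4) ∣ℤ (x ℤ.- ℤ.+ 1) →
    Cong p (Σ< p term1) (sgn ((p ∸ 1) / 4) * (ℕ→ℚ p ÷ ℤ→ℚ x)) (ℕ→ℚ (p ℕ.* p)))
    × (p % 4 ≡ 3 →
    Cong p (Σ< p term1)
    (sgn ((p ℕ.+ 1) / 4) * ((ℕ→ℚ (2 ℕ.* p ℕ.+ 3) - ℕ→ℚ (2 ℕ.^ (p ∸ 1))) * ℕ→ℚ (((p ∸ 1) / 2) C ((p ∸ 3) / 4))))
    (ℕ→ℚ (p ℕ.* p))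
    × Cong p (Σ< p term2)
    ((recip (ℕ→ℚ 2) * (sgn ((p ∸ 3) / 4) * ((ℕ→ℚ (2 ℕ.* p ℕ.+ 3) - ℕ→ℚ (2 ℕ.^ (p ∸ 1))) * ℕ→ℚ (((p ∸ 1) / 2) C ((p ∸ 3) / 4)))))
    - (sgn ((p ∸ 3) / 4) * (ℕ→ℚ p ÷ ℕ→ℚ (((p ∸ 1) / 2) C ((p ∸ 3) / 4)))))
    (ℕ→ℚ (p ℕ.* p)))
theorem3p2 p p-prime = one , three
  where
  r : ℕ
  -- In both residue classes this is the r of the respective module: p = 4r + 1 or p = 4r + 3. The
  -- quotients in the statement are then rewritten in terms of r.
  r = p / 4
  p≡ : ∀ {s} → p % 4 ≡ s → p ≡ s ℕ.+ r ℕ.* 4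
  p≡ eq = trans (m≡m%n+[m/n]*n p 4) (cong (ℕ._+ r ℕ.* 4) eq)
  one : p % 4 ≡ 1 → (x y : ℤ) → ℤ.+ p ≡ x ℤ.* x ℤ.+ ℤ.+ 4 ℤ.* (y ℤ.* y) → (ℤ.+ 4) ∣ℤ (x ℤ.- ℤ.+ 1) →
        Cong p (Σ< p term1) (sgn ((p ∸ 1) / 4) * (ℕ→ℚ p ÷ ℤ→ℚ x)) (ℕ→ℚ (p ℕ.* p))
  one p%4≡1 x y p≡x²+4y² 4∣x-1 = subst (λ t → Cong p (Σ< p term1) (sgn t * (ℕ→ℚ p ÷ ℤ→ℚ x)) (ℕ→ℚ (p ℕ.* p)))
    (sym (trans (cong (λ t → (t ∸ 1) / 4) (p≡ p%4≡1)) (m*n/n≡m r 4)))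
    (OneModFour.theorem p p-prime r (trans (p≡ p%4≡1) (cong suc (four r))) x y p≡x²+4y² 4∣x-1)
    where
    four : ∀ r → r ℕ.* 4 ≡ r ℕ.+ r ℕ.+ (r ℕ.+ r)
    four = ℕSolver.solve-∀
  three : p % 4 ≡ 3 → _
  three p%4≡3 =
      subst₂ (λ i j → Cong p (Σ< p term1) (sgn i * ((ℕ→ℚ (2 ℕ.* p ℕ.+ 3) - ℕ→ℚ (2 ℕ.^ j)) * ℕ→ℚ (((p ∸ 1) / 2) C ((p ∸ 3) / 4)))) (ℕ→ℚ (p ℕ.* p)))
        (sym [p+1]/4≡) (sym p-1≡)
        (subst₂ (λ i j → Cong p (Σ< p term1) (sgn (suc r) * (Q * ℕ→ℚ (i C j))) (ℕ→ℚ (p ℕ.* p))) (sym [p-1]/2≡) (sym [p-3]/4≡) theorem₁)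
    , subst₂ (λ i j → Cong p (Σ< p term2) (recip (ℕ→ℚ 2) * (sgn j * ((ℕ→ℚ (2 ℕ.* p ℕ.+ 3) - ℕ→ℚ (2 ℕ.^ (p ∸ 1))) * ℕ→ℚ (i C j))) - sgn j * (ℕ→ℚ p ÷ ℕ→ℚ (i C j))) (ℕ→ℚ (p ℕ.* p)))
        (sym [p-1]/2≡) (sym [p-3]/4≡)
        (subst (λ m → Cong p (Σ< p term2) (recip (ℕ→ℚ 2) * (sgn r * ((ℕ→ℚ (2 ℕ.* p ℕ.+ 3) - ℕ→ℚ (2 ℕ.^ m)) * B)) - sgn r * (ℕ→ℚ p ÷ B)) (ℕ→ℚ (p ℕ.* p)))
          (sym p-1≡) theorem₂)
    where
    double : ∀ r → 3 ℕ.+ r ℕ.* 4 ≡ suc (suc (r ℕ.+ r) ℕ.+ suc (r ℕ.+ r))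
    double = ℕSolver.solve-∀
    half : ∀ r → suc (r ℕ.+ r) ℕ.+ suc (r ℕ.+ r) ≡ suc (r ℕ.+ r) ℕ.* 2
    half = ℕSolver.solve-∀
    p≡3+4r : p ≡ suc (suc (r ℕ.+ r) ℕ.+ suc (r ℕ.+ r))
    p≡3+4r = trans (p≡ p%4≡3) (double r)
    open ThreeModFour p p-prime r p≡3+4r using (n; B; Q; theorem₁; theorem₂)
    p-1≡ : p ∸ 1 ≡ n ℕ.+ n
    p-1≡ = cong (_∸ 1) p≡3+4r
    [p-1]/2≡ : (p ∸ 1) / 2 ≡ n
    [p-1]/2≡ = trans (cong (_/ 2) (trans p-1≡ (half r))) (m*n/n≡m n 2)
    [p-3]/4≡ : (p ∸ 3) / 4 ≡ r
    [p-3]/4≡ = trans (cong (λ t → (t ∸ 3) / 4) (p≡ p%4≡3)) (m*n/n≡m r 4)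
    [p+1]/4≡ : (p ℕ.+ 1) / 4 ≡ suc r
    [p+1]/4≡ = trans (cong (_/ 4) (trans (ℕ.+-comm p 1) (cong suc (p≡ p%4≡3)))) (m*n/n≡m (suc r) 4)
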